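{- Let $(Z_n(x))_{n\ge1}$ be the polynomials (alternating runs polynomials of type $B$) defined by $Z_1(x)=x$ and $$Z_n(x)=\bigl[(2n-2)x^2+3x-1\bigr]Z_{n-1}(x)+2x(1-x^2)\,\frac{d}{dx}Z_{n-1}(x)\qquad(n\ge 2)$$ (so $Z_2(x)=x+3x^2$). Then the Turán expressions $(Z_{n+1}(x))^2-Z_{n+2}(x)Z_n(x)$ are Hurwitz stable for all $n\ge1$.
   Context: A polynomial $f\in\mathbb{C}[x]$ is Hurwitz stable if it is identically zero or $f(x)\ne0$ whenever $\Re(x)>0$. Combinatorially (not needed for the statement), the coefficient $Z(n,k)$ of $x^k$ in $Z_n(x)$ counts signed permutations $\pi$ of $\{\pm1,\dots,\pm n\}$ with $\pi_1>0$ (and $\pi_0=0$) having $k-1$ indices $i\in\{1,\dots,n-1\}$ with $\pi_{i-1}<\pi_i>\pi_{i+1}$ or $\pi_{i-1}>\pi_i<\pi_{i+1}$, and $Z(n,k)=(2k-1)Z(n-1,k)+3Z(n-1,k-1)+(2n-2k+2)Z(n-1,k-2)$. -}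

module Defs where

open import Algebra.Bundles.Raw using (RawRing)
import Algebra.Definitions.RawMonoid as RawMonoidOps
open import Data.Integer.Base as ℤ using (ℤ)
import Data.Integer.Properties as ℤₚ
open import Data.List.Base using (List; []; _∷_; map; foldr)
open import Data.List.Relation.Unary.All using (All)
open import Data.Nat.Base as ℕ using (ℕ; zero; suc; NonZero)
import Data.Nat.Properties as ℕₚ
open import Data.Product.Base using (∃; _×_; _,_)
open import Data.Rational.Base as ℚ
  using (ℚ; 0ℚ; 1ℚ; ½; ∣_∣; _+_; _*_; _-_; -_; _<_; _≤_; _/_; 1/_)
open import Data.Rational.Properties
open import Data.Rational.Solver using (module +-*-Solver)
open import Data.Sum.Base using (_⊎_)
open import Level using (0ℓ; _⊔_)
open import Relation.Binary.PropositionalEquality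
open import Relation.Nullary.Negation using (¬_)

------------------------------------------------------------------------
-- Real numbers: Cauchy sequences of rationals, with operations acting
-- termwise.  The library has no real numbers.  Two sequences denote the
-- same real number when they are related by _≈ᵣ_.

IsCauchy : (ℕ → ℚ) → Set
IsCauchy s = ∀ ε → 0ℚ < ε →
  ∃ λ N → ∀ {m n} → N ℕ.≤ m → N ℕ.≤ n → ∣ s m - s n ∣ < ε

record ℝ : Set where
  constructor mkℝ
  field
    seq    : ℕ → ℚ
    cauchy : IsCauchy seq

open ℝ public

infix  4 _≈ᵣ_ _<ᵣ_
infixl 6 _+ᵣ_
infixl 7 _*ᵣ_
infix  8 -ᵣ_

_≈ᵣ_ : ℝ → ℝ → Set
x ≈ᵣ y = ∀ ε → 0ℚ < ε →
  ∃ λ N → ∀ {n} → N ℕ.≤ n → ∣ seq x n - seq y n ∣ < ε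

_<ᵣ_ : ℝ → ℝ → Set
x <ᵣ y = ∃ λ ε → 0ℚ < ε × ∃ λ N → ∀ {n} → N ℕ.≤ n → seq x n + ε < seq y n

private
  open +-*-Solver using (solve; _:=_; _:+_; _:*_; _:-_; :-_)

  +-rearrange : ∀ a b c d → (a + b) - (c + d) ≡ (a - c) + (b - d)
  +-rearrange = solve 4 (λ a b c d →
    (a :+ b) :- (c :+ d) := (a :- c) :+ (b :- d)) refl

  neg-rearrange : ∀ a b → - (a - b) ≡ (- a) - (- b)
  neg-rearrange = solve 2 (λ a b → :- (a :- b) := (:- a) :- (:- b)) refl

  +-split : ∀ a b → b ≡ a + (b - a)
  +-split = solve 2 (λ a b → b := a :+ (b :- a)) refl

  *-rearrange : ∀ a b c d → a * b - c * d ≡ a * (b - d) + d * (a - c)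
  *-rearrange = solve 4 (λ a b c d →
    a :* b :- c :* d := a :* (b :- d) :+ d :* (a :- c)) refl

  ½-pos : ∀ {ε} → 0ℚ < ε → 0ℚ < ½ * ε
  ½-pos {ε} 0<ε = positive⁻¹ _ {{pos*pos⇒pos ½ ε {{ℚ.positive 0<ε}}}}

  ½+½ : ∀ ε → ½ * ε + ½ * ε ≡ ε
  ½+½ ε = trans (sym (*-distribʳ-+ ε ½ ½)) (*-identityˡ ε)

  ≤-⊔ˡ : ∀ {m n k} → m ℕ.⊔ n ℕ.≤ k → m ℕ.≤ k
  ≤-⊔ˡ {m} {n} = ℕₚ.≤-trans (ℕₚ.m≤m⊔n m n)

  ≤-⊔ʳ : ∀ {m n k} → m ℕ.⊔ n ℕ.≤ k → n ℕ.≤ k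
  ≤-⊔ʳ {m} {n} = ℕₚ.≤-trans (ℕₚ.m≤n⊔m m n)

  const-cauchy : ∀ q → IsCauchy (λ _ → q)
  const-cauchy q ε 0<ε =
    0 , λ _ _ → subst (λ d → ∣ d ∣ < ε) (sym (+-inverseʳ q)) 0<ε

  +-cauchy : ∀ s t → IsCauchy s → IsCauchy t → IsCauchy (λ n → s n + t n)
  +-cauchy s t cs ct ε 0<ε with cs (½ * ε) (½-pos 0<ε) | ct (½ * ε) (½-pos 0<ε)
  ... | M , hs | N , ht = M ℕ.⊔ N , λ {m} {n} pm pn → begin-strict
      ∣ (s m + t m) - (s n + t n) ∣
        ≡⟨ cong ∣_∣ (+-rearrange (s m) (t m) (s n) (t n)) ⟩
      ∣ (s m - s n) + (t m - t n) ∣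
        ≤⟨ ∣p+q∣≤∣p∣+∣q∣ (s m - s n) (t m - t n) ⟩
      ∣ s m - s n ∣ + ∣ t m - t n ∣
        <⟨ +-mono-< (hs (≤-⊔ˡ pm) (≤-⊔ˡ pn)) (ht (≤-⊔ʳ {M} pm) (≤-⊔ʳ {M} pn)) ⟩
      ½ * ε + ½ * ε
        ≡⟨ ½+½ ε ⟩
      ε ∎
    where open ≤-Reasoning

  neg-cauchy : ∀ s → IsCauchy s → IsCauchy (λ n → - s n)
  neg-cauchy s cs ε 0<ε with cs ε 0<ε
  ... | N , hs = N , λ {m} {n} pm pn →
      subst (_< ε)
        (trans (sym (∣-p∣≡∣p∣ (s m - s n)))
          (cong ∣_∣ (neg-rearrange (s m) (s n))))
        (hs pm pn)

  bounded : ∀ s → IsCauchy s →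
    ∃ λ B → 0ℚ < B × ∃ λ N → ∀ {n} → N ℕ.≤ n → ∣ s n ∣ < B
  bounded s cs with cs 1ℚ (positive⁻¹ 1ℚ)
  ... | N , hs =
      ∣ s N ∣ + 1ℚ , +-mono-≤-< (0≤∣p∣ (s N)) (positive⁻¹ 1ℚ) ,
      N , λ {n} pn → begin-strict
        ∣ s n ∣                   ≡⟨ cong ∣_∣ (+-split (s N) (s n)) ⟩
        ∣ s N + (s n - s N) ∣     ≤⟨ ∣p+q∣≤∣p∣+∣q∣ (s N) (s n - s N) ⟩
        ∣ s N ∣ + ∣ s n - s N ∣   <⟨ +-mono-≤-< (≤-refl {∣ s N ∣}) (hs pn ℕₚ.≤-refl) ⟩
        ∣ s N ∣ + 1ℚ              ∎
    where open ≤-Reasoning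

  divide : ∀ {B ε} → 0ℚ < B → 0ℚ < ε → ∃ λ δ → 0ℚ < δ × B * δ ≡ ε
  divide {B} {ε} 0<B 0<ε =
      (1/ B) * ε
    , positive⁻¹ _ {{pos*pos⇒pos (1/ B) {{1/pos⇒pos B}} ε}}
    , trans (sym (*-assoc B (1/ B) ε))
        (trans (cong (_* ε) (*-inverseʳ B)) (*-identityˡ ε))
    where
    instance
      _ = ℚ.positive 0<B
      _ = ℚ.positive 0<ε
      _ = pos⇒nonZero B

  ∣*∣-bound : ∀ {a b B δ} → ∣ a ∣ < B → ∣ b ∣ < δ → ∣ a * b ∣ ≤ B * δ
  ∣*∣-bound {a} {b} {B} {δ} a<B b<δ = begin
      ∣ a * b ∣       ≡⟨ ∣p*q∣≡∣p∣*∣q∣ a b ⟩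
      ∣ a ∣ * ∣ b ∣   ≤⟨ *-monoʳ-≤-nonNeg ∣ b ∣ {{ℚ.nonNegative (0≤∣p∣ b)}} (<⇒≤ a<B) ⟩
      B * ∣ b ∣       ≤⟨ *-monoˡ-≤-nonNeg B {{ℚ.nonNegative (≤-trans (0≤∣p∣ a) (<⇒≤ a<B))}} (<⇒≤ b<δ) ⟩
      B * δ           ∎
    where open ≤-Reasoning

  product-bound : ∀ {a b c d B C δ η} →
    ∣ a ∣ < B → ∣ b - d ∣ < δ → ∣ d ∣ < C → ∣ a - c ∣ < η →
    ∣ a * b - c * d ∣ ≤ B * δ + C * η
  product-bound {a} {b} {c} {d} {B} {C} {δ} {η} a<B bd<δ d<C ac<η = begin
      ∣ a * b - c * d ∣
        ≡⟨ cong ∣_∣ (*-rearrange a b c d) ⟩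
      ∣ a * (b - d) + d * (a - c) ∣
        ≤⟨ ∣p+q∣≤∣p∣+∣q∣ (a * (b - d)) (d * (a - c)) ⟩
      ∣ a * (b - d) ∣ + ∣ d * (a - c) ∣
        ≤⟨ +-mono-≤ (∣*∣-bound {a} {b - d} {B} {δ} a<B bd<δ)
                    (∣*∣-bound {d} {a - c} {C} {η} d<C ac<η) ⟩
      B * δ + C * η ∎
    where open ≤-Reasoning

  ½½+½< : ∀ {ε} → 0ℚ < ε → ½ * (½ * ε) + ½ * ε < ε
  ½½+½< {ε} 0<ε = begin-strict
      ½ * (½ * ε) + ½ * ε
        <⟨ +-mono-<-≤ (<-half (½-pos 0<ε)) (≤-refl {½ * ε}) ⟩
      ½ * ε + ½ * ε
        ≡⟨ ½+½ ε ⟩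
      ε ∎
    where
    open ≤-Reasoning
    <-half : ∀ {e} → 0ℚ < e → ½ * e < e
    <-half {e} 0<e = subst₂ _<_ (+-identityˡ (½ * e)) (½+½ e)
      (+-mono-<-≤ (½-pos {e} 0<e) (≤-refl {½ * e}))

  *-cauchy : ∀ s t → IsCauchy s → IsCauchy t → IsCauchy (λ n → s n * t n)
  *-cauchy s t cs ct ε 0<ε =
    let B , 0<B , M₁ , hB = bounded s cs
        C , 0<C , M₂ , hC = bounded t ct
        δ , 0<δ , Bδ = divide {B} 0<B (½-pos (½-pos 0<ε))
        η , 0<η , Cη = divide {C} 0<C (½-pos 0<ε)
        N₁ , ht = ct δ 0<δ
        N₂ , hs = cs η 0<η
    in (M₁ ℕ.⊔ M₂) ℕ.⊔ (N₁ ℕ.⊔ N₂) , λ {m} {n} pm pn →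
      ≤-<-trans
        (product-bound {s m} {t m} {s n} {t n} {B} {C} {δ} {η}
          (hB (≤-⊔ˡ {M₁} {M₂} (≤-⊔ˡ {M₁ ℕ.⊔ M₂} pm)))
          (ht (≤-⊔ˡ {N₁} {N₂} (≤-⊔ʳ {M₁ ℕ.⊔ M₂} pm))
              (≤-⊔ˡ {N₁} {N₂} (≤-⊔ʳ {M₁ ℕ.⊔ M₂} pn)))
          (hC (≤-⊔ʳ {M₁} {M₂} (≤-⊔ˡ {M₁ ℕ.⊔ M₂} pn)))
          (hs (≤-⊔ʳ {N₁} {N₂} (≤-⊔ʳ {M₁ ℕ.⊔ M₂} pm))
              (≤-⊔ʳ {N₁} {N₂} (≤-⊔ʳ {M₁ ℕ.⊔ M₂} pn))))
        (subst₂ (λ u v → u + v < ε) (sym Bδ) (sym Cη) (½½+½< {ε} 0<ε))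

fromℚ : ℚ → ℝ
fromℚ q = mkℝ (λ _ → q) (const-cauchy q)

0ᵣ : ℝ
0ᵣ = fromℚ 0ℚ

_+ᵣ_ _*ᵣ_ : ℝ → ℝ → ℝ
x +ᵣ y = mkℝ (λ n → seq x n + seq y n) (+-cauchy (seq x) (seq y) (cauchy x) (cauchy y))
x *ᵣ y = mkℝ (λ n → seq x n * seq y n) (*-cauchy (seq x) (seq y) (cauchy x) (cauchy y))

-ᵣ_ : ℝ → ℝ
-ᵣ x = mkℝ (λ n → - seq x n) (neg-cauchy (seq x) (cauchy x))

------------------------------------------------------------------------

record ℂ : Set where
  constructor _+i_
  field
    Re Im : ℝ

open ℂ public

fromℤ : ℤ → ℂ
fromℤ k = fromℚ (k / 1) +i 0ᵣ

ℂ-rawRing : RawRing 0ℓ 0ℓ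
ℂ-rawRing = record
  { Carrier = ℂ
  ; _≈_     = λ z w → Re z ≈ᵣ Re w × Im z ≈ᵣ Im w
  ; _+_     = λ z w → (Re z +ᵣ Re w) +i (Im z +ᵣ Im w)
  ; _*_     = λ z w → (Re z *ᵣ Re w +ᵣ -ᵣ (Im z *ᵣ Im w))
                   +i (Re z *ᵣ Im w +ᵣ Im z *ᵣ Re w)
  ; -_      = λ z → (-ᵣ Re z) +i (-ᵣ Im z)
  ; 0#      = fromℤ (ℤ.+ 0)
  ; 1#      = fromℤ (ℤ.+ 1)
  }

------------------------------------------------------------------------
-- Polynomials in one variable: a₀ ∷ a₁ ∷ … ∷ aₙ ∷ [] stands for
-- a₀ + a₁ x + … + aₙ xⁿ, and trailing zero coefficients are allowed.

module Polynomial {c ℓ} (R : RawRing c ℓ) where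

  private module R = RawRing R
  open R using (Carrier; _≈_; 0#; 1#)
  open RawMonoidOps R.+-rawMonoid using () renaming (_×_ to _×ᴿ_)

  Poly : Set c
  Poly = List Carrier

  infixl 6 _⊕_ _⊖_
  infixl 7 _⊗_

  C : Carrier → Poly
  C a = a ∷ []

  X : Poly
  X = 0# ∷ 1# ∷ []

  _⊕_ : Poly → Poly → Poly
  []      ⊕ q       = q
  (a ∷ p) ⊕ []      = a ∷ p
  (a ∷ p) ⊕ (b ∷ q) = a R.+ b ∷ p ⊕ q

  _⊖_ : Poly → Poly → Poly
  p ⊖ q = p ⊕ map R.-_ q

  _⊗_ : Poly → Poly → Poly
  []      ⊗ q = []
  (a ∷ p) ⊗ q = map (a R.*_) q ⊕ (0# ∷ p ⊗ q)

  -- k·a₀ + (k+1)·a₁ x + (k+2)·a₂ x² + …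
  weighted : ℕ → Poly → Poly
  weighted k []      = []
  weighted k (a ∷ p) = k ×ᴿ a ∷ weighted (suc k) p

  derivative : Poly → Poly
  derivative []      = []
  derivative (_ ∷ p) = weighted 1 p

  eval : Poly → Carrier → Carrier
  eval p x = foldr (λ a v → a R.+ x R.* v) 0# p

  IsZero : Poly → Set (c ⊔ ℓ)
  IsZero = All (_≈ 0#)

module ℤ[x] = Polynomial ℤ.+-*-rawRing
module ℂ[x] = Polynomial ℂ-rawRing

HurwitzStable : ℂ[x].Poly → Set
HurwitzStable f =
  ℂ[x].IsZero f ⊎ (∀ z → 0ᵣ <ᵣ Re z → ¬ (ℂ[x].eval f z ≈ 0#))
  where
  open RawRing ℂ-rawRing using (_≈_; 0#)

ℤ[x]⇒ℂ[x] : ℤ[x].Poly → ℂ[x].Poly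
ℤ[x]⇒ℂ[x] = map fromℤ

------------------------------------------------------------------------
-- The alternating runs polynomials of type B are defined in ℤ[x], since
-- their coefficients are integers, and are mapped to ℂ[x] for stability.

open ℤ[x] using (C; X; _⊕_; _⊖_; _⊗_; derivative)

Z : ∀ n → .{{_ : NonZero n}} → ℤ[x].Poly
Z (suc zero)        = X
Z n@(suc m@(suc _)) =
    (C (ℤ.+ 2 ℤ.* ℤ.+ n ℤ.- ℤ.+ 2) ⊗ (X ⊗ X) ⊕ C (ℤ.+ 3) ⊗ X ⊖ C (ℤ.+ 1)) ⊗ Z m
  ⊕ C (ℤ.+ 2) ⊗ X ⊗ (C (ℤ.+ 1) ⊖ X ⊗ X) ⊗ derivative (Z m)

turán : ∀ n → .{{_ : NonZero n}} → ℤ[x].Poly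
turán n = Z (suc n) ⊗ Z (suc n) ⊖ Z (suc (suc n)) ⊗ Z n

{-# OPTIONS --safe #-}
-- Write Z₂ₖ₊₁ = x (1 + x)ᵏ f and Z₂ₖ₊₂ = x (1 + x)ᵏ g.  In passing from f to g and from g to the
-- next f, the value of the new polynomial at a zero in (-1, 0) of the old one is a negative
-- multiple of the derivative of the old one.  Hence the signs alternate, and by induction f and g
-- have simple zeros, all in (-1, 0).
--
-- Let −r run through the zeros of f or g, and put
--   h r = (1 + r) ((1 − r) x² + r x + r) / (x + r)².
-- The logarithmic derivatives turn the Turán expression Zₙ₊₁² − Zₙ₊₂ Zₙ into
--   −2 x (1 + x) Zₙ² (1 + [n odd] · 2 / (1 + x) + 2 Σ h r).
-- Multiplication by x / (1 + x) moves each summand in the last factor into the right half-plane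
-- when Re x > 0, so the sum does not vanish.
--
-- Zeros are only approximated by rationals, so f is a limit of polynomials that split over ℚ.
-- The lower bound for the Turán expression of a split polynomial is uniform on
-- {Re x ≥ ε, |x|² ≤ B} and therefore survives the limits in f and in x.
module Submission where

open import Defs
open import Algebra.Bundles using (CommutativeRing)
open import Algebra.Bundles.Raw using (RawRing)
import Algebra.Definitions.RawMonoid as RawMonoidOps
import Algebra.Solver.Ring
open import Algebra.Solver.Ring.AlmostCommutativeRing
  using (fromCommutativeRing; _-Raw-AlmostCommutative⟶_)
open import Algebra.Structures using (IsCommutativeRing)
open import Data.Empty using (⊥-elim)
open import Data.Integer.Base as ℤ using (ℤ)
import Data.Integer.Properties as ℤₚ
open import Data.List.Base using (List; []; _∷_; _++_; map; foldr; length)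
open import Data.List.Properties using (length-map; length-++)
open import Data.List.Relation.Binary.Pointwise using (Pointwise; []; _∷_)
import Data.List.Relation.Binary.Pointwise as Pointwise
open import Data.Maybe.Base using (Maybe; just; nothing)
open import Data.Nat.Base as ℕ using (ℕ; zero; suc; pred; NonZero)
import Data.Nat.Properties as ℕₚ
open import Data.Product.Base using (∃; _×_; _,_; proj₁; proj₂)
open import Data.Rational.Base as ℚ using (ℚ; 0ℚ; 1ℚ)
import Data.Rational.Properties as ℚₚ
import Data.Rational.Unnormalised.Base as ℚᵘ
import Data.Rational.Unnormalised.Properties as ℚᵘₚ
open import Data.Sum.Base using (_⊎_; inj₁; inj₂)
open import Data.Unit.Base using (⊤; tt)
open import Level using (0ℓ)
open import Relation.Binary.Definitions using (tri<; tri≈; tri>)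
open import Relation.Binary.PropositionalEquality
open import Relation.Nullary.Decidable.Core using (yes; no)
open import Relation.Nullary.Negation using (¬_)

-- Polynomials over ℚ-algebras and their dual numbers

-- The recurrence has order one. Hence, after division by Zₙ², the squares of the logarithmic
-- derivative cancel in the Turán expression, and what remains is affine in the logarithmic
-- derivative and in its derivative. Both are sums over the zeros; this is why a decomposition into
-- summands `h r` exists at all. The obstacle is that exact zeros are out of reach: the sign of a
-- real number cannot be decided, and Cauchy sequences satisfy the ring laws only up to `_≈ᵣ_`. So
-- the induction hypothesis concerns coefficientwise limits of polynomials with distinct rational
-- zeros, where every sign test is decidable. In the limit the zeros may lose their separation, and
-- mere non-vanishing may be lost with it; a quantitative inequality is not. No quotient is formed.
-- Dividing by a Gaussian rational is replaced by multiplying with its conjugate, the factor x / (1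
-- + x) becomes x times the conjugate of 1 + x, and all norms stay squared, so that every estimate
-- is one between rationals. Complex numbers enter only at the very end, term by term.

fromInt : ℤ → ℚ
fromInt k = k ℚ./ 1

private
  toℚᵘ-fromInt : ∀ k → ℚ.toℚᵘ (fromInt k) ℚᵘ.≃ ℚᵘ.mkℚᵘ k 0
  toℚᵘ-fromInt k = ℚₚ.toℚᵘ-fromℚᵘ (ℚᵘ.mkℚᵘ k 0)

fromInt-+ : ∀ i j → fromInt (i ℤ.+ j) ≡ fromInt i ℚ.+ fromInt j
fromInt-+ i j = ℚₚ.toℚᵘ-injective (begin
  ℚ.toℚᵘ (fromInt (i ℤ.+ j))                     ≈⟨ toℚᵘ-fromInt (i ℤ.+ j) ⟩
  ℚᵘ.mkℚᵘ (i ℤ.+ j) 0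
      ≡⟨ cong₂ (λ u v → ℚᵘ.mkℚᵘ (u ℤ.+ v) 0) (ℤₚ.*-identityʳ i) (ℤₚ.*-identityʳ j) ⟨
  ℚᵘ.mkℚᵘ i 0 ℚᵘ.+ ℚᵘ.mkℚᵘ j 0                   ≈⟨ ℚᵘₚ.+-cong (toℚᵘ-fromInt i) (toℚᵘ-fromInt j) ⟨
  ℚ.toℚᵘ (fromInt i) ℚᵘ.+ ℚ.toℚᵘ (fromInt j)     ≈⟨ ℚₚ.toℚᵘ-homo-+ (fromInt i) (fromInt j) ⟨
  ℚ.toℚᵘ (fromInt i ℚ.+ fromInt j)               ∎)
  where open ℚᵘₚ.≃-Reasoning

fromInt-* : ∀ i j → fromInt (i ℤ.* j) ≡ fromInt i ℚ.* fromInt j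
fromInt-* i j = ℚₚ.toℚᵘ-injective (begin
  ℚ.toℚᵘ (fromInt (i ℤ.* j))                     ≈⟨ toℚᵘ-fromInt (i ℤ.* j) ⟩
  ℚᵘ.mkℚᵘ i 0 ℚᵘ.* ℚᵘ.mkℚᵘ j 0                   ≈⟨ ℚᵘₚ.*-cong (toℚᵘ-fromInt i) (toℚᵘ-fromInt j) ⟨
  ℚ.toℚᵘ (fromInt i) ℚᵘ.* ℚ.toℚᵘ (fromInt j)     ≈⟨ ℚₚ.toℚᵘ-homo-* (fromInt i) (fromInt j) ⟨
  ℚ.toℚᵘ (fromInt i ℚ.* fromInt j)               ∎)
  where open ℚᵘₚ.≃-Reasoning

fromInt-neg : ∀ i → fromInt (ℤ.- i) ≡ ℚ.- fromInt i
fromInt-neg i = ℚₚ.toℚᵘ-injective (begin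
  ℚ.toℚᵘ (fromInt (ℤ.- i))                       ≈⟨ toℚᵘ-fromInt (ℤ.- i) ⟩
  ℚᵘ.- ℚᵘ.mkℚᵘ i 0                               ≈⟨ ℚᵘₚ.-‿cong (toℚᵘ-fromInt i) ⟨
  ℚᵘ.- ℚ.toℚᵘ (fromInt i)                        ≈⟨ ℚₚ.toℚᵘ-homo‿- (fromInt i) ⟨
  ℚ.toℚᵘ (ℚ.- fromInt i)                         ∎)
  where open ℚᵘₚ.≃-Reasoning

-- One theory of evaluation serves ℚ (signs), the Gaussian rationals (norms) and the dual numbers
-- over either (derivatives). Laws up to `_≡_` allow values to be rewritten by `cong`.
record ℚ-Algebra : Set₁ where
  infixl 6 _+_
  infixl 7 _*_
  infix  8 -_
  field
    Carrier : Set
    _+_ _*_ : Carrier → Carrier → Carrier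
    -_      : Carrier → Carrier
    ι       : ℚ → Carrier
    isCommutativeRing : IsCommutativeRing _≡_ _+_ _*_ -_ (ι 0ℚ) (ι 1ℚ)
    ι-+     : ∀ p q → ι (p ℚ.+ q) ≡ ι p + ι q
    ι-*     : ∀ p q → ι (p ℚ.* q) ≡ ι p * ι q
    ι-neg   : ∀ p → ι (ℚ.- p) ≡ - ι p

  open IsCommutativeRing isCommutativeRing public
    using (+-assoc; +-comm; +-identityˡ; +-identityʳ; -‿inverseˡ; -‿inverseʳ;
           *-assoc; *-comm; *-identityˡ; *-identityʳ; distribˡ; distribʳ; zeroˡ; zeroʳ)

  commutativeRing : CommutativeRing 0ℓ 0ℓ
  commutativeRing = record { isCommutativeRing = isCommutativeRing }

  ιℤ : ℤ → Carrier
  ιℤ k = ι (fromInt k)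

  # : ℕ → Carrier
  # n = ιℤ (ℤ.+ n)

  ιℤ-+ : ∀ i j → ιℤ (i ℤ.+ j) ≡ ιℤ i + ιℤ j
  ιℤ-+ i j = trans (cong ι (fromInt-+ i j)) (ι-+ _ _)

  ιℤ-* : ∀ i j → ιℤ (i ℤ.* j) ≡ ιℤ i * ιℤ j
  ιℤ-* i j = trans (cong ι (fromInt-* i j)) (ι-* _ _)

  ιℤ-neg : ∀ i → ιℤ (ℤ.- i) ≡ - ιℤ i
  ιℤ-neg i = trans (cong ι (fromInt-neg i)) (ι-neg _)

  private
    morphism : ℤ.+-*-rawRing -Raw-AlmostCommutative⟶ fromCommutativeRing commutativeRing
    morphism = record
      { ⟦_⟧ = ιℤ ; +-homo = ιℤ-+ ; *-homo = ιℤ-* ; -‿homo = ιℤ-neg ; 0-homo = refl ; 1-homo = refl }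

    weaklyDec : ∀ i j → Maybe (ιℤ i ≡ ιℤ j)
    weaklyDec i j with i ℤₚ.≟ j
    ... | yes i≡j = just (cong ιℤ i≡j)
    ... | no _    = nothing

  open Algebra.Solver.Ring ℤ.+-*-rawRing (fromCommutativeRing commutativeRing) morphism weaklyDec
    public using (solve; con; _:=_; _:+_; _:*_; _:-_; :-_) renaming (Polynomial to Expression)

  :# : ∀ {m} → ℕ → Expression m
  :# n = con (ℤ.+ n)

  #-suc : ∀ n → # (suc n) ≡ # 1 + # n
  #-suc n = ιℤ-+ (ℤ.+ 1) (ℤ.+ n)

record Homomorphism (R : RawRing 0ℓ 0ℓ) (𝔸 : ℚ-Algebra) : Set where
  private module R = RawRing R
  open ℚ-Algebra 𝔸
  field
    φ     : R.Carrier → Carrier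
    φ-+   : ∀ a b → φ (a R.+ b) ≡ φ a + φ b
    φ-*   : ∀ a b → φ (a R.* b) ≡ φ a * φ b
    φ-neg : ∀ a → φ (R.- a) ≡ - φ a
    φ-0   : φ R.0# ≡ # 0
    φ-1   : φ R.1# ≡ # 1

module Evaluation {R : RawRing 0ℓ 0ℓ} {𝔸 : ℚ-Algebra} (hom : Homomorphism R 𝔸) where

  private module R = RawRing R
  open ℚ-Algebra 𝔸
  open Homomorphism hom
  open ≡-Reasoning
  open Polynomial R
  open RawMonoidOps R.+-rawMonoid using () renaming (_×_ to _×ᴿ_)

  ⟦_⟧ : Poly → Carrier → Carrier
  ⟦ p ⟧ x = foldr (λ a v → φ a + x * v) (# 0) p

  ⟦⟧-⊕ : ∀ p q x → ⟦ p ⊕ q ⟧ x ≡ ⟦ p ⟧ x + ⟦ q ⟧ x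
  ⟦⟧-⊕ [] q x = sym (+-identityˡ _)
  ⟦⟧-⊕ (a ∷ p) [] x = sym (+-identityʳ _)
  ⟦⟧-⊕ (a ∷ p) (b ∷ q) x = begin
    φ (a R.+ b) + x * ⟦ p ⊕ q ⟧ x
      ≡⟨ cong₂ (λ u v → u + x * v) (φ-+ a b) (⟦⟧-⊕ p q x) ⟩
    φ a + φ b + x * (⟦ p ⟧ x + ⟦ q ⟧ x)
      ≡⟨ solve 5 (λ a b x p q → a :+ b :+ x :* (p :+ q) := a :+ x :* p :+ (b :+ x :* q)) refl
           (φ a) (φ b) x (⟦ p ⟧ x) (⟦ q ⟧ x) ⟩
    φ a + x * ⟦ p ⟧ x + (φ b + x * ⟦ q ⟧ x) ∎

  ⟦⟧-scale : ∀ c p x → ⟦ map (c R.*_) p ⟧ x ≡ φ c * ⟦ p ⟧ x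
  ⟦⟧-scale c [] x = sym (zeroʳ _)
  ⟦⟧-scale c (a ∷ p) x = begin
    φ (c R.* a) + x * ⟦ map (c R.*_) p ⟧ x
      ≡⟨ cong₂ (λ u v → u + x * v) (φ-* c a) (⟦⟧-scale c p x) ⟩
    φ c * φ a + x * (φ c * ⟦ p ⟧ x)
      ≡⟨ solve 4 (λ c a x p → c :* a :+ x :* (c :* p) := c :* (a :+ x :* p)) refl
           (φ c) (φ a) x (⟦ p ⟧ x) ⟩
    φ c * (φ a + x * ⟦ p ⟧ x) ∎

  ⟦⟧-neg : ∀ p x → ⟦ map R.-_ p ⟧ x ≡ - ⟦ p ⟧ x
  ⟦⟧-neg [] x = solve 0 (:# 0 := :- :# 0) refl
  ⟦⟧-neg (a ∷ p) x = begin
    φ (R.- a) + x * ⟦ map R.-_ p ⟧ x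
      ≡⟨ cong₂ (λ u v → u + x * v) (φ-neg a) (⟦⟧-neg p x) ⟩
    - φ a + x * - ⟦ p ⟧ x
      ≡⟨ solve 3 (λ a x p → :- a :+ x :* :- p := :- (a :+ x :* p)) refl (φ a) x (⟦ p ⟧ x) ⟩
    - (φ a + x * ⟦ p ⟧ x) ∎

  ⟦⟧-⊖ : ∀ p q x → ⟦ p ⊖ q ⟧ x ≡ ⟦ p ⟧ x + - ⟦ q ⟧ x
  ⟦⟧-⊖ p q x = trans (⟦⟧-⊕ p (map R.-_ q) x) (cong (⟦ p ⟧ x +_) (⟦⟧-neg q x))

  ⟦⟧-shift : ∀ p x → ⟦ R.0# ∷ p ⟧ x ≡ x * ⟦ p ⟧ x
  ⟦⟧-shift p x = trans (cong (_+ x * ⟦ p ⟧ x) φ-0) (+-identityˡ _)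

  ⟦⟧-⊗ : ∀ p q x → ⟦ p ⊗ q ⟧ x ≡ ⟦ p ⟧ x * ⟦ q ⟧ x
  ⟦⟧-⊗ [] q x = sym (zeroˡ _)
  ⟦⟧-⊗ (a ∷ p) q x = begin
    ⟦ map (a R.*_) q ⊕ (R.0# ∷ p ⊗ q) ⟧ x
      ≡⟨ ⟦⟧-⊕ (map (a R.*_) q) _ x ⟩
    ⟦ map (a R.*_) q ⟧ x + ⟦ R.0# ∷ p ⊗ q ⟧ x
      ≡⟨ cong₂ _+_ (⟦⟧-scale a q x) (trans (⟦⟧-shift (p ⊗ q) x) (cong (x *_) (⟦⟧-⊗ p q x))) ⟩
    φ a * ⟦ q ⟧ x + x * (⟦ p ⟧ x * ⟦ q ⟧ x)
      ≡⟨ solve 4 (λ a x p q → a :* q :+ x :* (p :* q) := (a :+ x :* p) :* q) refl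
           (φ a) x (⟦ p ⟧ x) (⟦ q ⟧ x) ⟩
    (φ a + x * ⟦ p ⟧ x) * ⟦ q ⟧ x ∎

  ⟦⟧-C : ∀ a x → ⟦ C a ⟧ x ≡ φ a
  ⟦⟧-C a x = trans (cong (φ a +_) (zeroʳ x)) (+-identityʳ _)

  ⟦⟧-X : ∀ x → ⟦ X ⟧ x ≡ x
  ⟦⟧-X x = begin
    φ R.0# + x * (φ R.1# + x * # 0)
      ≡⟨ cong₂ (λ u v → u + x * (v + x * # 0)) φ-0 φ-1 ⟩
    # 0 + x * (# 1 + x * # 0)
      ≡⟨ solve 1 (λ x → :# 0 :+ x :* (:# 1 :+ x :* :# 0) := x) refl x ⟩
    x ∎

  ⟦⟧-weighted-suc : ∀ k p x → ⟦ weighted (suc k) p ⟧ x ≡ ⟦ weighted k p ⟧ x + ⟦ p ⟧ x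
  ⟦⟧-weighted-suc k [] x = sym (+-identityʳ _)
  ⟦⟧-weighted-suc k (a ∷ p) x = begin
    φ (a R.+ k ×ᴿ a) + x * ⟦ weighted (suc (suc k)) p ⟧ x
      ≡⟨ cong₂ (λ u v → u + x * v) (φ-+ a (k ×ᴿ a)) (⟦⟧-weighted-suc (suc k) p x) ⟩
    φ a + φ (k ×ᴿ a) + x * (⟦ weighted (suc k) p ⟧ x + ⟦ p ⟧ x)
      ≡⟨ solve 5 (λ a b x w p → a :+ b :+ x :* (w :+ p) := b :+ x :* w :+ (a :+ x :* p)) refl
           (φ a) (φ (k ×ᴿ a)) x (⟦ weighted (suc k) p ⟧ x) (⟦ p ⟧ x) ⟩
    φ (k ×ᴿ a) + x * ⟦ weighted (suc k) p ⟧ x + (φ a + x * ⟦ p ⟧ x) ∎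

  -- `weighted 0` is the Euler operator x d/dx. Through it the shifted weights of `derivative`
  -- become the product rule for a + x p.
  ⟦⟧-weighted-zero : ∀ p x → ⟦ weighted 0 p ⟧ x ≡ x * ⟦ derivative p ⟧ x
  ⟦⟧-weighted-zero [] x = sym (zeroʳ x)
  ⟦⟧-weighted-zero (a ∷ p) x = trans (cong (_+ x * ⟦ weighted 1 p ⟧ x) φ-0) (+-identityˡ _)

  ⟦⟧-derivative-∷ : ∀ a p x → ⟦ derivative (a ∷ p) ⟧ x ≡ ⟦ p ⟧ x + x * ⟦ derivative p ⟧ x
  ⟦⟧-derivative-∷ a p x = begin
    ⟦ weighted 1 p ⟧ x                  ≡⟨ ⟦⟧-weighted-suc 0 p x ⟩
    ⟦ weighted 0 p ⟧ x + ⟦ p ⟧ x        ≡⟨ cong (_+ ⟦ p ⟧ x) (⟦⟧-weighted-zero p x) ⟩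
    x * ⟦ derivative p ⟧ x + ⟦ p ⟧ x
        ≡⟨ solve 2 (λ u v → u :+ v := v :+ u) refl (x * ⟦ derivative p ⟧ x) (⟦ p ⟧ x) ⟩
    ⟦ p ⟧ x + x * ⟦ derivative p ⟧ x    ∎

-- The pair (a , b) is a + b e with e² = 0. Rational constants have second component zero, so second
-- components behave as derivatives.
dual : ℚ-Algebra → ℚ-Algebra
dual 𝔸 = record
  { Carrier = Carrier × Carrier
  ; _+_ = λ (a , b) (c , d) → a + c , b + d
  ; _*_ = λ (a , b) (c , d) → a * c , a * d + b * c
  ; -_  = λ (a , b) → - a , - b
  ; ι   = λ q → ι q , # 0
  ; isCommutativeRing = record
    { isRing = record
      { +-isAbelianGroup = record
        { isGroup = record
          { isMonoid = record
            { isSemigroup = record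
              { isMagma = record { isEquivalence = isEquivalence ; ∙-cong = cong₂ _ }
              ; assoc = λ (a , b) (c , d) (e , f) → cong₂ _,_ (+-assoc a c e) (+-assoc b d f)
              }
            ; identity = (λ (a , b) → cong₂ _,_ (+-identityˡ a) (+-identityˡ b))
                       , (λ (a , b) → cong₂ _,_ (+-identityʳ a) (+-identityʳ b))
            }
          ; inverse = (λ (a , b) → cong₂ _,_ (-‿inverseˡ a) (-‿inverseˡ b))
                    , (λ (a , b) → cong₂ _,_ (-‿inverseʳ a) (-‿inverseʳ b))
          ; ⁻¹-cong = cong (λ (a , b) → - a , - b)
          }
        ; comm = λ (a , b) (c , d) → cong₂ _,_ (+-comm a c) (+-comm b d)
        }
      ; *-cong = cong₂ _
      ; *-assoc = λ (a , b) (c , d) (e , f) → cong₂ _,_ (*-assoc a c e)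
          (solve 6 (λ a b c d e f → a :* c :* f :+ (a :* d :+ b :* c) :* e
                                  := a :* (c :* f :+ d :* e) :+ b :* (c :* e)) refl a b c d e f)
      ; *-identity =
            (λ (a , b) → cong₂ _,_ (*-identityˡ a)
              (solve 2 (λ a b → :# 1 :* b :+ :# 0 :* a := b) refl a b))
          , (λ (a , b) → cong₂ _,_ (*-identityʳ a)
              (solve 2 (λ a b → a :* :# 0 :+ b :* :# 1 := b) refl a b))
      ; distrib =
            (λ (a , b) (c , d) (e , f) → cong₂ _,_ (distribˡ a c e)
              (solve 6 (λ a b c d e f → a :* (d :+ f) :+ b :* (c :+ e)
                                      := a :* d :+ b :* c :+ (a :* f :+ b :* e)) refl a b c d e f))
          , (λ (a , b) (c , d) (e , f) → cong₂ _,_ (distribʳ a c e)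
              (solve 6 (λ a b c d e f → (c :+ e) :* b :+ (d :+ f) :* a
                                      := c :* b :+ d :* a :+ (e :* b :+ f :* a)) refl a b c d e f))
      }
    ; *-comm = λ (a , b) (c , d) → cong₂ _,_ (*-comm a c)
        (solve 4 (λ a b c d → a :* d :+ b :* c := c :* b :+ d :* a) refl a b c d)
    }
  ; ι-+ = λ p q → cong₂ _,_ (ι-+ p q) (sym (+-identityˡ _))
  ; ι-* = λ p q → cong₂ _,_ (ι-* p q)
      (solve 2 (λ p q → :# 0 := p :* :# 0 :+ :# 0 :* q) refl (ι p) (ι q))
  ; ι-neg = λ p → cong₂ _,_ (ι-neg p) (solve 0 (:# 0 := :- :# 0) refl)
  }
  where open ℚ-Algebra 𝔸

module ℚ[x] = Polynomial ℚ.+-*-rawRing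

module EvaluationAt (𝔸 : ℚ-Algebra) where
  open ℚ-Algebra 𝔸
  open ≡-Reasoning
  fromℤ-hom : Homomorphism ℤ.+-*-rawRing 𝔸
  fromℤ-hom = record
    { φ = ιℤ ; φ-+ = ιℤ-+ ; φ-* = ιℤ-* ; φ-neg = ιℤ-neg ; φ-0 = refl ; φ-1 = refl }
  fromℚ-hom : Homomorphism ℚ.+-*-rawRing 𝔸
  fromℚ-hom = record
    { φ = ι ; φ-+ = ι-+ ; φ-* = ι-* ; φ-neg = ι-neg ; φ-0 = refl ; φ-1 = refl }

  module ℤ⇒ = Evaluation fromℤ-hom
  module ℚ⇒ = Evaluation fromℚ-hom

  module _ {R : RawRing 0ℓ 0ℓ} (h : Homomorphism R 𝔸) (h′ : Homomorphism R (dual 𝔸))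
    (compatible : ∀ a → Homomorphism.φ h′ a ≡ (Homomorphism.φ h a , # 0)) where
    open Polynomial R
    private
      module E  = Evaluation h
      module E′ = Evaluation h′

    -- First-order Taylor expansion at x + e. An identity between values that holds in every
    -- ℚ-algebra can thus be differentiated by instantiating it at dual numbers; no product rule for
    -- coefficient lists is needed.
    ⟦⟧-dual : ∀ p x → E′.⟦ p ⟧ (x , # 1) ≡ (E.⟦ p ⟧ x , E.⟦ derivative p ⟧ x)
    ⟦⟧-dual [] x = refl
    ⟦⟧-dual (a ∷ p) x rewrite compatible a | ⟦⟧-dual p x = cong (E.⟦ a ∷ p ⟧ x ,_) (begin
      # 0 + (x * E.⟦ derivative p ⟧ x + # 1 * E.⟦ p ⟧ x)
        ≡⟨ solve 2 (λ u v → :# 0 :+ (u :+ :# 1 :* v) := v :+ u) refl _ _ ⟩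
      E.⟦ p ⟧ x + x * E.⟦ derivative p ⟧ x
        ≡⟨ E.⟦⟧-derivative-∷ a p x ⟨
      E.⟦ derivative (a ∷ p) ⟧ x ∎)

module DualEvaluation (𝔸 : ℚ-Algebra) where
  open ℚ-Algebra 𝔸 using (#; Carrier)
  private
    module E  = EvaluationAt 𝔸
    module E′ = EvaluationAt (dual 𝔸)

  ⟦⟧-dual-ℤ : ∀ p x → E′.ℤ⇒.⟦ p ⟧ (x , # 1) ≡ (E.ℤ⇒.⟦ p ⟧ x , E.ℤ⇒.⟦ ℤ[x].derivative p ⟧ x)
  ⟦⟧-dual-ℤ = E.⟦⟧-dual E.fromℤ-hom E′.fromℤ-hom (λ _ → refl)

  ⟦⟧-dual-ℚ : ∀ p x → E′.ℚ⇒.⟦ p ⟧ (x , # 1) ≡ (E.ℚ⇒.⟦ p ⟧ x , E.ℚ⇒.⟦ ℚ[x].derivative p ⟧ x)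
  ⟦⟧-dual-ℚ = E.⟦⟧-dual E.fromℚ-hom E′.fromℚ-hom (λ _ → refl)

-- Factorisation of Z

-- Doubling in this form exposes two successors per step, so `Z` unfolds without arithmetic on its
-- index.
double : ℕ → ℕ
double zero    = zero
double (suc k) = suc (suc (double k))

module ZRecurrence (𝔸 : ℚ-Algebra) where
  open ≡-Reasoning
  open ℚ-Algebra 𝔸
  open EvaluationAt 𝔸
  open ℤ⇒
  open ℤ[x] using (C; X; _⊕_; _⊖_; _⊗_; derivative)

  #-double : ∀ k → # (double k) ≡ # 2 * # k
  #-double zero    = solve 0 (:# 0 := :# 2 :* :# 0) refl
  #-double (suc k) = begin
    # (suc (suc (double k)))
        ≡⟨ trans (#-suc (suc (double k))) (cong (# 1 +_) (#-suc (double k))) ⟩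
    # 1 + (# 1 + # (double k)) ≡⟨ cong (λ u → # 1 + (# 1 + u)) (#-double k) ⟩
    # 1 + (# 1 + # 2 * # k)
        ≡⟨ solve 1 (λ k → :# 1 :+ (:# 1 :+ :# 2 :* k) := :# 2 :* (:# 1 :+ k)) refl (# k) ⟩
    # 2 * (# 1 + # k)          ≡⟨ cong (# 2 *_) (#-suc k) ⟨
    # 2 * # (suc k)            ∎

  leading : ∀ n → ιℤ (ℤ.+ 2 ℤ.* ℤ.+ suc n ℤ.- ℤ.+ 2) ≡ # 2 * # n
  leading n = begin
    ιℤ (ℤ.+ 2 ℤ.* ℤ.+ suc n ℤ.- ℤ.+ 2)       ≡⟨ ιℤ-+ (ℤ.+ 2 ℤ.* ℤ.+ suc n) (ℤ.- ℤ.+ 2) ⟩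
    ιℤ (ℤ.+ 2 ℤ.* ℤ.+ suc n) + ιℤ (ℤ.- ℤ.+ 2)
        ≡⟨ cong₂ _+_ (trans (ιℤ-* (ℤ.+ 2) (ℤ.+ suc n)) (cong (# 2 *_) (#-suc n))) (ιℤ-neg (ℤ.+ 2)) ⟩
    # 2 * (# 1 + # n) + - # 2
        ≡⟨ solve 1 (λ n → :# 2 :* (:# 1 :+ n) :+ :- :# 2 := :# 2 :* n) refl (# n) ⟩
    # 2 * # n                                 ∎

  ⟦⟧-Z : ∀ m x → let z = Z (suc m) in
    ⟦ Z (suc (suc m)) ⟧ x ≡ (# 2 * # (suc m) * (x * x) + # 3 * x + - # 1) * ⟦ z ⟧ x
                             + # 2 * x * (# 1 + - (x * x)) * ⟦ derivative z ⟧ x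
  ⟦⟧-Z m x = begin
    ⟦ (C a ⊗ (X ⊗ X) ⊕ C (ℤ.+ 3) ⊗ X ⊖ C (ℤ.+ 1)) ⊗ z ⊕ C (ℤ.+ 2) ⊗ X ⊗ (C (ℤ.+ 1) ⊖ X ⊗ X) ⊗
        derivative z ⟧ x
      ≡⟨ ⟦⟧-⊕ ((C a ⊗ (X ⊗ X) ⊕ C (ℤ.+ 3) ⊗ X ⊖ C (ℤ.+ 1)) ⊗ z)
        (C (ℤ.+ 2) ⊗ X ⊗ (C (ℤ.+ 1) ⊖ X ⊗ X) ⊗ derivative z) x ⟩
    ⟦ (C a ⊗ (X ⊗ X) ⊕ C (ℤ.+ 3) ⊗ X ⊖ C (ℤ.+ 1)) ⊗ z ⟧ x + ⟦ C (ℤ.+ 2) ⊗ X ⊗ (C (ℤ.+ 1) ⊖ X ⊗ X) ⊗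
        derivative z ⟧ x
      ≡⟨ cong₂ _+_ (trans (⟦⟧-⊗ (C a ⊗ (X ⊗ X) ⊕ C (ℤ.+ 3) ⊗ X ⊖ C (ℤ.+ 1)) z x)
        (cong (_* ⟦ z ⟧ x) quadratic))
                   (trans (⟦⟧-⊗ (C (ℤ.+ 2) ⊗ X ⊗ (C (ℤ.+ 1) ⊖ X ⊗ X)) (derivative z) x)
                     (cong (_* ⟦ derivative z ⟧ x) cubic)) ⟩
    (# 2 * # (suc m) * (x * x) + # 3 * x + - # 1) * ⟦ z ⟧ x + # 2 * x * (# 1 + - (x * x))
      * ⟦ derivative z ⟧ x ∎
    where
    z = Z (suc m)
    a = ℤ.+ 2 ℤ.* ℤ.+ suc (suc m) ℤ.- ℤ.+ 2
    square : ⟦ X ⊗ X ⟧ x ≡ x * x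
    square = trans (⟦⟧-⊗ X X x) (cong₂ _*_ (⟦⟧-X x) (⟦⟧-X x))
    linear : ∀ c → ⟦ C c ⊗ X ⟧ x ≡ ιℤ c * x
    linear c = trans (⟦⟧-⊗ (C c) X x) (cong₂ _*_ (⟦⟧-C c x) (⟦⟧-X x))
    quadratic : ⟦ C a ⊗ (X ⊗ X) ⊕ C (ℤ.+ 3) ⊗ X ⊖ C (ℤ.+ 1) ⟧ x
        ≡ # 2 * # (suc m) * (x * x) + # 3 * x + - # 1
    quadratic = trans (⟦⟧-⊖ (C a ⊗ (X ⊗ X) ⊕ C (ℤ.+ 3) ⊗ X) (C (ℤ.+ 1)) x)
      (cong₂ (λ u v → u + - v)
        (trans (⟦⟧-⊕ (C a ⊗ (X ⊗ X)) (C (ℤ.+ 3) ⊗ X) x)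
          (cong₂ _+_ (trans (⟦⟧-⊗ (C a) (X ⊗ X) x)
            (cong₂ _*_ (trans (⟦⟧-C a x) (leading (suc m))) square)) (linear (ℤ.+ 3))))
        (⟦⟧-C (ℤ.+ 1) x))
    cubic : ⟦ C (ℤ.+ 2) ⊗ X ⊗ (C (ℤ.+ 1) ⊖ X ⊗ X) ⟧ x ≡ # 2 * x * (# 1 + - (x * x))
    cubic = trans (⟦⟧-⊗ (C (ℤ.+ 2) ⊗ X) (C (ℤ.+ 1) ⊖ X ⊗ X) x)
      (cong₂ _*_ (linear (ℤ.+ 2))
        (trans (⟦⟧-⊖ (C (ℤ.+ 1)) (X ⊗ X) x) (cong₂ (λ u v → u + - v) (⟦⟧-C (ℤ.+ 1) x) square)))

-- The reduced polynomials and their recurrences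

open ℚ[x] using (Poly; _⊕_; weighted; derivative)

2ℚ 3ℚ : ℚ
2ℚ = fromInt (ℤ.+ 2)
3ℚ = fromInt (ℤ.+ 3)

-- A formal degree, read off the length: it needs no test for vanishing coefficients and does not
-- change under small perturbations of the coefficients. In return the lengths of all lists must be
-- tracked exactly.
degree : Poly → ℕ
degree p = pred (length p)

-- n·p − x·p′ for n = degree p; the top coefficient cancels and is dropped.
coderivative : Poly → Poly
coderivative []              = []
coderivative (a ∷ [])        = []
coderivative (a ∷ p@(_ ∷ _)) = fromInt (ℤ.+ length p) ℚ.* a ∷ coderivative p

-- The polar derivative of p with respect to the point 1.
polar : Poly → Poly
polar p = derivative p ⊕ coderivative p

doublePolar : Poly → Poly
doublePolar p = map (2ℚ ℚ.*_) (polar p)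

oddStep evenStep : Poly → Poly
oddStep  p = p ⊕ (0ℚ ∷ doublePolar p)
evenStep p = p ⊕ ((0ℚ ∷ (map (3ℚ ℚ.*_) p ⊕ doublePolar p)) ⊕ (0ℚ ∷ 0ℚ ∷ doublePolar p))

evenReduced oddReduced : ℕ → Poly
oddReduced zero     = 1ℚ ∷ []
oddReduced (suc k)  = oddStep (evenReduced k)
evenReduced k       = evenStep (oddReduced k)

length-⊕ : ∀ p q → length (p ⊕ q) ≡ length p ℕ.⊔ length q
length-⊕ []      q       = refl
length-⊕ (a ∷ p) []      = refl
length-⊕ (a ∷ p) (b ∷ q) = cong suc (length-⊕ p q)

length-weighted : ∀ k p → length (weighted k p) ≡ length p
length-weighted k []      = refl
length-weighted k (a ∷ p) = cong suc (length-weighted (suc k) p)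

length-derivative : ∀ p → length (derivative p) ≡ degree p
length-derivative []      = refl
length-derivative (a ∷ p) = length-weighted 1 p

length-coderivative : ∀ p → length (coderivative p) ≡ degree p
length-coderivative []              = refl
length-coderivative (a ∷ [])        = refl
length-coderivative (a ∷ p@(_ ∷ _)) = cong suc (length-coderivative p)

length-polar : ∀ p → length (polar p) ≡ degree p
length-polar p rewrite length-⊕ (derivative p) (coderivative p)
                     | length-derivative p | length-coderivative p = ℕₚ.⊔-idem (degree p)

length-doublePolar : ∀ p → length (doublePolar p) ≡ degree p
length-doublePolar p = trans (length-map (2ℚ ℚ.*_) (polar p)) (length-polar p)

length-oddStep : ∀ {n} p → length p ≡ suc n → length (oddStep p) ≡ suc n
length-oddStep {n} p eq
  rewrite length-⊕ p (0ℚ ∷ doublePolar p) | length-doublePolar p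
        | eq = cong suc (ℕₚ.⊔-idem n)

length-evenStep : ∀ {n} p → length p ≡ suc n → length (evenStep p) ≡ suc (suc n)
length-evenStep {n} p eq
  rewrite length-⊕ p ((0ℚ ∷ (map (3ℚ ℚ.*_) p ⊕ doublePolar p)) ⊕ (0ℚ ∷ 0ℚ ∷ doublePolar p))
        | length-⊕ (map (3ℚ ℚ.*_) p ⊕ doublePolar p) (0ℚ ∷ doublePolar p)
        | length-⊕ (map (3ℚ ℚ.*_) p) (doublePolar p)
        | length-doublePolar p | length-map (3ℚ ℚ.*_) p
        | eq = cong suc (begin
    n ℕ.⊔ ((suc n ℕ.⊔ n) ℕ.⊔ suc n)
        ≡⟨ cong (λ m → n ℕ.⊔ (m ℕ.⊔ suc n)) (ℕₚ.m≥n⇒m⊔n≡m (ℕₚ.n≤1+n n)) ⟩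
    n ℕ.⊔ (suc n ℕ.⊔ suc n)         ≡⟨ cong (n ℕ.⊔_) (ℕₚ.⊔-idem (suc n)) ⟩
    n ℕ.⊔ suc n                     ≡⟨ ℕₚ.m≤n⇒m⊔n≡n (ℕₚ.n≤1+n n) ⟩
    suc n                           ∎)
  where open ≡-Reasoning

length-oddReduced : ∀ k → length (oddReduced k) ≡ suc k
length-evenReduced : ∀ k → length (evenReduced k) ≡ suc (suc k)
length-oddReduced zero     = refl
length-oddReduced (suc k)  = length-oddStep (evenReduced k) (length-evenReduced k)
length-evenReduced k       = length-evenStep (oddReduced k) (length-oddReduced k)

module Steps (𝔸 : ℚ-Algebra) where
  open ℚ-Algebra 𝔸
  open EvaluationAt 𝔸
  open ℚ⇒
  open ≡-Reasoning

  oddMap evenMap : (n x f f₁ : Carrier) → Carrier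
  oddMap  n x f f₁ = f + # 2 * x * (n * f + (# 1 + - x) * f₁)
  evenMap n x f f₁ = (# 1 + # 3 * x) * f + # 2 * x * (# 1 + x) * (n * f + (# 1 + - x) * f₁)

  ⟦⟧-coderivative : ∀ p x → ⟦ coderivative p ⟧ x
      ≡ # (degree p) * ⟦ p ⟧ x + - (x * ⟦ derivative p ⟧ x)
  ⟦⟧-coderivative [] x = solve 1 (λ x → :# 0 := :# 0 :* :# 0 :+ :- (x :* :# 0)) refl x
  ⟦⟧-coderivative (a ∷ []) x = solve 2 (λ a x → :# 0 := :# 0 :* (a :+ x :* :# 0) :+ :- (x :* :# 0))
      refl (ι a) x
  ⟦⟧-coderivative (a ∷ p@(_ ∷ q)) x = begin
    ι (fromInt (ℤ.+ length p) ℚ.* a) + x * ⟦ coderivative p ⟧ x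
      ≡⟨ cong₂ (λ u v → u + x * v)
        (trans (ι-* (fromInt (ℤ.+ length p)) a) (cong (_* ι a) (#-suc (length q))))
          (⟦⟧-coderivative p x) ⟩
    (# 1 + # (length q)) * ι a + x * (# (length q) * ⟦ p ⟧ x + - (x * ⟦ derivative p ⟧ x))
      ≡⟨ solve 5 (λ n a x p d → (:# 1 :+ n) :* a :+ x :* (n :* p :+ :- (x :* d))
                             := (:# 1 :+ n) :* (a :+ x :* p) :+ :- (x :* (p :+ x :* d)))
           refl (# (length q)) (ι a) x (⟦ p ⟧ x) (⟦ derivative p ⟧ x) ⟩
    (# 1 + # (length q)) * ⟦ a ∷ p ⟧ x + - (x * (⟦ p ⟧ x + x * ⟦ derivative p ⟧ x))
      ≡⟨ cong₂ (λ u v → u * ⟦ a ∷ p ⟧ x + - (x * v)) (#-suc (length q)) (⟦⟧-derivative-∷ a p x) ⟨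
    # (suc (length q)) * ⟦ a ∷ p ⟧ x + - (x * ⟦ derivative (a ∷ p) ⟧ x) ∎

  ⟦⟧-polar : ∀ p x → ⟦ polar p ⟧ x ≡ # (degree p) * ⟦ p ⟧ x + (# 1 + - x) * ⟦ derivative p ⟧ x
  ⟦⟧-polar p x = begin
    ⟦ polar p ⟧ x ≡⟨ ⟦⟧-⊕ (derivative p) (coderivative p) x ⟩
    ⟦ derivative p ⟧ x + ⟦ coderivative p ⟧ x
        ≡⟨ cong (⟦ derivative p ⟧ x +_) (⟦⟧-coderivative p x) ⟩
    ⟦ derivative p ⟧ x + (# (degree p) * ⟦ p ⟧ x + - (x * ⟦ derivative p ⟧ x))
      ≡⟨ solve 4 (λ n p d x → d :+ (n :* p :+ :- (x :* d)) := n :* p :+ (:# 1 :+ :- x) :* d)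
           refl (# (degree p)) (⟦ p ⟧ x) (⟦ derivative p ⟧ x) x ⟩
    # (degree p) * ⟦ p ⟧ x + (# 1 + - x) * ⟦ derivative p ⟧ x ∎

  ⟦⟧-doublePolar : ∀ p x →
    ⟦ doublePolar p ⟧ x ≡ # 2 * (# (degree p) * ⟦ p ⟧ x + (# 1 + - x) * ⟦ derivative p ⟧ x)
  ⟦⟧-doublePolar p x = trans (⟦⟧-scale 2ℚ (polar p) x) (cong (# 2 *_) (⟦⟧-polar p x))

  ⟦⟧-oddStep : ∀ p x → ⟦ oddStep p ⟧ x ≡ oddMap (# (degree p)) x (⟦ p ⟧ x) (⟦ derivative p ⟧ x)
  ⟦⟧-oddStep p x = begin
    ⟦ oddStep p ⟧ x
      ≡⟨ ⟦⟧-⊕ p (0ℚ ∷ doublePolar p) x ⟩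
    ⟦ p ⟧ x + ⟦ 0ℚ ∷ doublePolar p ⟧ x
      ≡⟨ cong (⟦ p ⟧ x +_) (trans (⟦⟧-shift (doublePolar p) x) (cong (x *_) (⟦⟧-doublePolar p x))) ⟩
    ⟦ p ⟧ x + x * (# 2 * (# (degree p) * ⟦ p ⟧ x + (# 1 + - x) * ⟦ derivative p ⟧ x))
      ≡⟨ solve 3 (λ x p d → p :+ x :* (:# 2 :* d) := p :+ :# 2 :* x :* d)
           refl x (⟦ p ⟧ x) (# (degree p) * ⟦ p ⟧ x + (# 1 + - x) * ⟦ derivative p ⟧ x) ⟩
    oddMap (# (degree p)) x (⟦ p ⟧ x) (⟦ derivative p ⟧ x) ∎

  ⟦⟧-evenStep : ∀ p x → ⟦ evenStep p ⟧ x ≡ evenMap (# (degree p)) x (⟦ p ⟧ x) (⟦ derivative p ⟧ x)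
  ⟦⟧-evenStep p x = begin
    ⟦ evenStep p ⟧ x
      ≡⟨ ⟦⟧-⊕ p ((0ℚ ∷ (map (3ℚ ℚ.*_) p ⊕ doublePolar p)) ⊕ (0ℚ ∷ 0ℚ ∷ doublePolar p)) x ⟩
    ⟦ p ⟧ x + ⟦ (0ℚ ∷ (map (3ℚ ℚ.*_) p ⊕ doublePolar p)) ⊕ (0ℚ ∷ 0ℚ ∷ doublePolar p) ⟧ x
      ≡⟨ cong (⟦ p ⟧ x +_) (⟦⟧-⊕ (0ℚ ∷ (map (3ℚ ℚ.*_) p ⊕ doublePolar p)) (0ℚ ∷ 0ℚ ∷ doublePolar p)
        x) ⟩
    ⟦ p ⟧ x + (⟦ 0ℚ ∷ (map (3ℚ ℚ.*_) p ⊕ doublePolar p) ⟧ x + ⟦ 0ℚ ∷ 0ℚ ∷ doublePolar p ⟧ x)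
      ≡⟨ cong (⟦ p ⟧ x +_) (cong₂ _+_ linear quadratic) ⟩
    ⟦ p ⟧ x + (x * (# 3 * ⟦ p ⟧ x + # 2 * d) + x * (x * (# 2 * d)))
      ≡⟨ solve 3 (λ x p d → p :+ (x :* (:# 3 :* p :+ :# 2 :* d) :+ x :* (x :* (:# 2 :* d)))
                         := (:# 1 :+ :# 3 :* x) :* p :+ :# 2 :* x :* (:# 1 :+ x) :* d)
           refl x (⟦ p ⟧ x) d ⟩
    evenMap (# (degree p)) x (⟦ p ⟧ x) (⟦ derivative p ⟧ x) ∎
    where
    d = # (degree p) * ⟦ p ⟧ x + (# 1 + - x) * ⟦ derivative p ⟧ x
    linear : ⟦ 0ℚ ∷ (map (3ℚ ℚ.*_) p ⊕ doublePolar p) ⟧ x ≡ x * (# 3 * ⟦ p ⟧ x + # 2 * d)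
    linear = trans (⟦⟧-shift (map (3ℚ ℚ.*_) p ⊕ doublePolar p) x)
      (cong (x *_) (trans (⟦⟧-⊕ (map (3ℚ ℚ.*_) p) (doublePolar p) x)
        (cong₂ _+_ (⟦⟧-scale 3ℚ p x) (⟦⟧-doublePolar p x))))
    quadratic : ⟦ 0ℚ ∷ 0ℚ ∷ doublePolar p ⟧ x ≡ x * (x * (# 2 * d))
    quadratic = trans (⟦⟧-shift (0ℚ ∷ doublePolar p) x)
      (cong (x *_) (trans (⟦⟧-shift (doublePolar p) x) (cong (x *_) (⟦⟧-doublePolar p x))))

module StepDerivatives (𝔸 : ℚ-Algebra) where
  open ℚ-Algebra 𝔸
  open EvaluationAt 𝔸
  open ℚ⇒
  open ≡-Reasoning
  open DualEvaluation 𝔸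
  private
    module Dual = Steps (dual 𝔸)

  -- The x-derivatives of `oddMap` and `evenMap` when `f₁` and `f₂` are the derivatives of `f`. The
  -- recurring bracket n f₁ - f₁ + (1 - x) f₂ is the derivative of n f + (1 - x) f₁.
  oddMap′ evenMap′ : (n x f f₁ f₂ : Carrier) → Carrier
  oddMap′ n x f f₁ f₂ = f₁ + # 2 * (n * f + (# 1 + - x) * f₁) + # 2 * x
      * (n * f₁ + - f₁ + (# 1 + - x) * f₂)
  evenMap′ n x f f₁ f₂ =
    # 3 * f + (# 1 + # 3 * x) * f₁ + # 2 * (# 1 + # 2 * x) * (n * f + (# 1 + - x) * f₁)
    + # 2 * x * (# 1 + x) * (n * f₁ + - f₁ + (# 1 + - x) * f₂)

  ⟦⟧-oddStep′ : ∀ p x → ⟦ derivative (oddStep p) ⟧ x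
    ≡ oddMap′ (# (degree p)) x (⟦ p ⟧ x) (⟦ derivative p ⟧ x) (⟦ derivative (derivative p) ⟧ x)
  ⟦⟧-oddStep′ p x = begin
    ⟦ derivative (oddStep p) ⟧ x
      ≡⟨ cong proj₂ (⟦⟧-dual-ℚ (oddStep p) x) ⟨
    proj₂ (EvaluationAt.ℚ⇒.⟦_⟧ (dual 𝔸) (oddStep p) (x , # 1))
      ≡⟨ cong proj₂ (Dual.⟦⟧-oddStep p (x , # 1)) ⟩
    proj₂ (Dual.oddMap (# (degree p) , # 0) (x , # 1) (EvaluationAt.ℚ⇒.⟦_⟧ (dual 𝔸) p (x , # 1))
        (EvaluationAt.ℚ⇒.⟦_⟧ (dual 𝔸) (derivative p) (x , # 1)))
      ≡⟨ cong₂ (λ u v → proj₂ (Dual.oddMap (# (degree p) , # 0) (x , # 1) u v)) (⟦⟧-dual-ℚ p x)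
        (⟦⟧-dual-ℚ (derivative p) x) ⟩
    proj₂ (Dual.oddMap (# (degree p) , # 0) (x , # 1) (⟦ p ⟧ x , ⟦ derivative p ⟧ x)
        (⟦ derivative p ⟧ x , ⟦ derivative (derivative p) ⟧ x))
      ≡⟨ solve 5 (λ n x f f₁ f₂ →
           let 0′ = :# 0 ; 1′ = :# 1 ; 2′ = :# 2
               u = n :* f :+ (1′ :+ :- x) :* f₁
           in f₁ :+ (2′ :* x :* (n :* f₁ :+ 0′ :* f :+ ((1′ :+ :- x) :* f₂ :+ (0′ :+ :- 1′) :* f₁))
               :+ (2′ :* 1′ :+ 0′ :* x) :* u)
           := f₁ :+ 2′ :* u :+ 2′ :* x :* (n :* f₁ :+ :- f₁ :+ (1′ :+ :- x) :* f₂))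
           refl (# (degree p)) x (⟦ p ⟧ x) (⟦ derivative p ⟧ x) (⟦ derivative (derivative p) ⟧ x) ⟩
    oddMap′ (# (degree p)) x (⟦ p ⟧ x) (⟦ derivative p ⟧ x) (⟦ derivative (derivative p) ⟧ x) ∎

  ⟦⟧-evenStep′ : ∀ p x → ⟦ derivative (evenStep p) ⟧ x
    ≡ evenMap′ (# (degree p)) x (⟦ p ⟧ x) (⟦ derivative p ⟧ x) (⟦ derivative (derivative p) ⟧ x)
  ⟦⟧-evenStep′ p x = begin
    ⟦ derivative (evenStep p) ⟧ x
      ≡⟨ cong proj₂ (⟦⟧-dual-ℚ (evenStep p) x) ⟨
    proj₂ (EvaluationAt.ℚ⇒.⟦_⟧ (dual 𝔸) (evenStep p) (x , # 1))
      ≡⟨ cong proj₂ (Dual.⟦⟧-evenStep p (x , # 1)) ⟩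
    proj₂ (Dual.evenMap (# (degree p) , # 0) (x , # 1) (EvaluationAt.ℚ⇒.⟦_⟧ (dual 𝔸) p (x , # 1))
        (EvaluationAt.ℚ⇒.⟦_⟧ (dual 𝔸) (derivative p) (x , # 1)))
      ≡⟨ cong₂ (λ u v → proj₂ (Dual.evenMap (# (degree p) , # 0) (x , # 1) u v)) (⟦⟧-dual-ℚ p x)
        (⟦⟧-dual-ℚ (derivative p) x) ⟩
    proj₂ (Dual.evenMap (# (degree p) , # 0) (x , # 1) (⟦ p ⟧ x , ⟦ derivative p ⟧ x)
        (⟦ derivative p ⟧ x , ⟦ derivative (derivative p) ⟧ x))
      ≡⟨ solve 5 (λ n x f f₁ f₂ →
           let 0′ = :# 0 ; 1′ = :# 1 ; 2′ = :# 2 ; 3′ = :# 3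
               u = n :* f :+ (1′ :+ :- x) :* f₁
               u₁ = n :* f₁ :+ 0′ :* f :+ ((1′ :+ :- x) :* f₂ :+ (0′ :+ :- 1′) :* f₁)
           in (1′ :+ 3′ :* x) :* f₁ :+ (0′ :+ (3′ :* 1′ :+ 0′ :* x)) :* f
              :+ (2′ :* x :* (1′ :+ x) :* u₁ :+ (2′ :* x :* (0′ :+ 1′) :+ (2′ :* 1′ :+ 0′ :* x) :*
                  (1′ :+ x)) :* u)
           := 3′ :* f :+ (1′ :+ 3′ :* x) :* f₁ :+ 2′ :* (1′ :+ 2′ :* x) :* u
              :+ 2′ :* x :* (1′ :+ x) :* (n :* f₁ :+ :- f₁ :+ (1′ :+ :- x) :* f₂))
           refl (# (degree p)) x (⟦ p ⟧ x) (⟦ derivative p ⟧ x) (⟦ derivative (derivative p) ⟧ x) ⟩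
    evenMap′ (# (degree p)) x (⟦ p ⟧ x) (⟦ derivative p ⟧ x) (⟦ derivative (derivative p) ⟧ x) ∎

-- Extraction of the factors x and 1 + x from Z

module Powers (𝔸 : ℚ-Algebra) where
  open ℚ-Algebra 𝔸
  infixr 8 _^_
  _^_ : Carrier → ℕ → Carrier
  x ^ zero  = # 1
  x ^ suc n = x * x ^ n

module DualPowers (𝔸 : ℚ-Algebra) where
  open ℚ-Algebra 𝔸
  open ≡-Reasoning
  open Powers 𝔸
  private module Dual = Powers (dual 𝔸)

  ^-dual₁ : ∀ n x e → proj₁ ((x , e) Dual.^ n) ≡ x ^ n
  ^-dual₁ zero    x e = refl
  ^-dual₁ (suc n) x e = cong (x *_) (^-dual₁ n x e)

  -- The power rule multiplied by x: the exponent n - 1 does not occur, and n = 0 is no exception.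
  ^-dual₂ : ∀ n x e → x * proj₂ ((x , e) Dual.^ n) ≡ # n * e * x ^ n
  ^-dual₂ zero x e = solve 2 (λ x e → x :* :# 0 := :# 0 :* e :* :# 1) refl x e
  ^-dual₂ (suc n) x e = begin
    x * (x * d + e * proj₁ ((x , e) Dual.^ n))
      ≡⟨ cong (λ u → x * (x * d + e * u)) (^-dual₁ n x e) ⟩
    x * (x * d + e * x ^ n)
      ≡⟨ cong (λ u → x * (u + e * x ^ n)) (^-dual₂ n x e) ⟩
    x * (# n * e * x ^ n + e * x ^ n)
      ≡⟨ solve 4 (λ x e n p → x :* (n :* e :* p :+ e :* p) := (:# 1 :+ n) :* e :* (x :* p))
        refl x e (# n) (x ^ n) ⟩
    (# 1 + # n) * e * (x * x ^ n)
      ≡⟨ cong (λ u → u * e * (x * x ^ n)) (#-suc n) ⟨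
    # (suc n) * e * (x * x ^ n) ∎
    where d = proj₂ ((x , e) Dual.^ n)

-- Quantified over all ℚ-algebras so that it can be used in the dual numbers, where it also
-- determines the derivative of Z.
Factorisation : ℕ → ℕ → ℚ[x].Poly → Set₁
Factorisation m k p = ∀ 𝔸 → let open ℚ-Algebra 𝔸 ; open EvaluationAt 𝔸 ; open Powers 𝔸 in
  ∀ x → ℤ⇒.⟦ Z (suc m) ⟧ x ≡ x * (# 1 + x) ^ k * ℚ⇒.⟦ p ⟧ x

module _ (𝔸 : ℚ-Algebra) where
  open ℚ-Algebra 𝔸
  open ≡-Reasoning
  open EvaluationAt 𝔸
  open Powers 𝔸

  -- Stated for (1 + x) Z′ because of the form of the power rule. This suffices, since Z′ enters the
  -- recurrence with the factor 1 - x² = (1 - x) (1 + x).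
  derivative-factorisation : ∀ m k p → Factorisation m k p → ∀ x →
    (# 1 + x) * ℤ⇒.⟦ ℤ[x].derivative (Z (suc m)) ⟧ x ≡
    (# 1 + x) ^ k * ((# 1 + x) * (ℚ⇒.⟦ p ⟧ x + x * ℚ⇒.⟦ derivative p ⟧ x) + # k * x * ℚ⇒.⟦ p ⟧ x)
  derivative-factorisation m k p fact x = begin
    (# 1 + x) * ℤ⇒.⟦ ℤ[x].derivative (Z (suc m)) ⟧ x
      ≡⟨ cong (λ u → (# 1 + x) * proj₂ u) (DualEvaluation.⟦⟧-dual-ℤ 𝔸 (Z (suc m)) x) ⟨
    (# 1 + x) * proj₂ (EvaluationAt.ℤ⇒.⟦_⟧ (dual 𝔸) (Z (suc m)) (x , # 1))
      ≡⟨ cong (λ u → (# 1 + x) * proj₂ u) (fact (dual 𝔸) (x , # 1)) ⟩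
    (# 1 + x) * (x * proj₁ q * proj₂ f + (x * proj₂ q + # 1 * proj₁ q) * proj₁ f)
      ≡⟨ cong₂ (λ u v → (# 1 + x) * (x * u * proj₂ v + (x * proj₂ q + # 1 * u) * proj₁ v))
           (DualPowers.^-dual₁ 𝔸 k (# 1 + x) (# 0 + # 1)) (DualEvaluation.⟦⟧-dual-ℚ 𝔸 p x) ⟩
    (# 1 + x) * (x * P * f₁ + (x * d + # 1 * P) * f₀)
      ≡⟨ solve 5 (λ x P d f f₁ → let X = :# 1 :+ x in
           X :* (x :* P :* f₁ :+ (x :* d :+ :# 1 :* P) :* f)
           := X :* (P :* (f :+ x :* f₁)) :+ X :* d :* (x :* f)) refl x P d f₀ f₁ ⟩
    (# 1 + x) * (P * (f₀ + x * f₁)) + (# 1 + x) * d * (x * f₀)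
      ≡⟨ cong (λ u → (# 1 + x) * (P * (f₀ + x * f₁)) + u * (x * f₀))
        (DualPowers.^-dual₂ 𝔸 k (# 1 + x) (# 0 + # 1)) ⟩
    (# 1 + x) * (P * (f₀ + x * f₁)) + # k * (# 0 + # 1) * P * (x * f₀)
      ≡⟨ solve 5 (λ x P k f f₁ → let X = :# 1 :+ x in
           X :* (P :* (f :+ x :* f₁)) :+ k :* (:# 0 :+ :# 1) :* P :* (x :* f)
           := P :* (X :* (f :+ x :* f₁) :+ k :* x :* f)) refl x P (# k) f₀ f₁ ⟩
    P * ((# 1 + x) * (f₀ + x * f₁) + # k * x * f₀) ∎
    where
    f = EvaluationAt.ℚ⇒.⟦_⟧ (dual 𝔸) p (x , # 1)
    q = Powers._^_ (dual 𝔸) (# 1 + x , # 0 + # 1) k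
    P = (# 1 + x) ^ k
    d = proj₂ q
    f₀ = ℚ⇒.⟦ p ⟧ x
    f₁ = ℚ⇒.⟦ derivative p ⟧ x

  open Steps 𝔸
  open ZRecurrence 𝔸

  ⟦⟧-Z-factorised : ∀ m k p → Factorisation m k p → ∀ x → let f = ℚ⇒.⟦ p ⟧ x in
    ℤ⇒.⟦ Z (suc (suc m)) ⟧ x ≡ x * (# 1 + x) ^ k *
      ((# 2 * # (suc m) * (x * x) + # 3 * x + - # 1) * f
        + # 2 * (# 1 + - x) * ((# 1 + x) * (f + x * ℚ⇒.⟦ derivative p ⟧ x) + # k * x * f))
  ⟦⟧-Z-factorised m k p fact x = begin
    ℤ⇒.⟦ Z (suc (suc m)) ⟧ x
      ≡⟨ ⟦⟧-Z m x ⟩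
    a * ℤ⇒.⟦ Z (suc m) ⟧ x + # 2 * x * (# 1 + - (x * x)) * z₁
      ≡⟨ cong (λ u → a * u + # 2 * x * (# 1 + - (x * x)) * z₁) (fact 𝔸 x) ⟩
    a * (x * P * f) + # 2 * x * (# 1 + - (x * x)) * z₁
      ≡⟨ solve 5 (λ x P f a z₁ → a :* (x :* P :* f) :+ :# 2 :* x :* (:# 1 :+ :- (x :* x)) :* z₁
           := a :* (x :* P :* f) :+ :# 2 :* x :* (:# 1 :+ :- x) :* ((:# 1 :+ x) :* z₁))
           refl x P f a z₁ ⟩
    a * (x * P * f) + # 2 * x * (# 1 + - x) * ((# 1 + x) * z₁)
      ≡⟨ cong (λ u → a * (x * P * f) + # 2 * x * (# 1 + - x) * u)
        (derivative-factorisation m k p fact x) ⟩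
    a * (x * P * f) + # 2 * x * (# 1 + - x) * (P * e)
      ≡⟨ solve 5 (λ x P f a e → a :* (x :* P :* f) :+ :# 2 :* x :* (:# 1 :+ :- x) :* (P :* e)
           := x :* P :* (a :* f :+ :# 2 :* (:# 1 :+ :- x) :* e)) refl x P f a e ⟩
    x * P * (a * f + # 2 * (# 1 + - x) * e) ∎
    where
    P = (# 1 + x) ^ k
    f = ℚ⇒.⟦ p ⟧ x
    z₁ = ℤ⇒.⟦ ℤ[x].derivative (Z (suc m)) ⟧ x
    a = # 2 * # (suc m) * (x * x) + # 3 * x + - # 1
    e = (# 1 + x) * (f + x * ℚ⇒.⟦ derivative p ⟧ x) + # k * x * f

Z-odd  : ∀ k → Factorisation (double k) k (oddReduced k)
Z-even : ∀ k → Factorisation (suc (double k)) k (evenReduced k)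

Z-odd zero 𝔸 x = trans (ℤ⇒.⟦⟧-X x)
  (solve 1 (λ x → x := x :* :# 1 :* (:# 1 :+ x :* :# 0)) refl x)
  where
  open ℚ-Algebra 𝔸
  open EvaluationAt 𝔸
Z-odd (suc k) 𝔸 x = begin
  ℤ⇒.⟦ Z (suc (suc (suc (double k)))) ⟧ x
    ≡⟨ ⟦⟧-Z-factorised 𝔸 (suc (double k)) k (evenReduced k) (Z-even k) x ⟩
  x * P * ((# 2 * # (suc (suc (double k))) * (x * x) + # 3 * x + - # 1) * f + # 2 * (# 1 + - x)
      * ((# 1 + x) * (f + x * f₁) + # k * x * f))
    ≡⟨ cong (λ u → x * P * ((# 2 * u * (x * x) + # 3 * x + - # 1) * f + # 2 * (# 1 + - x)
      * ((# 1 + x) * (f + x * f₁) + # k * x * f)))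
         (trans (#-double (suc k)) (cong (# 2 *_) (#-suc k))) ⟩
  x * P * ((# 2 * (# 2 * (# 1 + # k)) * (x * x) + # 3 * x + - # 1) * f + # 2 * (# 1 + - x)
      * ((# 1 + x) * (f + x * f₁) + # k * x * f))
    -- The new factor 1 + x: at x = -1 the large bracket is 4 k f - 4 k f = 0. In the other parity
    -- it is -2 f there, and nothing splits off.
    ≡⟨ solve 5 (λ x P k f f₁ → let 1′ = :# 1 ; 2′ = :# 2 in
         x :* P :* ((2′ :* (2′ :* (1′ :+ k)) :* (x :* x) :+ :# 3 :* x :+ :- 1′) :* f
                    :+ 2′ :* (1′ :+ :- x) :* ((1′ :+ x) :* (f :+ x :* f₁) :+ k :* x :* f))
         := x :* ((1′ :+ x) :* P) :* (f :+ 2′ :* x :* ((1′ :+ k) :* f :+ (1′ :+ :- x) :* f₁)))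
         refl x P (# k) f f₁ ⟩
  x * ((# 1 + x) * P) * oddMap (# 1 + # k) x f f₁
    ≡⟨ cong (λ u → x * ((# 1 + x) * P) * oddMap u x f f₁)
      (trans (cong (λ m → # (pred m)) (length-evenReduced k)) (#-suc k)) ⟨
  x * ((# 1 + x) * P) * oddMap (# (degree (evenReduced k))) x f f₁
    ≡⟨ cong (x * ((# 1 + x) * P) *_) (⟦⟧-oddStep (evenReduced k) x) ⟨
  x * ((# 1 + x) * P) * ℚ⇒.⟦ oddReduced (suc k) ⟧ x ∎
  where
  open ≡-Reasoning
  open ℚ-Algebra 𝔸
  open EvaluationAt 𝔸
  open Powers 𝔸
  open Steps 𝔸
  open ZRecurrence 𝔸
  P = (# 1 + x) ^ k
  f = ℚ⇒.⟦ evenReduced k ⟧ x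
  f₁ = ℚ⇒.⟦ ℚ[x].derivative (evenReduced k) ⟧ x

Z-even k 𝔸 x = begin
  ℤ⇒.⟦ Z (suc (suc (double k))) ⟧ x
    ≡⟨ ⟦⟧-Z-factorised 𝔸 (double k) k (oddReduced k) (Z-odd k) x ⟩
  x * P * ((# 2 * # (suc (double k)) * (x * x) + # 3 * x + - # 1) * f + # 2 * (# 1 + - x)
      * ((# 1 + x) * (f + x * f₁) + # k * x * f))
    ≡⟨ cong (λ u → x * P * ((# 2 * u * (x * x) + # 3 * x + - # 1) * f + # 2 * (# 1 + - x)
      * ((# 1 + x) * (f + x * f₁) + # k * x * f)))
         (trans (#-suc (double k)) (cong (# 1 +_) (#-double k))) ⟩
  x * P * ((# 2 * (# 1 + # 2 * # k) * (x * x) + # 3 * x + - # 1) * f + # 2 * (# 1 + - x)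
      * ((# 1 + x) * (f + x * f₁) + # k * x * f))
    ≡⟨ solve 5 (λ x P k f f₁ → let 1′ = :# 1 ; 2′ = :# 2 ; 3′ = :# 3 in
         x :* P :* ((2′ :* (1′ :+ 2′ :* k) :* (x :* x) :+ 3′ :* x :+ :- 1′) :* f
                    :+ 2′ :* (1′ :+ :- x) :* ((1′ :+ x) :* (f :+ x :* f₁) :+ k :* x :* f))
         := x :* P :* ((1′ :+ 3′ :* x) :* f :+ 2′ :* x :* (1′ :+ x) :*
             (k :* f :+ (1′ :+ :- x) :* f₁)))
         refl x P (# k) f f₁ ⟩
  x * P * evenMap (# k) x f f₁
    ≡⟨ cong (λ m → x * P * evenMap (# (pred m)) x f f₁) (length-oddReduced k) ⟨
  x * P * evenMap (# (degree (oddReduced k))) x f f₁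
    ≡⟨ cong (x * P *_) (⟦⟧-evenStep (oddReduced k) x) ⟨
  x * P * ℚ⇒.⟦ evenReduced k ⟧ x ∎
  where
  open ≡-Reasoning
  open ℚ-Algebra 𝔸
  open EvaluationAt 𝔸
  open Powers 𝔸
  open Steps 𝔸
  open ZRecurrence 𝔸
  P = (# 1 + x) ^ k
  f = ℚ⇒.⟦ oddReduced k ⟧ x
  f₁ = ℚ⇒.⟦ ℚ[x].derivative (oddReduced k) ⟧ x

-- Polynomials that split over ℚ

-- addLinear c σ q is c + (X − σ) q.
addLinear : ℚ → ℚ → Poly → Poly
addLinear c σ []      = c ∷ []
addLinear c σ (e ∷ q) = c ℚ.- σ ℚ.* e ∷ addLinear e σ q

split : ℚ → List ℚ → Poly
split c []       = c ∷ []
split c (σ ∷ σs) = addLinear 0ℚ σ (split c σs)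

length-addLinear : ∀ c σ p → length (addLinear c σ p) ≡ suc (length p)
length-addLinear c σ []      = refl
length-addLinear c σ (e ∷ p) = cong suc (length-addLinear e σ p)

length-split : ∀ c σs → length (split c σs) ≡ suc (length σs)
length-split c []       = refl
length-split c (σ ∷ σs) = trans (length-addLinear 0ℚ σ (split c σs)) (cong suc (length-split c σs))

module LinearFactors (𝔸 : ℚ-Algebra) where
  open ℚ-Algebra 𝔸
  open EvaluationAt.ℚ⇒ 𝔸

  ⟦⟧-addLinear : ∀ c σ q x → ⟦ addLinear c σ q ⟧ x ≡ ι c + (x + - ι σ) * ⟦ q ⟧ x
  ⟦⟧-addLinear c σ [] x = solve 3 (λ c x s → c :+ x :* :# 0 := c :+ (x :+ :- s) :* :# 0)
    refl (ι c) x (ι σ)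
  ⟦⟧-addLinear c σ (e ∷ q) x = begin
    ι (c ℚ.- σ ℚ.* e) + x * ⟦ addLinear e σ q ⟧ x
      ≡⟨ cong₂ (λ u v → u + x * v)
           (trans (ι-+ c (ℚ.- (σ ℚ.* e)))
             (cong (ι c +_) (trans (ι-neg (σ ℚ.* e)) (cong (-_) (ι-* σ e)))))
           (⟦⟧-addLinear e σ q x) ⟩
    ι c + - (ι σ * ι e) + x * (ι e + (x + - ι σ) * ⟦ q ⟧ x)
      ≡⟨ solve 5 (λ c s e x q → c :+ :- (s :* e) :+ x :* (e :+ (x :+ :- s) :* q)
           := c :+ (x :+ :- s) :* (e :+ x :* q)) refl (ι c) (ι σ) (ι e) x (⟦ q ⟧ x) ⟩
    ι c + (x + - ι σ) * (ι e + x * ⟦ q ⟧ x) ∎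
    where open ≡-Reasoning

  ⟦⟧-split-∷ : ∀ c σ σs x → ⟦ split c (σ ∷ σs) ⟧ x ≡ (x + - ι σ) * ⟦ split c σs ⟧ x
  ⟦⟧-split-∷ c σ σs x = trans (⟦⟧-addLinear 0ℚ σ (split c σs) x) (+-identityˡ _)

module SplitDerivatives (𝔸 : ℚ-Algebra) where
  open ℚ-Algebra 𝔸
  private
    module E′ = EvaluationAt.ℚ⇒ (dual 𝔸)
  open EvaluationAt.ℚ⇒ 𝔸
  open DualEvaluation

  ⟦⟧-split-∷′ : ∀ c σ σs x → let p = split c σs in
    ⟦ derivative (split c (σ ∷ σs)) ⟧ x ≡ ⟦ p ⟧ x + (x + - ι σ) * ⟦ derivative p ⟧ x
  ⟦⟧-split-∷′ c σ σs x = begin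
    ⟦ derivative (split c (σ ∷ σs)) ⟧ x
      ≡⟨ cong proj₂ (⟦⟧-dual-ℚ 𝔸 (split c (σ ∷ σs)) x) ⟨
    proj₂ (E′.⟦ split c (σ ∷ σs) ⟧ (x , # 1))
      ≡⟨ cong proj₂ (LinearFactors.⟦⟧-split-∷ (dual 𝔸) c σ σs (x , # 1)) ⟩
    (x + - ι σ) * proj₂ (E′.⟦ p ⟧ (x , # 1)) + (# 1 + - # 0) * proj₁ (E′.⟦ p ⟧ (x , # 1))
      ≡⟨ cong (λ u → (x + - ι σ) * proj₂ u + (# 1 + - # 0) * proj₁ u) (⟦⟧-dual-ℚ 𝔸 p x) ⟩
    (x + - ι σ) * ⟦ derivative p ⟧ x + (# 1 + - # 0) * ⟦ p ⟧ x
      ≡⟨ solve 3 (λ w f f₁ → w :* f₁ :+ (:# 1 :+ :- :# 0) :* f := f :+ w :* f₁)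
        refl (x + - ι σ) (⟦ p ⟧ x) (⟦ derivative p ⟧ x) ⟩
    ⟦ p ⟧ x + (x + - ι σ) * ⟦ derivative p ⟧ x ∎
    where
    open ≡-Reasoning
    p = split c σs

-- Turán expressions as sums over the zeros

module Curvature (𝔸 : ℚ-Algebra) where
  open ℚ-Algebra 𝔸
  open Steps 𝔸
  open StepDerivatives 𝔸

  -- For f of degree n with zeros −r, this is f² times the sum over r of
  -- (1 + r) ((1 − r) x² + r x + r) / (x + r)².
  curvature : (n x f f₁ f₂ : Carrier) → Carrier
  curvature n x f f₁ f₂ =
    n * (# 1 + x + - (x * x)) * (f * f)
    + (# 1 + - x) * (# 1 + - (# 2 * (x * x))) * (f * f₁)
    + - (x * ((# 1 + - x) * (# 1 + - x)) * (# 1 + x) * (f₁ * f₁ + - (f * f₂)))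

  -- For s = -r this is (x + r)² `h r`, the numerator of one summand.
  rootCurvature : (s x : Carrier) → Carrier
  rootCurvature s x = (# 1 + - s) * ((# 1 + s) * (x * x) + - (s * x) + - s)

  -- A new factor w adds 1 / w to f₁ / f and -1 / w² to the derivative of that quotient. Divided by
  -- f², `curvature` is affine in these two and in n, so it gains a term that depends on s and x
  -- only.
  curvature-∷ : ∀ s n x f f₁ f₂ → let w = x + - s in
    curvature (# 1 + n) x (w * f) (f + w * f₁) (# 2 * f₁ + w * f₂) ≡
    w * w * curvature n x f f₁ f₂ + rootCurvature s x * (f * f)
  curvature-∷ = solve 6 (λ s n x f f₁ f₂ →
    let 1′ = :# 1
        2′ = :# 2
        curv = λ n f f₁ f₂ →
          n :* (1′ :+ x :+ :- (x :* x)) :* (f :* f)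
          :+ (1′ :+ :- x) :* (1′ :+ :- (2′ :* (x :* x))) :* (f :* f₁)
          :+ :- (x :* ((1′ :+ :- x) :* (1′ :+ :- x)) :* (1′ :+ x) :* (f₁ :* f₁ :+ :- (f :* f₂)))
        w = x :+ :- s
    in curv (1′ :+ n) (w :* f) (f :+ w :* f₁) (2′ :* f₁ :+ w :* f₂)
       := w :* w :* curv n f f₁ f₂ :+ (1′ :+ :- s) :* ((1′ :+ s) :* (x :* x) :+ :- (s :* x) :+ :- s)
           :* (f :* f)) refl

  -- Here `f`, `f₁` and `f₂` are independent variables, so this is a polynomial identity; that they
  -- are derivatives of each other matters only when it is applied.
  evenTurán : ∀ n x f f₁ f₂ →
    let g  = oddMap n x f f₁
        g₁ = oddMap′ n x f f₁ f₂
    in (# 1 + x) * (g * g) + - (# 1 * (f * evenMap n x g g₁)) ≡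
       - # 2 * x * (f * f + # 2 * curvature n x f f₁ f₂)
  evenTurán = solve 5 (λ n x f f₁ f₂ →
    let 1′ = :# 1
        2′ = :# 2
        D = λ y y₁ → n :* y :+ (1′ :+ :- x) :* y₁
        g = f :+ 2′ :* x :* D f f₁
        g₁ = f₁ :+ 2′ :* D f f₁ :+ 2′ :* x :* (n :* f₁ :+ :- f₁ :+ (1′ :+ :- x) :* f₂)
        h = (1′ :+ :# 3 :* x) :* g :+ 2′ :* x :* (1′ :+ x) :* D g g₁
        W = n :* (1′ :+ x :+ :- (x :* x)) :* (f :* f) :+ (1′ :+ :- x) :* (1′ :+ :- (2′ :* (x :* x)))
            :* (f :* f₁) :+ :- (x :* ((1′ :+ :- x) :* (1′ :+ :- x)) :* (1′ :+ x) :*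
                (f₁ :* f₁ :+ :- (f :* f₂)))
    in (1′ :+ x) :* (g :* g) :+ :- (1′ :* (f :* h)) := :- 2′ :* x :* (f :* f :+ 2′ :* W)) refl

  -- The second step works with 1 + n because `evenStep` has raised the degree by one. The
  -- coefficient 3 + x is (1 + x) + 2, the source of the extra term 2 / (1 + x) for odd indices.
  oddTurán : ∀ n x f f₁ f₂ →
    let g  = evenMap n x f f₁
        g₁ = evenMap′ n x f f₁ f₂
    in # 1 * (g * g) + - ((# 1 + x) * (f * oddMap (# 1 + n) x g g₁)) ≡
       - # 2 * x * ((# 3 + x) * (f * f) + # 2 * (# 1 + x) * curvature n x f f₁ f₂)
  oddTurán = solve 5 (λ n x f f₁ f₂ →
    let 1′ = :# 1
        2′ = :# 2
        3′ = :# 3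
        D = λ n y y₁ → n :* y :+ (1′ :+ :- x) :* y₁
        g = (1′ :+ 3′ :* x) :* f :+ 2′ :* x :* (1′ :+ x) :* D n f f₁
        g₁ = 3′ :* f :+ (1′ :+ 3′ :* x) :* f₁ :+ 2′ :* (1′ :+ 2′ :* x) :* D n f f₁
             :+ 2′ :* x :* (1′ :+ x) :* (n :* f₁ :+ :- f₁ :+ (1′ :+ :- x) :* f₂)
        h = g :+ 2′ :* x :* D (1′ :+ n) g g₁
        W = n :* (1′ :+ x :+ :- (x :* x)) :* (f :* f) :+ (1′ :+ :- x) :* (1′ :+ :- (2′ :* (x :* x)))
            :* (f :* f₁) :+ :- (x :* ((1′ :+ :- x) :* (1′ :+ :- x)) :* (1′ :+ x) :*
                (f₁ :* f₁ :+ :- (f :* f₂)))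
    in 1′ :* (g :* g) :+ :- ((1′ :+ x) :* (f :* h))
        := :- 2′ :* x :* ((3′ :+ x) :* (f :* f) :+ 2′ :* (1′ :+ x) :* W)) refl

  open EvaluationAt.ℚ⇒ 𝔸
  open DualEvaluation 𝔸
  open ≡-Reasoning

  splitCurvature : ℚ → List ℚ → Carrier → Carrier
  splitCurvature c σs x = let p = split c σs in
    curvature (# (length σs)) x (⟦ p ⟧ x) (⟦ derivative p ⟧ x) (⟦ derivative (derivative p) ⟧ x)

  -- The first-order rule, used over the dual numbers; its own proof passes to dual numbers once
  -- more, which gives second derivatives.
  ⟦⟧-split-∷″ : ∀ c σ σs x → let p = split c σs in
    ⟦ derivative (derivative (split c (σ ∷ σs))) ⟧ x ≡
    # 2 * ⟦ derivative p ⟧ x + (x + - ι σ) * ⟦ derivative (derivative p) ⟧ x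
  ⟦⟧-split-∷″ c σ σs x = begin
    ⟦ derivative (derivative (split c (σ ∷ σs))) ⟧ x
      ≡⟨ cong proj₂ (⟦⟧-dual-ℚ (derivative (split c (σ ∷ σs))) x) ⟨
    proj₂ (E′.⟦ derivative (split c (σ ∷ σs)) ⟧ (x , # 1))
      ≡⟨ cong proj₂ (SplitDerivatives.⟦⟧-split-∷′ (dual 𝔸) c σ σs (x , # 1)) ⟩
    proj₂ (E′.⟦ p ⟧ (x , # 1)) + (w * proj₂ (E′.⟦ derivative p ⟧ (x , # 1)) + (# 1 + - # 0) * proj₁
        (E′.⟦ derivative p ⟧ (x , # 1)))
      ≡⟨ cong₂ (λ u v → proj₂ u + (w * proj₂ v + (# 1 + - # 0) * proj₁ v)) (⟦⟧-dual-ℚ p x)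
        (⟦⟧-dual-ℚ (derivative p) x) ⟩
    f₁ + (w * f₂ + (# 1 + - # 0) * f₁)
      ≡⟨ solve 3 (λ w f₁ f₂ → f₁ :+ (w :* f₂ :+ (:# 1 :+ :- :# 0) :* f₁) := :# 2 :* f₁ :+ w :* f₂)
        refl w f₁ f₂ ⟩
    # 2 * f₁ + w * f₂ ∎
    where
    module E′ = EvaluationAt.ℚ⇒ (dual 𝔸)
    p = split c σs
    w = x + - ι σ
    f₁ = ⟦ derivative p ⟧ x
    f₂ = ⟦ derivative (derivative p) ⟧ x

  splitCurvature-∷ : ∀ c σ σs x → let f = ⟦ split c σs ⟧ x ; w = x + - ι σ in
    splitCurvature c (σ ∷ σs) x ≡ w * w * splitCurvature c σs x + rootCurvature (ι σ) x * (f * f)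
  splitCurvature-∷ c σ σs x = begin
    splitCurvature c (σ ∷ σs) x
      ≡⟨ cong₂ (λ n f → curvature n x f (⟦ derivative q ⟧ x) (⟦ derivative (derivative q) ⟧ x))
        (#-suc (length σs)) (LinearFactors.⟦⟧-split-∷ 𝔸 c σ σs x) ⟩
    curvature (# 1 + # (length σs)) x (w * f) (⟦ derivative q ⟧ x) (⟦ derivative (derivative q) ⟧ x)
      ≡⟨ cong₂ (curvature (# 1 + # (length σs)) x (w * f)) (SplitDerivatives.⟦⟧-split-∷′ 𝔸 c σ σs x)
        (⟦⟧-split-∷″ c σ σs x) ⟩
    curvature (# 1 + # (length σs)) x (w * f) (f + w * f₁) (# 2 * f₁ + w * f₂)
      ≡⟨ curvature-∷ (ι σ) (# (length σs)) x f f₁ f₂ ⟩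
    w * w * splitCurvature c σs x + rootCurvature (ι σ) x * (f * f) ∎
    where
    p = split c σs
    q = split c (σ ∷ σs)
    w = x + - ι σ
    f = ⟦ p ⟧ x
    f₁ = ⟦ derivative p ⟧ x
    f₂ = ⟦ derivative (derivative p) ⟧ x

  -- The factors `# 1` are kept so that both expressions are instances of `turánForm` by
  -- computation, and one limit argument covers both parities.
  evenTuránAt oddTuránAt : Poly → Carrier → Carrier
  evenTuránAt p x = (# 1 + x) * (⟦ oddStep p ⟧ x * ⟦ oddStep p ⟧ x)
      + - (# 1 * (⟦ p ⟧ x * ⟦ evenStep (oddStep p) ⟧ x))
  oddTuránAt  p x = # 1 * (⟦ evenStep p ⟧ x * ⟦ evenStep p ⟧ x)
      + - ((# 1 + x) * (⟦ p ⟧ x * ⟦ oddStep (evenStep p) ⟧ x))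

  evenTurán-split : ∀ c σs x → let f = ⟦ split c σs ⟧ x in
    evenTuránAt (split c σs) x ≡ - # 2 * x * (f * f + # 2 * splitCurvature c σs x)
  evenTurán-split c σs x = begin
    evenTuránAt p x
      ≡⟨ cong₂ (λ u v → (# 1 + x) * (u * u) + - (# 1 * (f * v))) g≡
           (trans (⟦⟧-evenStep (oddStep p) x) (cong₂ (evenMap (# (degree (oddStep p))) x) g≡ g₁≡)) ⟩
    (# 1 + x) * (g * g) + - (# 1 * (f * evenMap (# (degree (oddStep p))) x g g₁))
      ≡⟨ cong (λ m → (# 1 + x) * (g * g) + - (# 1 * (f * evenMap (# (pred m)) x g g₁)))
        (length-oddStep p (length-split c σs)) ⟩
    (# 1 + x) * (g * g) + - (# 1 * (f * evenMap n x g g₁))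
      ≡⟨ evenTurán n x f f₁ f₂ ⟩
    - # 2 * x * (f * f + # 2 * splitCurvature c σs x) ∎
    where
    p = split c σs
    n = # (length σs)
    f = ⟦ p ⟧ x
    f₁ = ⟦ derivative p ⟧ x
    f₂ = ⟦ derivative (derivative p) ⟧ x
    g = oddMap n x f f₁
    g₁ = oddMap′ n x f f₁ f₂
    g≡ = trans (⟦⟧-oddStep p x) (cong (λ m → oddMap (# (pred m)) x f f₁) (length-split c σs))
    g₁≡ = trans (⟦⟧-oddStep′ p x) (cong (λ m → oddMap′ (# (pred m)) x f f₁ f₂) (length-split c σs))

  oddTurán-split : ∀ c σs x → let f = ⟦ split c σs ⟧ x in
    oddTuránAt (split c σs) x
        ≡ - # 2 * x * ((# 3 + x) * (f * f) + # 2 * (# 1 + x) * splitCurvature c σs x)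
  oddTurán-split c σs x = begin
    oddTuránAt p x
      ≡⟨ cong₂ (λ u v → # 1 * (u * u) + - ((# 1 + x) * (f * v))) g≡
           (trans (⟦⟧-oddStep (evenStep p) x) (cong₂ (oddMap (# (degree (evenStep p))) x) g≡ g₁≡)) ⟩
    # 1 * (g * g) + - ((# 1 + x) * (f * oddMap (# (degree (evenStep p))) x g g₁))
      ≡⟨ cong (λ m → # 1 * (g * g) + - ((# 1 + x) * (f * oddMap m x g g₁)))
           (trans (cong (λ m → # (pred m)) (length-evenStep p (length-split c σs)))
             (#-suc (length σs))) ⟩
    # 1 * (g * g) + - ((# 1 + x) * (f * oddMap (# 1 + n) x g g₁))
      ≡⟨ oddTurán n x f f₁ f₂ ⟩
    - # 2 * x * ((# 3 + x) * (f * f) + # 2 * (# 1 + x) * splitCurvature c σs x) ∎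
    where
    p = split c σs
    n = # (length σs)
    f = ⟦ p ⟧ x
    f₁ = ⟦ derivative p ⟧ x
    f₂ = ⟦ derivative (derivative p) ⟧ x
    g = evenMap n x f f₁
    g₁ = evenMap′ n x f f₁ f₂
    g≡ = trans (⟦⟧-evenStep p x) (cong (λ m → evenMap (# (pred m)) x f f₁) (length-split c σs))
    g₁≡ = trans (⟦⟧-evenStep′ p x)
        (cong (λ m → evenMap′ (# (pred m)) x f f₁ f₂) (length-split c σs))

-- Identities for conjugates and for differences

module RingIdentities (𝔸 : ℚ-Algebra) where
  open ℚ-Algebra 𝔸

  -- With conjugates in place of the barred variables, multiplying by the square of w̄ f̄ stands for
  -- dividing by (w f)². The two summands then carry the real factors |w|⁴ and |f|⁴, which do not
  -- affect the signs of real parts.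
  combine : ∀ y z q w w̄ f f̄ →
    y * (w * w * z + q * (f * f)) * ((w̄ * f̄) * (w̄ * f̄)) ≡
    (w * w̄) * (w * w̄) * (y * z * (f̄ * f̄)) + (f * f̄) * (f * f̄) * (y * q * (w̄ * w̄))
  combine = solve 7 (λ y z q w w̄ f f̄ →
    y :* (w :* w :* z :+ q :* (f :* f)) :* ((w̄ :* f̄) :* (w̄ :* f̄)) :=
    (w :* w̄) :* (w :* w̄) :* (y :* z :* (f̄ :* f̄)) :+ (f :* f̄) :* (f :* f̄) :*
      (y :* q :* (w̄ :* w̄))) refl

  combine-even : ∀ y z f f̄ →
    y * (f * f + # 2 * z) * (f̄ * f̄) ≡ (f * f̄) * (f * f̄) * y + # 2 * (y * z * (f̄ * f̄))
  combine-even = solve 4 (λ y z f f̄ →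
    y :* (f :* f :+ :# 2 :* z) :* (f̄ :* f̄) :=
    (f :* f̄) :* (f :* f̄) :* y :+ :# 2 :* (y :* z :* (f̄ :* f̄))) refl

  combine-odd : ∀ x X X̄ z f f̄ →
    x * X̄ * X̄ * ((X + # 2) * (f * f) + # 2 * X * z) * (f̄ * f̄) ≡
    (f * f̄) * (f * f̄) * ((X * X̄) * (x * X̄) + # 2 * (x * X̄ * X̄)) + (X * X̄)
      * (# 2 * (x * X̄ * z * (f̄ * f̄)))
  combine-odd = solve 6 (λ x X X̄ z f f̄ →
    x :* X̄ :* X̄ :* ((X :+ :# 2) :* (f :* f) :+ :# 2 :* X :* z) :* (f̄ :* f̄) :=
    (f :* f̄) :* (f :* f̄) :* ((X :* X̄) :* (x :* X̄) :+ :# 2 :* (x :* X̄ :* X̄)) :+ (X :* X̄) :*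
      (:# 2 :* (x :* X̄ :* z :* (f̄ :* f̄)))) refl

  subtract-difference : ∀ z w → z + - (z + - w) ≡ w
  subtract-difference = solve 2 (λ z w → z :+ :- (z :+ :- w) := w) refl

  difference-∷ : ∀ a b x u v → a + x * u + - (b + x * v) ≡ (a + - b) + x * (u + - v)
  difference-∷ = solve 5 (λ a b x u v → a :+ x :* u :+ :- (b :+ x :* v)
      := (a :+ :- b) :+ x :* (u :+ :- v)) refl

  difference-* : ∀ z w z′ w′ → z * w + - (z′ * w′) ≡ z * (w + - w′) + w′ * (z + - z′)
  difference-* = solve 4 (λ z w z′ w′ → z :* w :+ :- (z′ :* w′)
      := z :* (w :+ :- w′) :+ w′ :* (z :+ :- z′)) refl

  -- The common shape of both parities: the factor 1 + x sits in `α` for even indices and in `β` for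
  -- odd ones.
  turánForm : (α β f g h : Carrier) → Carrier
  turánForm α β f g h = α * (g * g) + - (β * (f * h))

  difference-turánForm : ∀ α β f g h f′ g′ h′ →
    turánForm α β f g h + - turánForm α β f′ g′ h′
        ≡ α * (g * g + - (g′ * g′)) + - (β * (f * h + - (f′ * h′)))
  difference-turánForm α β f g h f′ g′ h′ = solve 6 (λ α β u v u′ v′ →
    α :* u :+ :- (β :* v) :+ :- (α :* u′ :+ :- (β :* v′))
        := α :* (u :+ :- u′) :+ :- (β :* (v :+ :- v′)))
    refl α β (g * g) (f * h) (g′ * g′) (f′ * h′)

-- The Turán polynomials in terms of the reduced polynomials

module TuránFactorisation (𝔸 : ℚ-Algebra) where
  open ℚ-Algebra 𝔸
  open EvaluationAt 𝔸
  open Powers 𝔸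
  open Curvature 𝔸 using (evenTuránAt; oddTuránAt)
  open ℤ[x] using (_⊗_)
  open ≡-Reasoning

  ⟦⟧-turán : ∀ m x → let z = λ i → ℤ⇒.⟦ Z (suc i) ⟧ x in
    ℤ⇒.⟦ turán (suc m) ⟧ x ≡ z (suc m) * z (suc m) + - (z (suc (suc m)) * z m)
  ⟦⟧-turán m x = trans (ℤ⇒.⟦⟧-⊖ (Z (suc (suc m)) ⊗ Z (suc (suc m)))
      (Z (suc (suc (suc m))) ⊗ Z (suc m)) x)
    (cong₂ (λ u v → u + - v) (ℤ⇒.⟦⟧-⊗ (Z (suc (suc m))) (Z (suc (suc m))) x)
      (ℤ⇒.⟦⟧-⊗ (Z (suc (suc (suc m)))) (Z (suc m)) x))

  turán-odd : ∀ k x → let P = x * (# 1 + x) ^ k in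
    ℤ⇒.⟦ turán (suc (double k)) ⟧ x ≡ P * P * oddTuránAt (oddReduced k) x
  turán-odd k x = begin
    ℤ⇒.⟦ turán (suc (double k)) ⟧ x
      ≡⟨ ⟦⟧-turán (double k) x ⟩
    z₁ * z₁ + - (z₂ * z₀)
      ≡⟨ cong₂ (λ u v → u * u + - v) (Z-even k 𝔸 x) (cong₂ _*_ (Z-odd (suc k) 𝔸 x) (Z-odd k 𝔸 x)) ⟩
    x * P * g * (x * P * g) + - (x * ((# 1 + x) * P) * h * (x * P * f))
      ≡⟨ solve 5 (λ x P f g h → let X = :# 1 :+ x in
           x :* P :* g :* (x :* P :* g) :+ :- (x :* (X :* P) :* h :* (x :* P :* f))
           := x :* P :* (x :* P) :* (:# 1 :* (g :* g) :+ :- (X :* (f :* h)))) refl x P f g h ⟩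
    x * P * (x * P) * oddTuránAt (oddReduced k) x ∎
    where
    P = (# 1 + x) ^ k
    f = ℚ⇒.⟦ oddReduced k ⟧ x
    g = ℚ⇒.⟦ evenReduced k ⟧ x
    h = ℚ⇒.⟦ oddReduced (suc k) ⟧ x
    z₀ = ℤ⇒.⟦ Z (suc (double k)) ⟧ x
    z₁ = ℤ⇒.⟦ Z (suc (suc (double k))) ⟧ x
    z₂ = ℤ⇒.⟦ Z (suc (suc (suc (double k)))) ⟧ x

  turán-even : ∀ k x → let P = x * (# 1 + x) ^ k in
    ℤ⇒.⟦ turán (suc (suc (double k))) ⟧ x ≡ P * P * ((# 1 + x) * evenTuránAt (evenReduced k) x)
  turán-even k x = begin
    ℤ⇒.⟦ turán (suc (suc (double k))) ⟧ x
      ≡⟨ ⟦⟧-turán (suc (double k)) x ⟩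
    z₁ * z₁ + - (z₂ * z₀)
      ≡⟨ cong₂ (λ u v → u * u + - v) (Z-odd (suc k) 𝔸 x)
        (cong₂ _*_ (Z-even (suc k) 𝔸 x) (Z-even k 𝔸 x)) ⟩
    x * ((# 1 + x) * P) * g * (x * ((# 1 + x) * P) * g) + - (x * ((# 1 + x) * P) * h * (x * P * f))
      ≡⟨ solve 5 (λ x P f g h → let X = :# 1 :+ x in
           x :* (X :* P) :* g :* (x :* (X :* P) :* g) :+ :- (x :* (X :* P) :* h :* (x :* P :* f))
           := x :* P :* (x :* P) :* (X :* (X :* (g :* g) :+ :- (:# 1 :* (f :* h)))))
               refl x P f g h ⟩
    x * P * (x * P) * ((# 1 + x) * evenTuránAt (evenReduced k) x) ∎
    where
    P = (# 1 + x) ^ k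
    f = ℚ⇒.⟦ evenReduced k ⟧ x
    g = ℚ⇒.⟦ oddReduced (suc k) ⟧ x
    h = ℚ⇒.⟦ evenReduced (suc k) ⟧ x
    z₀ = ℤ⇒.⟦ Z (suc (suc (double k))) ⟧ x
    z₁ = ℤ⇒.⟦ Z (suc (suc (suc (double k)))) ⟧ x
    z₂ = ℤ⇒.⟦ Z (suc (suc (suc (suc (double k))))) ⟧ x

open import Data.Rational.Base using (½; ∣_∣; _+_; _*_; _-_; -_; _<_; _≤_; _⊓_; 1/_)
open import Data.Rational.Properties

-- Rational approximation of zeros

ℚ-algebra : ℚ-Algebra
ℚ-algebra = record
  { isCommutativeRing = +-*-isCommutativeRing
  ; ι = λ q → q ; ι-+ = λ _ _ → refl ; ι-* = λ _ _ → refl ; ι-neg = λ _ → refl }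

open ℚ-Algebra ℚ-algebra using (Expression; solve; :#; _:=_; _:+_; _:*_; _:-_; :-_; #)

-- Order and absolute value of rational numbers

difference : ∀ {a b} → a < b → 0ℚ < b - a
difference {a} {b} a<b = subst (_< b - a) (+-inverseʳ a) (+-monoˡ-< (- a) a<b)

difference-≤ : ∀ {a b} → a ≤ b → 0ℚ ≤ b - a
difference-≤ {a} {b} a≤b = subst (_≤ b - a) (+-inverseʳ a) (+-monoˡ-≤ (- a) a≤b)

private
  a+[b-a] : ∀ a b → a + (b - a) ≡ b
  a+[b-a] = solve 2 (λ a b → a :+ (b :- a) := b) refl

<-by : ∀ {a b} e → b - a ≡ e → 0ℚ < e → a < b
<-by {a} {b} e b-a≡e 0<e =
  subst₂ _<_ (+-identityʳ a) (a+[b-a] a b) (+-monoʳ-< a (subst (0ℚ <_) (sym b-a≡e) 0<e))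

≤-by : ∀ {a b} e → b - a ≡ e → 0ℚ ≤ e → a ≤ b
≤-by {a} {b} e b-a≡e 0≤e =
  subst₂ _≤_ (+-identityʳ a) (a+[b-a] a b) (+-monoʳ-≤ a (subst (0ℚ ≤_) (sym b-a≡e) 0≤e))

+-nonNeg : ∀ {a b} → 0ℚ ≤ a → 0ℚ ≤ b → 0ℚ ≤ a + b
+-nonNeg = +-mono-≤

*-pos : ∀ {a b} → 0ℚ < a → 0ℚ < b → 0ℚ < a * b
*-pos {a} {b} 0<a 0<b = positive⁻¹ _ {{pos*pos⇒pos a {{ℚ.positive 0<a}} b {{ℚ.positive 0<b}}}}

*-nonNeg : ∀ {a b} → 0ℚ ≤ a → 0ℚ ≤ b → 0ℚ ≤ a * b
*-nonNeg {a} {b} 0≤a 0≤b =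
  subst (_≤ a * b) (*-zeroʳ a) (*-monoˡ-≤-nonNeg a {{ℚ.nonNegative 0≤a}} 0≤b)

*-monoˡ-≤ : ∀ {c a b} → 0ℚ ≤ c → a ≤ b → c * a ≤ c * b
*-monoˡ-≤ {c} 0≤c = *-monoˡ-≤-nonNeg c {{ℚ.nonNegative 0≤c}}

*-monoʳ-≤ : ∀ {c a b} → 0ℚ ≤ c → a ≤ b → a * c ≤ b * c
*-monoʳ-≤ {c} 0≤c = *-monoʳ-≤-nonNeg c {{ℚ.nonNegative 0≤c}}

*-mono-≤ : ∀ {a b c d} → 0ℚ ≤ b → 0ℚ ≤ c → a ≤ b → c ≤ d → a * c ≤ b * d
*-mono-≤ 0≤b 0≤c a≤b c≤d = ≤-trans (*-monoʳ-≤ 0≤c a≤b) (*-monoˡ-≤ 0≤b c≤d)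

*-cancel-pos : ∀ {c a} → 0ℚ < c → 0ℚ < c * a → 0ℚ < a
*-cancel-pos {c} {a} 0<c 0<ca =
  *-cancelˡ-<-nonNeg c {{ℚ.nonNegative (<⇒≤ 0<c)}} (subst (_< c * a) (sym (*-zeroʳ c)) 0<ca)

*-cancel-≤ : ∀ {c a b} → 0ℚ < c → c * a ≤ c * b → a ≤ b
*-cancel-≤ {c} 0<c = *-cancelˡ-≤-pos c {{ℚ.positive 0<c}}

square-nonNeg : ∀ a → 0ℚ ≤ a * a
square-nonNeg a with ≤-total 0ℚ a
... | inj₁ 0≤a = *-nonNeg 0≤a 0≤a
... | inj₂ a≤0 = subst (0ℚ ≤_) (solve 1 (λ a → :- a :* :- a := a :* a) refl a)
  (*-nonNeg (neg-antimono-≤ a≤0) (neg-antimono-≤ a≤0))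

square-pos : ∀ {a} → 0ℚ < a → 0ℚ < a * a
square-pos 0<a = *-pos 0<a 0<a

0<1 : 0ℚ < 1ℚ
0<1 = positive⁻¹ 1ℚ

0<½ : 0ℚ < ½
0<½ = positive⁻¹ ½

half-pos : ∀ {ε} → 0ℚ < ε → 0ℚ < ½ * ε
half-pos = *-pos 0<½

half+half : ∀ ε → ½ * ε + ½ * ε ≡ ε
half+half ε = trans (sym (*-distribʳ-+ ε ½ ½)) (*-identityˡ ε)

≤∣∣ : ∀ a → a ≤ ∣ a ∣
≤∣∣ a with ≤-total 0ℚ a
... | inj₁ 0≤a = ≤-reflexive (sym (0≤p⇒∣p∣≡p 0≤a))
... | inj₂ a≤0 = ≤-trans a≤0 (0≤∣p∣ a)

∣∣-sym : ∀ a b → ∣ a - b ∣ ≡ ∣ b - a ∣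
∣∣-sym a b = trans (sym (∣-p∣≡∣p∣ (a - b)))
    (cong ∣_∣ (solve 2 (λ a b → :- (a :- b) := b :- a) refl a b))

∣∣-triangle : ∀ a b c → ∣ a - c ∣ ≤ ∣ a - b ∣ + ∣ b - c ∣
∣∣-triangle a b c = subst (λ u → ∣ u ∣ ≤ ∣ a - b ∣ + ∣ b - c ∣)
  (solve 3 (λ a b c → a :- b :+ (b :- c) := a :- c) refl a b c) (∣p+q∣≤∣p∣+∣q∣ (a - b) (b - c))

∣∣-*-≤ : ∀ {a b c d} → ∣ a ∣ ≤ c → ∣ b ∣ ≤ d → ∣ a * b ∣ ≤ c * d
∣∣-*-≤ {a} {b} a≤c b≤d = subst (_≤ _) (sym (∣p*q∣≡∣p∣*∣q∣ a b))
  (*-mono-≤ (≤-trans (0≤∣p∣ a) a≤c) (0≤∣p∣ b) a≤c b≤d)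

reciprocal : ∀ {a} → 0ℚ < a → ∃ λ r → 0ℚ < r × a * r ≡ 1ℚ
reciprocal {a} 0<a = 1/ a , positive⁻¹ _ {{1/pos⇒pos a}} , *-inverseʳ a
  where
  instance
    _ = ℚ.positive 0<a
    _ = pos⇒nonZero a

-- Approximate zeros on a grid

archimedean : ∀ q → ∃ λ n → q < # n
archimedean q@(ℚ.mkℚ num d-1 _) = suc ℤ.∣ num ∣ ,
  toℚᵘ-cancel-< (ℚᵘₚ.<-respʳ-≃ (ℚᵘₚ.≃-sym (toℚᵘ-fromℚᵘ (ℚᵘ.mkℚᵘ (ℤ.+ suc ℤ.∣ num ∣) 0)))
      (ℚᵘ.*<* (begin-strict
    num ℤ.* ℤ.+ 1                    ≡⟨ ℤₚ.*-identityʳ num ⟩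
    num                              ≤⟨ i≤∣i∣ num ⟩
    ℤ.+ ℤ.∣ num ∣                    <⟨ ℤ.+<+ (ℕₚ.n<1+n ℤ.∣ num ∣) ⟩
    ℤ.+ suc ℤ.∣ num ∣                ≤⟨ ℤ.+≤+ (ℕₚ.m≤m*n (suc ℤ.∣ num ∣) (suc d-1)) ⟩
    ℤ.+ (suc ℤ.∣ num ∣ ℕ.* suc d-1)  ≡⟨ ℤₚ.pos-* (suc ℤ.∣ num ∣) (suc d-1) ⟩
    ℤ.+ suc ℤ.∣ num ∣ ℤ.* ℤ.+ suc d-1 ∎)))
  where
  open ℤₚ.≤-Reasoning
  i≤∣i∣ : ∀ i → i ℤ.≤ ℤ.+ ℤ.∣ i ∣
  i≤∣i∣ (ℤ.+ n)      = ℤₚ.≤-refl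
  i≤∣i∣ ℤ.-[1+ n ]   = ℤ.-≤+

subdivision : ∀ {K w η} → 0ℚ ≤ K → 0ℚ < w → 0ℚ < η →
  ∃ λ n → ∃ λ d → 0ℚ < d × # n * d ≡ w × K * d < η
subdivision {K} {w} {η} 0≤K 0<w 0<η =
  let r , 0<r , ηr≡1 = reciprocal 0<η
      -- Since r = 1 / η, the number n exceeds K w / η, and n parts of length w / n satisfy the
      -- bound. As K w r is nonnegative, n is positive.
      n , Kwr<n = archimedean (K * w * r)
      0<n = ≤-<-trans (*-nonNeg (*-nonNeg 0≤K (<⇒≤ 0<w)) (<⇒≤ 0<r)) Kwr<n
      t , 0<t , nt≡1 = reciprocal 0<n
  in n , t * w , *-pos 0<t 0<w
   , trans (sym (*-assoc (# n) t w)) (trans (cong (_* w) nt≡1) (*-identityˡ w))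
   , <-by (η * t * (# n - K * w * r))
       (begin
         η - K * (t * w)
           ≡⟨ cong₂ _-_ (*-identityʳ η) (*-identityʳ (K * (t * w))) ⟨
         η * 1ℚ - K * (t * w) * 1ℚ
           ≡⟨ cong₂ (λ u v → η * u - K * (t * w) * v) nt≡1 ηr≡1 ⟨
         η * (# n * t) - K * (t * w) * (η * r)
           ≡⟨ solve 6 (λ η t n K w r → η :* (n :* t) :- K :* (t :* w) :* (η :* r)
             := η :* t :* (n :- K :* w :* r)) refl η t (# n) K w r ⟩
         η * t * (# n - K * w * r) ∎)
       (*-pos (*-pos 0<η 0<t) (difference Kwr<n))
  where
  open ≡-Reasoning

module _ (φ : ℚ → ℚ) {K : ℚ} (0≤K : 0ℚ ≤ K) {lo hi : ℚ}
  (lipschitz : ∀ {x y} → lo ≤ x → x ≤ hi → lo ≤ y → y ≤ hi → ∣ φ x - φ y ∣ ≤ K * ∣ x - y ∣) where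

  -- A rational intermediate value theorem. The grid is so fine that `φ` varies by less than `η`
  -- over a cell; the walk from `a` stops just before the first grid point at which `φ` is not
  -- positive, and there `φ` is positive but below `η`. The margin `η` at `a` makes the point found
  -- differ from `a`.
  approximateRoot : ∀ {a b η} → lo ≤ a → a < b → b ≤ hi → 0ℚ < η → η ≤ φ a → φ b < 0ℚ →
    ∃ λ σ → a < σ × σ < b × ∣ φ σ ∣ < η
  approximateRoot {a} {b} {η} lo≤a a<b b≤hi 0<η η≤φa φb<0 =
    let n , d , 0<d , nd≡w , Kd<η = subdivision 0≤K (difference a<b) 0<η
    in search d 0<d Kd<η n a ≤-refl (<-≤-trans 0<η η≤φa) (trans (cong (a +_) nd≡w) (a+[b-a] a b))
    where
    open ≤-Reasoning
    search : ∀ d → 0ℚ < d → K * d < η → ∀ n l → a ≤ l → 0ℚ < φ l → l + # n * d ≡ b →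
      ∃ λ σ → a < σ × σ < b × ∣ φ σ ∣ < η
    search d 0<d Kd<η zero l a≤l 0<φl l+0≡b =
      ⊥-elim (<-asym 0<φl (subst (λ u → φ u < 0ℚ) (trans (sym l+0≡b)
        (solve 2 (λ l d → l :+ :# 0 :* d := l) refl l d)) φb<0))
    search d 0<d Kd<η (suc n) l a≤l 0<φl l+nd≡b with 0ℚ <? φ (l + d)
    ... | yes 0<φ = search d 0<d Kd<η n (l + d) (≤-trans a≤l l≤l+d) 0<φ (trans step l+nd≡b)
      where
      l≤l+d : l ≤ l + d
      l≤l+d = ≤-by d (solve 2 (λ l d → l :+ d :- l := d) refl l d) (<⇒≤ 0<d)
      step : l + d + # n * d ≡ l + # (suc n) * d
      step = trans (solve 3 (λ l d n → l :+ d :+ n :* d := l :+ (:# 1 :+ n) :* d) refl l d (# n))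
        (cong (λ u → l + u * d) (sym (fromInt-+ (ℤ.+ 1) (ℤ.+ n))))
    ... | no ¬0<φ = l , a<l , <-≤-trans l<l+d l+d≤b , ∣φl∣<η
      where
      nd≥0 : 0ℚ ≤ # n * d
      nd≥0 = *-nonNeg (nonNegative⁻¹ (# n) {{normalize-nonNeg n 1}}) (<⇒≤ 0<d)
      l<l+d : l < l + d
      l<l+d = <-by d (solve 2 (λ l d → l :+ d :- l := d) refl l d) 0<d
      l+d≤b : l + d ≤ b
      l+d≤b = ≤-by (# n * d) (trans (cong (_- (l + d))
          (trans (sym l+nd≡b) (cong (λ u → l + u * d) (fromInt-+ (ℤ.+ 1) (ℤ.+ n)))))
        (solve 3 (λ l d n → l :+ (:# 1 :+ n) :* d :- (l :+ d) := n :* d) refl l d (# n))) nd≥0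
      ∣φl∣<η : ∣ φ l ∣ < η
      ∣φl∣<η = begin-strict
        ∣ φ l ∣                      ≡⟨ 0≤p⇒∣p∣≡p (<⇒≤ 0<φl) ⟩
        φ l                          ≤⟨ ≤-by (- φ (l + d)) (solve 2 (λ u v → u :- v :- u := :- v)
            refl (φ l) (φ (l + d))) (neg-antimono-≤ (≮⇒≥ ¬0<φ)) ⟩
        φ l - φ (l + d)              ≤⟨ ≤∣∣ (φ l - φ (l + d)) ⟩
        ∣ φ l - φ (l + d) ∣          ≤⟨ lipschitz (≤-trans lo≤a a≤l)
            (≤-trans (<⇒≤ l<l+d) (≤-trans l+d≤b b≤hi))
                                          (≤-trans (≤-trans lo≤a a≤l) (<⇒≤ l<l+d))
                                            (≤-trans l+d≤b b≤hi) ⟩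
        K * ∣ l - (l + d) ∣          ≡⟨ cong (K *_)
            (trans (∣∣-sym l (l + d))
              (trans (cong ∣_∣ (solve 2 (λ l d → l :+ d :- l := d) refl l d))
                (0≤p⇒∣p∣≡p (<⇒≤ 0<d)))) ⟩
        K * d                        <⟨ Kd<η ⟩
        η                            ∎
      a<l : a < l
      a<l with <-cmp a l
      ... | tri< a<l _ _  = a<l
      ... | tri≈ _ refl _ = ⊥-elim (<-irrefl refl (<-≤-trans (≤-<-trans (≤∣∣ (φ a)) ∣φl∣<η) η≤φa))
      ... | tri> _ _ l<a  = ⊥-elim (<-irrefl refl (<-≤-trans l<a a≤l))

-- Division by linear factors and sign alternation

module _ where

  open EvaluationAt ℚ-algebra using (module ℚ⇒)
  open ℚ⇒
  open LinearFactors ℚ-algebra using (⟦⟧-addLinear; ⟦⟧-split-∷)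
  open SplitDerivatives ℚ-algebra using (⟦⟧-split-∷′)
  open Steps ℚ-algebra using (⟦⟧-oddStep; ⟦⟧-evenStep)
  open RawMonoidOps ℚ.+-0-rawMonoid using () renaming (_×_ to _×ℚ_)

  -1ℚ : ℚ
  -1ℚ = - 1ℚ

  -- Both constants are meant for |x| ≤ 1. The second comes from x u - y v = u (x - y) + y (u - v),
  -- applied at each Horner step.
  coefficientSum lipschitzConstant : Poly → ℚ
  coefficientSum []      = 0ℚ
  coefficientSum (a ∷ p) = ∣ a ∣ + coefficientSum p
  lipschitzConstant []      = 0ℚ
  lipschitzConstant (a ∷ p) = coefficientSum p + lipschitzConstant p

  coefficientSum-nonNeg : ∀ p → 0ℚ ≤ coefficientSum p
  coefficientSum-nonNeg []      = ≤-refl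
  coefficientSum-nonNeg (a ∷ p) = +-nonNeg (0≤∣p∣ a) (coefficientSum-nonNeg p)

  lipschitzConstant-nonNeg : ∀ p → 0ℚ ≤ lipschitzConstant p
  lipschitzConstant-nonNeg []      = ≤-refl
  lipschitzConstant-nonNeg (a ∷ p) = +-nonNeg (coefficientSum-nonNeg p) (lipschitzConstant-nonNeg p)

  ⟦⟧-bounded : ∀ p {x} → ∣ x ∣ ≤ 1ℚ → ∣ ⟦ p ⟧ x ∣ ≤ coefficientSum p
  ⟦⟧-bounded []      x≤1 = ≤-refl
  ⟦⟧-bounded (a ∷ p) {x} x≤1 = ≤-trans (∣p+q∣≤∣p∣+∣q∣ a (x * ⟦ p ⟧ x))
    (+-monoʳ-≤ ∣ a ∣ (subst (∣ x * ⟦ p ⟧ x ∣ ≤_) (*-identityˡ (coefficientSum p))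
      (∣∣-*-≤ {x} {⟦ p ⟧ x} x≤1 (⟦⟧-bounded p x≤1))))

  ⟦⟧-lipschitz : ∀ p {x y} → ∣ x ∣ ≤ 1ℚ → ∣ y ∣ ≤ 1ℚ → ∣ ⟦ p ⟧ x - ⟦ p ⟧ y ∣ ≤ lipschitzConstant p
      * ∣ x - y ∣
  ⟦⟧-lipschitz [] {x} {y} _ _ = ≤-reflexive (sym (*-zeroˡ ∣ x - y ∣))
  ⟦⟧-lipschitz (a ∷ p) {x} {y} x≤1 y≤1 = begin
    ∣ a + x * ⟦ p ⟧ x - (a + y * ⟦ p ⟧ y) ∣
      ≡⟨ cong ∣_∣ (solve 5 (λ a x y u v → a :+ x :* u :- (a :+ y :* v)
        := u :* (x :- y) :+ y :* (u :- v)) refl a x y (⟦ p ⟧ x) (⟦ p ⟧ y)) ⟩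
    ∣ ⟦ p ⟧ x * (x - y) + y * (⟦ p ⟧ x - ⟦ p ⟧ y) ∣
      ≤⟨ ∣p+q∣≤∣p∣+∣q∣ (⟦ p ⟧ x * (x - y)) (y * (⟦ p ⟧ x - ⟦ p ⟧ y)) ⟩
    ∣ ⟦ p ⟧ x * (x - y) ∣ + ∣ y * (⟦ p ⟧ x - ⟦ p ⟧ y) ∣
      ≤⟨ +-mono-≤ (∣∣-*-≤ {⟦ p ⟧ x} {x - y} (⟦⟧-bounded p x≤1) ≤-refl)
        (∣∣-*-≤ {y} {⟦ p ⟧ x - ⟦ p ⟧ y} y≤1 (⟦⟧-lipschitz p x≤1 y≤1)) ⟩
    coefficientSum p * ∣ x - y ∣ + 1ℚ * (lipschitzConstant p * ∣ x - y ∣)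
      ≡⟨ solve 3 (λ u v w → u :* w :+ :# 1 :* (v :* w) := (u :+ v) :* w)
        refl (coefficientSum p) (lipschitzConstant p) ∣ x - y ∣ ⟩
    (coefficientSum p + lipschitzConstant p) * ∣ x - y ∣ ∎
    where open ≤-Reasoning

  ∣∣≤1 : ∀ {x} → -1ℚ ≤ x → x ≤ 0ℚ → ∣ x ∣ ≤ 1ℚ
  ∣∣≤1 {x} -1≤x x≤0 = subst (_≤ 1ℚ) (trans (sym (0≤p⇒∣p∣≡p (neg-antimono-≤ x≤0))) (∣-p∣≡∣p∣ x))
      (neg-antimono-≤ -1≤x)

  -- Synthetic division by X - σ: the coefficients are the Horner values of the tails at σ, and the
  -- value of the whole list is the remainder.
  quotient : ℚ → Poly → Poly
  quotient σ []              = []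
  quotient σ (a ∷ [])        = []
  quotient σ (a ∷ p@(_ ∷ _)) = ⟦ p ⟧ σ ∷ quotient σ p

  length-quotient : ∀ σ p → length (quotient σ p) ≡ pred (length p)
  length-quotient σ []              = refl
  length-quotient σ (a ∷ [])        = refl
  length-quotient σ (a ∷ p@(_ ∷ _)) = cong suc (length-quotient σ p)

  division : ∀ σ a p → addLinear (⟦ a ∷ p ⟧ σ) σ (quotient σ (a ∷ p)) ≡ a ∷ p
  division σ a [] = cong (_∷ []) (solve 2 (λ a σ → a :+ σ :* :# 0 := a) refl a σ)
  division σ a p@(b ∷ q) = cong₂ _∷_
    (solve 3 (λ a σ v → a :+ σ :* v :- σ :* v := a) refl a σ (⟦ p ⟧ σ))
    (division σ b q)

  -- Equal lengths are part of the relation because the formal degree, and with it `oddStep` and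
  -- `evenStep`, depends on the length.
  Close : ℚ → Poly → Poly → Set
  Close ε = Pointwise (λ a b → ∣ a - b ∣ < ε)

  signed : ℕ → ℚ → ℚ
  signed zero    a = a
  signed (suc n) a = - signed n a

  ∣signed∣ : ∀ n a → ∣ signed n a ∣ ≡ ∣ a ∣
  ∣signed∣ zero    a = refl
  ∣signed∣ (suc n) a = trans (∣-p∣≡∣p∣ (signed n a)) (∣signed∣ n a)

  signed-* : ∀ n a b → signed n (a * b) ≡ a * signed n b
  signed-* zero    a b = refl
  signed-* (suc n) a b = trans (cong -_ (signed-* n a b)) (neg-distribʳ-* a (signed n b))

  signed-+ : ∀ n a b → signed n (a + b) ≡ signed n a + signed n b
  signed-+ zero    a b = refl
  signed-+ (suc n) a b = trans (cong -_ (signed-+ n a b)) (neg-distrib-+ (signed n a) (signed n b))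

  signed-neg : ∀ n a → signed n (- a) ≡ - signed n a
  signed-neg zero    a = refl
  signed-neg (suc n) a = cong -_ (signed-neg n a)

  signed-minus : ∀ n a b → signed n (a - b) ≡ signed n a - signed n b
  signed-minus n a b = trans (signed-+ n a (- b)) (cong (signed n a +_) (signed-neg n b))

  -- The exponent of the sign counts the points further to the right, so the last value is positive.
  -- This fits the steps, which are positive at their last point 0.
  Alternating : (ℚ → ℚ) → List ℚ → Set
  Alternating φ []       = ⊤
  Alternating φ (q ∷ qs) = 0ℚ < signed (length qs) (φ q) × Alternating φ qs

  AlternatingBy : ℚ → (ℚ → ℚ) → List ℚ → Set
  AlternatingBy η φ []       = ⊤
  AlternatingBy η φ (q ∷ qs) = η ≤ signed (length qs) (φ q) × AlternatingBy η φ qs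

  AlternatingBy-mono : ∀ {η θ φ} qs → η ≤ θ → AlternatingBy θ φ qs → AlternatingBy η φ qs
  AlternatingBy-mono []       η≤θ tt          = tt
  AlternatingBy-mono (q ∷ qs) η≤θ (θ≤ , rest) = ≤-trans η≤θ θ≤ , AlternatingBy-mono qs η≤θ rest

  ⊓-pos : ∀ {a b} → 0ℚ < a → 0ℚ < b → 0ℚ < a ⊓ b
  ⊓-pos {a} {b} 0<a 0<b with ⊓-sel a b
  ... | inj₁ eq = subst (0ℚ <_) (sym eq) 0<a
  ... | inj₂ eq = subst (0ℚ <_) (sym eq) 0<b

  alternation-margin : ∀ {φ} qs → Alternating φ qs → ∃ λ η → 0ℚ < η × AlternatingBy η φ qs
  alternation-margin []       tt         = 1ℚ , 0<1 , tt
  alternation-margin {φ} (q ∷ qs) (0<φq , alt) =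
    let η , 0<η , by = alternation-margin qs alt
        v = signed (length qs) (φ q)
    in v ⊓ η , ⊓-pos 0<φq 0<η , p⊓q≤p v η , AlternatingBy-mono qs (p⊓q≤q v η) by

  Between : ℚ → List ℚ → ℚ → Set
  Between lo []       hi = lo < hi
  Between lo (q ∷ qs) hi = lo < q × Between q qs hi

  -- Unlike in `Between`, the last point may equal `hi`: 0 is itself a point of alternation, whereas
  -- zeros lie strictly below it.
  Increasing : ℚ → List ℚ → ℚ → Set
  Increasing q []        hi = q ≤ hi
  Increasing q (q′ ∷ qs) hi = q < q′ × Increasing q′ qs hi

  Between⇒< : ∀ {lo hi} qs → Between lo qs hi → lo < hi
  Between⇒< []       lo<hi          = lo<hi
  Between⇒< (q ∷ qs) (lo<q , rest)  = <-trans lo<q (Between⇒< qs rest)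

  Increasing⇒≤ : ∀ {q hi} qs → Increasing q qs hi → q ≤ hi
  Increasing⇒≤ []        q≤hi         = q≤hi
  Increasing⇒≤ (q′ ∷ qs) (q<q′ , inc) = ≤-trans (<⇒≤ q<q′) (Increasing⇒≤ qs inc)

  -- Each new coefficient is c - σ a with |σ| ≤ 1, so errors at most add up and the tolerance
  -- doubles.
  addLinear-close : ∀ {ε σ c d} p q → ∣ σ ∣ ≤ 1ℚ → ∣ c - d ∣ < ε → Close ε p q →
    Close (ε + ε) (addLinear c σ p) (addLinear d σ q)
  addLinear-close {ε} [] [] σ≤1 c~d [] =
    <-≤-trans c~d (≤-by ε (solve 1 (λ e → e :+ e :- e := e) refl ε) (≤-trans (0≤∣p∣ _) (<⇒≤ c~d))) ∷
        []
  addLinear-close {ε} {σ} {c} {d} (a ∷ p) (b ∷ q) σ≤1 c~d (a~b ∷ p~q) =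
    (begin-strict
      ∣ c - σ * a - (d - σ * b) ∣
        ≡⟨ cong ∣_∣ (solve 5 (λ c d s a b → c :- s :* a :- (d :- s :* b) := c :- d :+ s :* (b :- a))
          refl c d σ a b) ⟩
      ∣ c - d + σ * (b - a) ∣
        ≤⟨ ∣p+q∣≤∣p∣+∣q∣ (c - d) (σ * (b - a)) ⟩
      ∣ c - d ∣ + ∣ σ * (b - a) ∣
        <⟨ +-mono-<-≤ c~d (≤-trans (∣∣-*-≤ {σ} {b - a} σ≤1
          (≤-trans (≤-reflexive (∣∣-sym b a)) (<⇒≤ a~b))) (≤-reflexive (*-identityˡ ε))) ⟩
      ε + ε ∎)
    ∷ addLinear-close p q σ≤1 a~b p~q
    where open ≤-Reasoning

  -- For p = `a ∷ p` as a whole, p q - p σ is (q - σ) times the quotient at q. The remainder p σ is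
  -- smaller than the margin, so it cannot change the sign of p q, and q - σ is positive.
  quotient-alternating : ∀ {η} σ a p {q} qs {hi} → ∣ ⟦ a ∷ p ⟧ σ ∣ < η → σ < q →
      Increasing q qs hi →
    AlternatingBy η ⟦ a ∷ p ⟧ (q ∷ qs) → Alternating ⟦ quotient σ (a ∷ p) ⟧ (q ∷ qs)
  quotient-alternating {η} σ a p {q} qs {hi} small σ<q inc (η≤ , by) =
      *-cancel-pos (difference σ<q) positive , tail qs inc by
    where
    n = length qs
    open ≤-Reasoning
    value : signed n (⟦ a ∷ p ⟧ q) - signed n (⟦ a ∷ p ⟧ σ)
        ≡ (q - σ) * signed n (⟦ quotient σ (a ∷ p) ⟧ q)
    value = trans (sym (signed-minus n _ _)) (trans (cong (signed n) (trans
      (cong (_- ⟦ a ∷ p ⟧ σ) (trans (cong (λ r → ⟦ r ⟧ q) (sym (division σ a p)))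
        (⟦⟧-addLinear (⟦ a ∷ p ⟧ σ) σ (quotient σ (a ∷ p)) q)))
      (solve 2 (λ u v → u :+ v :- u := v) refl (⟦ a ∷ p ⟧ σ) _)))
      (signed-* n (q - σ) _))
    positive : 0ℚ < (q - σ) * signed n (⟦ quotient σ (a ∷ p) ⟧ q)
    positive = subst (0ℚ <_) value (difference (begin-strict
      signed n (⟦ a ∷ p ⟧ σ)      ≤⟨ ≤∣∣ _ ⟩
      ∣ signed n (⟦ a ∷ p ⟧ σ) ∣  ≡⟨ ∣signed∣ n _ ⟩
      ∣ ⟦ a ∷ p ⟧ σ ∣             <⟨ small ⟩
      η                           ≤⟨ η≤ ⟩
      signed n (⟦ a ∷ p ⟧ q)      ∎))
    tail : ∀ qs → Increasing q qs hi → AlternatingBy η ⟦ a ∷ p ⟧ qs →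
        Alternating ⟦ quotient σ (a ∷ p) ⟧ qs
    tail []        _            _  = tt
    tail (q′ ∷ qs) (q<q′ , inc) by = quotient-alternating σ a p qs small (<-trans σ<q q<q′) inc by

  SplitApproximation : Poly → ℚ → ℚ → ℚ → Set
  SplitApproximation p lo hi ε = ∃ λ c → ∃ λ σs → 0ℚ < c × Between lo σs hi × Close ε p (split c σs)

  -- A point σ of the first interval with |p σ| below every |p q| is divided out: the quotient
  -- still alternates at the remaining points.
  approximate-split : ∀ p {lo q} qs → length p ≡ suc (length qs) → -1ℚ ≤ q → Increasing q qs 0ℚ →
      lo ≤ q → lo < 0ℚ →
    Alternating ⟦ p ⟧ (q ∷ qs) → ∀ ε → 0ℚ < ε → SplitApproximation p lo 0ℚ ε
  approximate-split (a ∷ []) {q = q} [] _ _ _ _ lo<0 (0<p , _) ε 0<ε =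
    a , [] , subst (0ℚ <_) (solve 2 (λ a q → a :+ q :* :# 0 := a) refl a q) 0<p , lo<0 ,
    subst (λ u → ∣ u ∣ < ε) (sym (+-inverseʳ a)) 0<ε ∷ []
  approximate-split (a ∷ p@(b ∷ p′)) {lo} {q} (q′ ∷ qs) len -1≤q (q<q′ , inc) lo≤q lo<0
      alt@(0<pq , 0<pq′ , _) ε 0<ε =
    let η , 0<η , (η≤ , by) = alternation-margin {⟦ a ∷ p ⟧} (q ∷ q′ ∷ qs) alt
        -- Below `η` the remainder leaves the signs of the quotient intact; below half of `ε` it may
        -- be dropped, and `addLinear-close` doubles that half to `ε`.
        θ = η ⊓ (½ * ε)
        σ , q<σ , σ<q′ , small = approximateRoot φ (lipschitzConstant-nonNeg (a ∷ p)) lipschitz -1≤q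
            q<q′ q′≤0
          (⊓-pos 0<η (half-pos 0<ε)) (≤-trans (p⊓q≤p η (½ * ε)) η≤) φq′<0
        small′ : ∣ ⟦ a ∷ p ⟧ σ ∣ < θ
        small′ = subst (_< θ) (∣signed∣ (suc n) (⟦ a ∷ p ⟧ σ)) small
        c , σs , 0<c , between , close = approximate-split (quotient σ (a ∷ p)) {σ} {q′} qs
          (trans (length-quotient σ (a ∷ p)) (ℕₚ.suc-injective len))
          (≤-trans -1≤q (<⇒≤ q<q′)) inc (<⇒≤ σ<q′) (<-≤-trans σ<q′ q′≤0)
          (quotient-alternating σ a p qs (<-≤-trans small′ (p⊓q≤p η (½ * ε))) σ<q′ inc by) (½ * ε)
            (half-pos 0<ε)
    in c , σ ∷ σs , 0<c , (≤-<-trans lo≤q q<σ , between) ,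
       subst₂ (λ δ r → Close δ r (split c (σ ∷ σs))) (half+half ε) (division σ a p)
         (addLinear-close {c = ⟦ a ∷ p ⟧ σ} {d = 0ℚ} (quotient σ (a ∷ p)) (split c σs)
           (∣∣≤1 (≤-trans -1≤q (<⇒≤ q<σ)) (≤-trans (<⇒≤ σ<q′) q′≤0))
           (subst (λ u → ∣ u ∣ < ½ * ε) (sym (+-identityʳ (⟦ a ∷ p ⟧ σ)))
             (<-≤-trans small′ (p⊓q≤q η (½ * ε)))) close)
    where
    n = length qs
    q′≤0 = Increasing⇒≤ qs inc
    φ : ℚ → ℚ
    φ x = signed (suc n) (⟦ a ∷ p ⟧ x)
    φq′<0 : φ q′ < 0ℚ
    φq′<0 = neg-antimono-< 0<pq′
    lipschitz : ∀ {x y} → -1ℚ ≤ x → x ≤ 0ℚ → -1ℚ ≤ y → y ≤ 0ℚ → ∣ φ x - φ y ∣ ≤ lipschitzConstant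
        (a ∷ p) * ∣ x - y ∣
    lipschitz {x} {y} -1≤x x≤0 -1≤y y≤0 = subst (_≤ lipschitzConstant (a ∷ p) * ∣ x - y ∣)
      (trans (sym (∣signed∣ (suc n) (⟦ a ∷ p ⟧ x - ⟦ a ∷ p ⟧ y)))
        (cong ∣_∣ (signed-minus (suc n) (⟦ a ∷ p ⟧ x) (⟦ a ∷ p ⟧ y))))
      (⟦⟧-lipschitz (a ∷ p) (∣∣≤1 -1≤x x≤0) (∣∣≤1 -1≤y y≤0))

  -- Continuity of the steps in the coefficients

  Close-mono : ∀ {δ ε p q} → δ ≤ ε → Close δ p q → Close ε p q
  Close-mono δ≤ε = Pointwise.map (λ a~b → <-≤-trans a~b δ≤ε)

  Close-trans : ∀ {δ ε p q r} → Close δ p q → Close ε q r → Close (δ + ε) p r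
  Close-trans {p = []} {[]} {[]} [] [] = []
  Close-trans {p = a ∷ p} {b ∷ q} {c ∷ r} (a~b ∷ p~q) (b~c ∷ q~r) =
    ≤-<-trans (∣∣-triangle a b c) (+-mono-< a~b b~c) ∷ Close-trans p~q q~r

  Close-⊕ : ∀ {ε p q p′ q′} → 0ℚ < ε → Close ε p p′ → Close ε q q′ → Close (ε + ε) (p ⊕ q) (p′ ⊕ q′)
  Close-⊕ {ε} 0<ε []          q~q′        =
      Close-mono (≤-by ε (solve 1 (λ e → e :+ e :- e := e) refl ε) (<⇒≤ 0<ε)) q~q′
  Close-⊕ {ε} 0<ε p~p′@(_ ∷ _) []          =
      Close-mono (≤-by ε (solve 1 (λ e → e :+ e :- e := e) refl ε) (<⇒≤ 0<ε)) p~p′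
  Close-⊕ {ε} {a ∷ p} {b ∷ q} {a′ ∷ p′} {b′ ∷ q′} 0<ε (a~a′ ∷ p~p′) (b~b′ ∷ q~q′) =
    ≤-<-trans
      (subst (λ u → ∣ u ∣ ≤ ∣ a - a′ ∣ + ∣ b - b′ ∣)
        (solve 4 (λ a b a′ b′ → a :- a′ :+ (b :- b′) := a :+ b :- (a′ :+ b′)) refl a b a′ b′)
        (∣p+q∣≤∣p∣+∣q∣ (a - a′) (b - b′)))
      (+-mono-< a~a′ b~b′)
    ∷ Close-⊕ 0<ε p~p′ q~q′

  Continuous : (ℚ → ℚ) → ℚ → Set
  Continuous f a = ∀ {ε} → 0ℚ < ε → ∃ λ δ → 0ℚ < δ × (∀ b → ∣ a - b ∣ < δ → ∣ f a - f b ∣ < ε)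

  ContinuousAt : (Poly → Poly) → Poly → Set
  ContinuousAt F p = ∀ {ε} → 0ℚ < ε → ∃ λ δ → 0ℚ < δ × (∀ q → Close δ p q → Close ε (F p) (F q))

  scale-continuous : ∀ c a → Continuous (c *_) a
  scale-continuous c a {ε} 0<ε =
    let 0<c+1 = +-mono-≤-< (0≤∣p∣ c) 0<1
        r , 0<r , eq = reciprocal 0<c+1
    in r * ε , *-pos 0<r 0<ε , λ b a~b → begin-strict
      ∣ c * a - c * b ∣      ≡⟨ cong ∣_∣ (solve 3 (λ c a b → c :* a :- c :* b := c :* (a :- b))
          refl c a b) ⟩
      ∣ c * (a - b) ∣        ≤⟨ ∣∣-*-≤ {c} {a - b} ≤-refl (<⇒≤ a~b) ⟩
      ∣ c ∣ * (r * ε)        <⟨ <-by (r * ε) (trans (cong (_- ∣ c ∣ * (r * ε))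
          (sym (trans (cong (_* ε) eq) (*-identityˡ ε))))
            (solve 3 (λ c r e → (c :+ :# 1) :* r :* e :- c :* (r :* e) := r :* e) refl ∣ c ∣ r ε))
              (*-pos 0<r 0<ε) ⟩
      ε                      ∎
    where open ≤-Reasoning

  ×-continuous : ∀ k a → Continuous (k ×ℚ_) a
  ×-continuous zero a {ε} 0<ε = 1ℚ , 0<1 , λ _ _ → 0<ε
  ×-continuous (suc k) a {ε} 0<ε =
    let δ , 0<δ , close = ×-continuous k a (half-pos 0<ε)
    in δ ⊓ (½ * ε) , ⊓-pos 0<δ (half-pos 0<ε) , λ b a~b → begin-strict
      ∣ a + k ×ℚ a - (b + k ×ℚ b) ∣
        ≡⟨ cong ∣_∣ (solve 4 (λ a b u v → a :+ u :- (b :+ v) := a :- b :+ (u :- v))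
          refl a b (k ×ℚ a) (k ×ℚ b)) ⟩
      ∣ a - b + (k ×ℚ a - k ×ℚ b) ∣
        ≤⟨ ∣p+q∣≤∣p∣+∣q∣ (a - b) (k ×ℚ a - k ×ℚ b) ⟩
      ∣ a - b ∣ + ∣ k ×ℚ a - k ×ℚ b ∣
        <⟨ +-mono-< (<-≤-trans a~b (p⊓q≤q δ (½ * ε))) (close b (<-≤-trans a~b (p⊓q≤p δ (½ * ε)))) ⟩
      ½ * ε + ½ * ε
        ≡⟨ half+half ε ⟩
      ε ∎
    where open ≤-Reasoning

  id-continuous : ∀ p → ContinuousAt (λ q → q) p
  id-continuous p {ε} 0<ε = ε , 0<ε , λ _ p~q → p~q

  ∘-continuous : ∀ {F G p} → ContinuousAt G p → ContinuousAt F (G p) →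
      ContinuousAt (λ q → F (G q)) p
  ∘-continuous {G = G} contG contF 0<ε =
    let δ , 0<δ , closeF = contF 0<ε
        θ , 0<θ , closeG = contG 0<δ
    in θ , 0<θ , λ q p~q → closeF (G q) (closeG q p~q)

  ⊕-continuous : ∀ {F G p} → ContinuousAt F p → ContinuousAt G p → ContinuousAt (λ q → F q ⊕ G q) p
  ⊕-continuous {F} {G} {p} contF contG {ε} 0<ε =
    let δ , 0<δ , closeF = contF (half-pos 0<ε)
        θ , 0<θ , closeG = contG (half-pos 0<ε)
    in δ ⊓ θ , ⊓-pos 0<δ 0<θ , λ q p~q →
       subst (λ e → Close e (F p ⊕ G p) (F q ⊕ G q)) (half+half ε)
         (Close-⊕ (half-pos 0<ε) (closeF q (Close-mono (p⊓q≤p δ θ) p~q))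
           (closeG q (Close-mono (p⊓q≤q δ θ) p~q)))

  cons-continuous : ∀ {f F a p} → Continuous f a → ContinuousAt F p → ∀ {ε} → 0ℚ < ε →
    ∃ λ δ → 0ℚ < δ × (∀ b q → ∣ a - b ∣ < δ → Close δ p q → Close ε (f a ∷ F p) (f b ∷ F q))
  cons-continuous contf contF 0<ε =
    let δ , 0<δ , closef = contf 0<ε
        θ , 0<θ , closeF = contF 0<ε
    in δ ⊓ θ , ⊓-pos 0<δ 0<θ , λ b q a~b p~q →
       closef b (<-≤-trans a~b (p⊓q≤p δ θ)) ∷ closeF q (Close-mono (p⊓q≤q δ θ) p~q)

  shift-continuous : ∀ p → ContinuousAt (0ℚ ∷_) p
  shift-continuous p {ε} 0<ε = ε , 0<ε , λ _ p~q → 0<ε ∷ p~q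

  map-continuous : ∀ c p → ContinuousAt (map (c *_)) p
  map-continuous c []      0<ε = 1ℚ , 0<1 , λ { [] [] → [] }
  map-continuous c (a ∷ p) 0<ε =
    let δ , 0<δ , close = cons-continuous (scale-continuous c a) (map-continuous c p) 0<ε
    in δ , 0<δ , λ { (b ∷ q) (a~b ∷ p~q) → close b q a~b p~q }

  weighted-continuous : ∀ k p → ContinuousAt (weighted k) p
  weighted-continuous k []      0<ε = 1ℚ , 0<1 , λ { [] [] → [] }
  weighted-continuous k (a ∷ p) 0<ε =
    let δ , 0<δ , close = cons-continuous (×-continuous k a) (weighted-continuous (suc k) p) 0<ε
    in δ , 0<δ , λ { (b ∷ q) (a~b ∷ p~q) → close b q a~b p~q }

  derivative-continuous : ∀ p → ContinuousAt derivative p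
  derivative-continuous []      0<ε = 1ℚ , 0<1 , λ { [] [] → [] }
  derivative-continuous (a ∷ p) 0<ε =
    let δ , 0<δ , close = weighted-continuous 1 p 0<ε
    in δ , 0<δ , λ { (b ∷ q) (a~b ∷ p~q) → close q p~q }

  coderivative-cons-continuous : ∀ a {b p} → ContinuousAt coderivative (b ∷ p) →
      ContinuousAt coderivative (a ∷ b ∷ p)
  coderivative-cons-continuous a {b} {p} cont {ε} 0<ε =
    let δ , 0<δ , close = cons-continuous (scale-continuous (fromInt (ℤ.+ suc (length p))) a) cont
            0<ε
    in δ , 0<δ , λ { (a′ ∷ q@(_ ∷ _)) (a~a′ ∷ p~q) →
         -- The integer factor depends on the list only through its length, which closeness
         -- preserves.
         subst (λ n → Close ε (coderivative (a ∷ b ∷ p)) (fromInt (ℤ.+ n) * a′ ∷ coderivative q))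
           (Pointwise.Pointwise-length p~q) (close a′ q a~a′ p~q) }

  coderivative-continuous : ∀ p → ContinuousAt coderivative p
  coderivative-continuous []          0<ε = 1ℚ , 0<1 , λ { [] [] → [] }
  coderivative-continuous (a ∷ [])    0<ε = 1ℚ , 0<1 , λ { (b ∷ []) (_ ∷ []) → [] }
  coderivative-continuous (a ∷ b ∷ p)     =
      coderivative-cons-continuous a (coderivative-continuous (b ∷ p))

  doublePolar-continuous : ∀ p → ContinuousAt doublePolar p
  doublePolar-continuous p = ∘-continuous {F = map (2ℚ *_)} {G = polar}
    (⊕-continuous {derivative} {coderivative} (derivative-continuous p) (coderivative-continuous p))
      (map-continuous 2ℚ (polar p))

  oddStep-continuous : ∀ p → ContinuousAt oddStep p
  oddStep-continuous p = ⊕-continuous {λ q → q} {λ q → 0ℚ ∷ doublePolar q} (id-continuous p)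
    (∘-continuous {F = 0ℚ ∷_} {G = doublePolar} (doublePolar-continuous p)
      (shift-continuous (doublePolar p)))

  evenStep-continuous : ∀ p → ContinuousAt evenStep p
  evenStep-continuous p =
    ⊕-continuous {λ q → q} {λ q →
        (0ℚ ∷ (map (3ℚ *_) q ⊕ doublePolar q)) ⊕ (0ℚ ∷ 0ℚ ∷ doublePolar q)} (id-continuous p)
      (⊕-continuous {λ q → 0ℚ ∷ (map (3ℚ *_) q ⊕ doublePolar q)} {λ q → 0ℚ ∷ 0ℚ ∷ doublePolar q}
        (∘-continuous {F = 0ℚ ∷_} {G = λ q → map (3ℚ *_) q ⊕ doublePolar q}
          (⊕-continuous {map (3ℚ *_)} {doublePolar} (map-continuous 3ℚ p)
            (doublePolar-continuous p))
          (shift-continuous (map (3ℚ *_) p ⊕ doublePolar p)))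
        (∘-continuous {F = λ q → 0ℚ ∷ 0ℚ ∷ q} {G = doublePolar} (doublePolar-continuous p)
          (∘-continuous {F = 0ℚ ∷_} {G = 0ℚ ∷_} (shift-continuous (doublePolar p))
            (shift-continuous (0ℚ ∷ doublePolar p)))))

  -- Alternation of a step at the zeros of its argument

  SimpleRoots : (f f₁ : ℚ → ℚ) → List ℚ → Set
  SimpleRoots f f₁ []       = ⊤
  SimpleRoots f f₁ (σ ∷ σs) = f σ ≡ 0ℚ × 0ℚ < signed (length σs) (f₁ σ) × SimpleRoots f f₁ σs

  Between-weaken : ∀ {lo lo′ hi} σs → lo ≤ lo′ → Between lo′ σs hi → Between lo σs hi
  Between-weaken []       lo≤lo′ lo′<hi         = ≤-<-trans lo≤lo′ lo′<hi
  Between-weaken (σ ∷ σs) lo≤lo′ (lo′<σ , rest) = ≤-<-trans lo≤lo′ lo′<σ , rest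

  split-below : ∀ {c x hi} σs → 0ℚ < c → Between x σs hi →
      0ℚ < signed (length σs) (⟦ split c σs ⟧ x)
  split-below {c} {x} [] 0<c _ = subst (0ℚ <_) (solve 2 (λ c x → c := c :+ x :* :# 0) refl c x) 0<c
  split-below {c} {x} (σ ∷ σs) 0<c (x<σ , between) =
    subst (0ℚ <_) (sym value)
        (*-pos (difference x<σ) (split-below σs 0<c (Between-weaken σs (<⇒≤ x<σ) between)))
    where
    n = length σs
    v = ⟦ split c σs ⟧ x
    value : signed (suc n) (⟦ split c (σ ∷ σs) ⟧ x) ≡ (σ - x) * signed n v
    value = trans (cong (signed (suc n)) (⟦⟧-split-∷ c σ σs x))
      (trans (cong -_ (signed-* n (x - σ) v))
        (solve 3 (λ x s v → :- ((x :- s) :* v) := (s :- x) :* v) refl x σ (signed n v)))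

  split-above : ∀ {c lo x} σs → 0ℚ < c → Between lo σs x → 0ℚ < ⟦ split c σs ⟧ x
  split-above {c} {x = x} [] 0<c _ =
      subst (0ℚ <_) (solve 2 (λ c x → c := c :+ x :* :# 0) refl c x) 0<c
  split-above {c} {x = x} (σ ∷ σs) 0<c (_ , between) =
    subst (0ℚ <_) (sym (⟦⟧-split-∷ c σ σs x))
        (*-pos (difference (Between⇒< σs between)) (split-above σs 0<c between))

  -- At the first zero σ the derivative of (X - σ) g is g σ, whose sign `split-below` provides. At a
  -- later zero τ it is (τ - σ) g′ τ with a positive first factor.
  split-simpleRoots : ∀ {c lo hi} σs → 0ℚ < c → Between lo σs hi →
      SimpleRoots ⟦ split c σs ⟧ ⟦ derivative (split c σs) ⟧ σs
  split-simpleRoots [] _ _ = tt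
  split-simpleRoots {c} {hi = hi} (σ ∷ σs) 0<c (_ , between) =
      trans (⟦⟧-split-∷ c σ σs σ) (solve 2 (λ s v → (s :- s) :* v := :# 0) refl σ (g σ))
    , subst (λ u → 0ℚ < signed (length σs) u)
        (sym (trans (⟦⟧-split-∷′ c σ σs σ) (solve 3 (λ s v w → v :+ (s :- s) :* w := v)
          refl σ (g σ) (g₁ σ))))
        (split-below σs 0<c between)
    , lift σs between (split-simpleRoots σs 0<c between)
    where
    g  = ⟦ split c σs ⟧
    g₁ = ⟦ derivative (split c σs) ⟧
    lift : ∀ {τ} τs → Between σ τs τ → SimpleRoots g g₁ τs →
      SimpleRoots ⟦ split c (σ ∷ σs) ⟧ ⟦ derivative (split c (σ ∷ σs)) ⟧ τs
    lift []       _              _                     = tt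
    lift (τ ∷ τs) (σ<τ , between) (gτ≡0 , 0<g₁τ , rest) =
        trans (⟦⟧-split-∷ c σ σs τ) (trans (cong ((τ - σ) *_) gτ≡0) (*-zeroʳ (τ - σ)))
      , subst (0ℚ <_)
          (trans (sym (signed-* (length τs) (τ - σ) (g₁ τ))) (cong (signed (length τs))
            (sym (trans (⟦⟧-split-∷′ c σ σs τ)
              (trans (cong (_+ (τ - σ) * g₁ τ) gτ≡0) (+-identityˡ ((τ - σ) * g₁ τ)))))))
          (*-pos (difference σ<τ) 0<g₁τ)
      , lift τs (Between-weaken τs (<⇒≤ σ<τ) between) rest

  -- At a zero of `f` the new polynomial is a negative multiple of `f₁`, whose signs alternate from
  -- zero to zero. The point 0 is appended at the right end with a positive value.
  step-alternating : ∀ {f f₁ g m : ℚ → ℚ} {lo} σs →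
    (∀ x → f x ≡ 0ℚ → g x ≡ - m x * f₁ x) → (∀ {x} → -1ℚ < x → x < 0ℚ → 0ℚ < m x) →
    -1ℚ ≤ lo → Between lo σs 0ℚ → SimpleRoots f f₁ σs → 0ℚ < g 0ℚ → Alternating g (σs ++ 0ℚ ∷ [])
  step-alternating [] _ _ _ _ _ 0<g0 = 0<g0 , tt
  step-alternating {f₁ = f₁} {g} {m} (σ ∷ σs) g≡ m-pos -1≤lo (lo<σ , between) (fσ≡0 , 0<f₁σ , roots)
      0<g0 =
      subst (0ℚ <_) (sym value) (*-pos (m-pos (≤-<-trans -1≤lo lo<σ) (Between⇒< σs between)) 0<f₁σ)
    , step-alternating σs g≡ m-pos (<⇒≤ (≤-<-trans -1≤lo lo<σ)) between roots 0<g0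
    where
    n = length σs
    value : signed (length (σs ++ 0ℚ ∷ [])) (g σ) ≡ m σ * signed n (f₁ σ)
    -- Appending 0 raises the exponent of the sign by one, which cancels the minus sign in `g≡`.
    value = trans (cong₂ signed (trans (length-++ σs) (ℕₚ.+-comm n 1)) (g≡ σ fσ≡0))
      (trans (cong -_ (signed-* n (- m σ) (f₁ σ))) (solve 2 (λ m v → :- (:- m :* v) := m :* v)
        refl (m σ) (signed n (f₁ σ))))

  Between⇒Increasing : ∀ {lo hi} σs → Between lo σs hi → Increasing lo (σs ++ hi ∷ []) hi
  Between⇒Increasing []       lo<hi            = lo<hi , ≤-refl
  Between⇒Increasing (σ ∷ σs) (lo<σ , between) = lo<σ , Between⇒Increasing σs between

  -- This step keeps the degree n, so the n zeros together with 0 are the n + 1 points required for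
  -- a complete splitting.
  oddStep-alternating : ∀ {c} σs → 0ℚ < c → Between -1ℚ σs 0ℚ →
      Alternating ⟦ oddStep (split c σs) ⟧ (σs ++ 0ℚ ∷ [])
  oddStep-alternating {c} σs 0<c between =
    step-alternating {f = f} {m = λ x → - x * (# 2 * (1ℚ - x))} σs
      (λ x fx≡0 → trans (⟦⟧-oddStep p x) (trans
        (cong (λ u → u + # 2 * x * (n * u + (# 1 - x) * f₁ x)) fx≡0)
        (solve 3 (λ x n f₁ → :# 0 :+ :# 2 :* x :* (n :* :# 0 :+ (:# 1 :- x) :* f₁)
          := :- (:- x :* (:# 2 :* (:# 1 :- x))) :* f₁) refl x n (f₁ x))))
      (λ -1<x x<0 → *-pos (neg-antimono-< x<0)
        (*-pos (positive⁻¹ (# 2)) (difference (<-trans x<0 0<1))))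
      ≤-refl between (split-simpleRoots σs 0<c between)
      (subst (0ℚ <_) (sym (trans (⟦⟧-oddStep p 0ℚ)
        (solve 3 (λ f n f₁ → f :+ :# 2 :* :# 0 :* (n :* f :+ (:# 1 :- :# 0) :* f₁) := f)
          refl (f 0ℚ) n (f₁ 0ℚ))))
        (split-above σs 0<c between))
    where
    p = split c σs
    n = # (degree p)
    f = ⟦ p ⟧
    f₁ = ⟦ derivative p ⟧

  -- This step raises the degree, so one further point is required. It is -1, where the terms with
  -- the factor 1 + x vanish and -2 f(-1) remains, with the sign opposite to that of f(-1).
  evenStep-alternating : ∀ {c} σs → 0ℚ < c → Between -1ℚ σs 0ℚ →
      Alternating ⟦ evenStep (split c σs) ⟧ (-1ℚ ∷ (σs ++ 0ℚ ∷ []))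
  evenStep-alternating {c} σs 0<c between =
      subst (0ℚ <_) (sym value) (*-pos (positive⁻¹ (# 2)) (split-below σs 0<c between))
    , step-alternating {f = f} {m = λ x → - x * (# 2 * (1ℚ + x) * (1ℚ - x))} σs
        (λ x fx≡0 → trans (⟦⟧-evenStep p x) (trans
          (cong (λ u → (# 1 + # 3 * x) * u + # 2 * x * (# 1 + x) * (n * u + (# 1 - x) * f₁ x)) fx≡0)
          (solve 3 (λ x n f₁ → (:# 1 :+ :# 3 :* x) :* :# 0
              :+ :# 2 :* x :* (:# 1 :+ x) :* (n :* :# 0 :+ (:# 1 :- x) :* f₁)
            := :- (:- x :* (:# 2 :* (:# 1 :+ x) :* (:# 1 :- x))) :* f₁) refl x n (f₁ x))))
        (λ {x} -1<x x<0 → *-pos (neg-antimono-< x<0) (*-pos (*-pos (positive⁻¹ (# 2))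
          (subst (0ℚ <_) (solve 1 (λ x → x :- :- :# 1 := :# 1 :+ x) refl x) (difference -1<x)))
          (difference (<-trans x<0 0<1))))
        ≤-refl between (split-simpleRoots σs 0<c between)
        (subst (0ℚ <_) (sym (trans (⟦⟧-evenStep p 0ℚ)
          (solve 3 (λ f n f₁ → (:# 1 :+ :# 3 :* :# 0) :* f
            :+ :# 2 :* :# 0 :* (:# 1 :+ :# 0) :* (n :* f :+ (:# 1 :- :# 0) :* f₁) := f)
                refl (f 0ℚ) n (f₁ 0ℚ))))
          (split-above σs 0<c between))
    where
    p = split c σs
    n = # (degree p)
    f = ⟦ p ⟧
    f₁ = ⟦ derivative p ⟧
    value : signed (length (σs ++ 0ℚ ∷ [])) (⟦ evenStep p ⟧ -1ℚ) ≡ # 2 * signed (length σs) (f -1ℚ)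
    value = trans (cong₂ signed (trans (length-++ σs) (ℕₚ.+-comm (length σs) 1))
        (trans (⟦⟧-evenStep p -1ℚ) (solve 3 (λ f n f₁ → let x = :- :# 1 in
          (:# 1 :+ :# 3 :* x) :* f :+ :# 2 :* x :* (:# 1 :+ x) :* (n :* f :+ (:# 1 :- x) :* f₁)
          := :- :# 2 :* f) refl (f -1ℚ) n (f₁ -1ℚ))))
      (trans (cong -_ (signed-* (length σs) (- # 2) (f -1ℚ)))
        (solve 1 (λ v → :- (:- :# 2 :* v) := :# 2 :* v) refl (signed (length σs) (f -1ℚ))))

  -- Limits of split polynomials

  LimitOfSplits : Poly → Set
  LimitOfSplits p = ∀ ε → 0ℚ < ε → SplitApproximation p -1ℚ 0ℚ ε

  Close-length : ∀ {ε c} {p : Poly} σs → Close ε p (split c σs) → length p ≡ suc (length σs)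
  Close-length {c = c} σs close = trans (Pointwise.Pointwise-length close) (length-split c σs)

  -- The image of a split polynomial under `F` need not have rational zeros, so it is approximated
  -- by a split polynomial once more; each of the two approximations may use half of the tolerance.
  limit-transfer : ∀ {F : Poly → Poly} {p} → ContinuousAt F p →
    (∀ {c σs ε} → 0ℚ < c → Between -1ℚ σs 0ℚ → length p ≡ suc (length σs) → 0ℚ < ε →
      SplitApproximation (F (split c σs)) -1ℚ 0ℚ ε) →
    LimitOfSplits p → LimitOfSplits (F p)
  limit-transfer {F} {p} cont approx limit ε 0<ε =
    let δ , 0<δ , closeF = cont (half-pos 0<ε)
        c , σs , 0<c , between , close = limit δ 0<δ
        d , τs , 0<d , between′ , close′ = approx 0<c between (Close-length σs close) (half-pos 0<ε)
    in d , τs , 0<d , between′ ,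
       subst (λ e → Close e (F p) (split d τs)) (half+half ε)
           (Close-trans (closeF (split c σs) close) close′)

  oddStep-limit : ∀ {n} p → length p ≡ suc (suc n) → LimitOfSplits p → LimitOfSplits (oddStep p)
  oddStep-limit p len = limit-transfer {F = oddStep} (oddStep-continuous p) approx
    where
    approx : ∀ {c σs ε} → 0ℚ < c → Between -1ℚ σs 0ℚ → length p ≡ suc (length σs) → 0ℚ < ε →
      SplitApproximation (oddStep (split c σs)) -1ℚ 0ℚ ε
    -- The length rules out a split without zeros; in the other clause the least zero serves as the
    -- first point of alternation.
    approx {σs = []} _ _ len′ _ with () ← trans (sym len) len′
    approx {c} {σ ∷ σs} {ε} 0<c between@(-1<σ , between′) _ 0<ε =
      approximate-split (oddStep (split c (σ ∷ σs))) (σs ++ 0ℚ ∷ [])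
        (trans (length-oddStep (split c (σ ∷ σs)) (length-split c (σ ∷ σs)))
          (cong suc (trans (ℕₚ.+-comm 1 (length σs)) (sym (length-++ σs)))))
        (<⇒≤ -1<σ) (Between⇒Increasing σs between′) (<⇒≤ -1<σ) (Between⇒< (σ ∷ σs) between)
        (oddStep-alternating (σ ∷ σs) 0<c between) ε 0<ε

  evenStep-limit : ∀ p → LimitOfSplits p → LimitOfSplits (evenStep p)
  evenStep-limit p = limit-transfer {F = evenStep} (evenStep-continuous p) approx
    where
    approx : ∀ {c σs ε} → 0ℚ < c → Between -1ℚ σs 0ℚ → length p ≡ suc (length σs) → 0ℚ < ε →
      SplitApproximation (evenStep (split c σs)) -1ℚ 0ℚ ε
    approx {c} {σs} {ε} 0<c between _ 0<ε =
      approximate-split (evenStep (split c σs)) (σs ++ 0ℚ ∷ [])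
        (trans (length-evenStep (split c σs) (length-split c σs))
          (cong suc (trans (ℕₚ.+-comm 1 (length σs)) (sym (length-++ σs)))))
        ≤-refl (Between⇒Increasing σs between) ≤-refl (Between⇒< σs between)
        (evenStep-alternating σs 0<c between) ε 0<ε

  oddReduced-limit : ∀ k → LimitOfSplits (oddReduced k)
  evenReduced-limit : ∀ k → LimitOfSplits (evenReduced k)
  oddReduced-limit zero ε 0<ε = 1ℚ , [] , 0<1 , neg-antimono-< 0<1 , 0<ε ∷ []
  oddReduced-limit (suc k) =
      oddStep-limit (evenReduced k) (length-evenReduced k) (evenReduced-limit k)
  evenReduced-limit k = evenStep-limit (oddReduced k) (oddReduced-limit k)

-- Gaussian rationals

ℚ[i] : ℚ-Algebra
ℚ[i] = record
  { Carrier = ℚ × ℚ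
  ; _+_ = λ (a , b) (c , d) → a + c , b + d
  ; _*_ = λ (a , b) (c , d) → a * c + - (b * d) , a * d + b * c
  ; -_  = λ (a , b) → - a , - b
  ; ι   = λ q → q , 0ℚ
  ; isCommutativeRing = record
    { isRing = record
      { +-isAbelianGroup = record
        { isGroup = record
          { isMonoid = record
            { isSemigroup = record
              { isMagma = record { isEquivalence = isEquivalence ; ∙-cong = cong₂ _ }
              ; assoc = λ (a , b) (c , d) (e , f) → cong₂ _,_ (+-assoc a c e) (+-assoc b d f)
              }
            ; identity = (λ (a , b) → cong₂ _,_ (+-identityˡ a) (+-identityˡ b))
                       , (λ (a , b) → cong₂ _,_ (+-identityʳ a) (+-identityʳ b))
            }
          ; inverse = (λ (a , b) → cong₂ _,_ (+-inverseˡ a) (+-inverseˡ b))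
                    , (λ (a , b) → cong₂ _,_ (+-inverseʳ a) (+-inverseʳ b))
          ; ⁻¹-cong = cong (λ (a , b) → - a , - b)
          }
        ; comm = λ (a , b) (c , d) → cong₂ _,_ (+-comm a c) (+-comm b d)
        }
      ; *-cong = cong₂ _
      ; *-assoc = λ (a , b) (c , d) (e , f) → cong₂ _,_
          (solve 6 (λ a b c d e f → (a :* c :+ :- (b :* d)) :* e :+ :- ((a :* d :+ b :* c) :* f)
                                  := a :* (c :* e :+ :- (d :* f)) :+ :- (b :* (c :* f :+ d :* e)))
                                      refl a b c d e f)
          (solve 6 (λ a b c d e f → (a :* c :+ :- (b :* d)) :* f :+ (a :* d :+ b :* c) :* e
                                  := a :* (c :* f :+ d :* e) :+ b :* (c :* e :+ :- (d :* f)))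
                                      refl a b c d e f)
      ; *-identity =
            (λ (a , b) → cong₂ _,_
              (solve 2 (λ a b → :# 1 :* a :+ :- (:# 0 :* b) := a) refl a b)
              (solve 2 (λ a b → :# 1 :* b :+ :# 0 :* a := b) refl a b))
          , (λ (a , b) → cong₂ _,_
              (solve 2 (λ a b → a :* :# 1 :+ :- (b :* :# 0) := a) refl a b)
              (solve 2 (λ a b → a :* :# 0 :+ b :* :# 1 := b) refl a b))
      ; distrib =
            (λ (a , b) (c , d) (e , f) → cong₂ _,_
              (solve 6 (λ a b c d e f → a :* (c :+ e) :+ :- (b :* (d :+ f))
                                      := a :* c :+ :- (b :* d) :+ (a :* e :+ :- (b :* f)))
                                          refl a b c d e f)
              (solve 6 (λ a b c d e f → a :* (d :+ f) :+ b :* (c :+ e)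
                                      := a :* d :+ b :* c :+ (a :* f :+ b :* e)) refl a b c d e f))
          , (λ (a , b) (c , d) (e , f) → cong₂ _,_
              (solve 6 (λ a b c d e f → (c :+ e) :* a :+ :- ((d :+ f) :* b)
                                      := c :* a :+ :- (d :* b) :+ (e :* a :+ :- (f :* b)))
                                          refl a b c d e f)
              (solve 6 (λ a b c d e f → (c :+ e) :* b :+ (d :+ f) :* a
                                      := c :* b :+ d :* a :+ (e :* b :+ f :* a)) refl a b c d e f))
      }
    ; *-comm = λ (a , b) (c , d) → cong₂ _,_
        (solve 4 (λ a b c d → a :* c :+ :- (b :* d) := c :* a :+ :- (d :* b)) refl a b c d)
        (solve 4 (λ a b c d → a :* d :+ b :* c := c :* b :+ d :* a) refl a b c d)
    }
  ; ι-+ = λ _ _ → refl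
  ; ι-* = λ p q → cong₂ _,_
      (solve 2 (λ p q → p :* q := p :* q :+ :- (:# 0 :* :# 0)) refl p q)
      (solve 2 (λ p q → :# 0 := p :* :# 0 :+ :# 0 :* q) refl p q)
  ; ι-neg = λ _ → refl
  }

private module 𝔾 = ℚ-Algebra ℚ[i]
open 𝔾 using () renaming (_+_ to _+ᵍ_; _*_ to _*ᵍ_; -_ to -ᵍ_; # to #ᵍ; ι to ιᵍ)

ℚi : Set
ℚi = ℚ × ℚ

re im : ℚi → ℚ
re = proj₁
im = proj₂

conj : ℚi → ℚi
conj (a , b) = a , - b

normSq : ℚi → ℚ
normSq (a , b) = a * a + b * b

normSq-* : ∀ z w → normSq (z *ᵍ w) ≡ normSq z * normSq w
normSq-* (a , b) (c , d) = solve 4 (λ a b c d →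
  let u = a :* c :+ :- (b :* d) ; v = a :* d :+ b :* c
  in u :* u :+ v :* v := (a :* a :+ b :* b) :* (c :* c :+ d :* d)) refl a b c d

normSq-conj : ∀ z → normSq (conj z) ≡ normSq z
normSq-conj (a , b) = solve 2 (λ a b → a :* a :+ :- b :* :- b := a :* a :+ b :* b) refl a b

*-conj : ∀ z → z *ᵍ conj z ≡ ιᵍ (normSq z)
*-conj (a , b) = cong₂ _,_
  (solve 2 (λ a b → a :* a :+ :- (b :* :- b) := a :* a :+ b :* b) refl a b)
  (solve 2 (λ a b → a :* :- b :+ b :* a := :# 0) refl a b)

conj-* : ∀ z w → conj (z *ᵍ w) ≡ conj z *ᵍ conj w
conj-* (a , b) (c , d) = cong₂ _,_
  (solve 4 (λ a b c d → a :* c :+ :- (b :* d) := a :* c :+ :- (:- b :* :- d)) refl a b c d)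
  (solve 4 (λ a b c d → :- (a :* d :+ b :* c) := a :* :- d :+ :- b :* c) refl a b c d)

re-scale : ∀ r z → re (ιᵍ r *ᵍ z) ≡ r * re z
re-scale r (a , b) = solve 3 (λ r a b → r :* a :+ :- (:# 0 :* b) := r :* a) refl r a b

normSq-nonNeg : ∀ z → 0ℚ ≤ normSq z
normSq-nonNeg (a , b) = +-nonNeg (square-nonNeg a) (square-nonNeg b)

re²≤normSq : ∀ z → re z * re z ≤ normSq z
re²≤normSq (a , b) = ≤-by (b * b) (solve 2 (λ a b → a :* a :+ b :* b :- a :* a := b :* b) refl a b)
    (square-nonNeg b)

private
  infixl 6 _⊞_
  infixl 7 _⊠_
  _⊞_ : ∀ {a b} → 0ℚ ≤ a → 0ℚ ≤ b → 0ℚ ≤ a + b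
  _⊞_ = +-nonNeg
  _⊠_ : ∀ {a b} → 0ℚ ≤ a → 0ℚ ≤ b → 0ℚ ≤ a * b
  _⊠_ = *-nonNeg

-- The operations of ℚ[i] on pairs of solver expressions.
infixl 6 _+ᵉ_
infixl 7 _*ᵉ_
infix  8 -ᵉ_
_+ᵉ_ _*ᵉ_ : ∀ {m} → Expression m × Expression m → Expression m × Expression m →
    Expression m × Expression m
(a , b) +ᵉ (c , d) = a :+ c , b :+ d
(a , b) *ᵉ (c , d) = a :* c :+ :- (b :* d) , a :* d :+ b :* c
-ᵉ_ conjᵉ : ∀ {m} → Expression m × Expression m → Expression m × Expression m
-ᵉ (a , b) = :- a , :- b
conjᵉ (a , b) = a , :- b

-- Rotation of the curvature into the right half-plane

open Curvature ℚ[i] using (rootCurvature; splitCurvature; splitCurvature-∷)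

-- The product of x / (1 + x) and `h r` for r = -σ, cleared of denominators: it has been multiplied
-- by |1 + x|² |x + r|⁴.
rotatedRootCurvature : ℚi → ℚ → ℚi
rotatedRootCurvature x σ = x *ᵍ conj (#ᵍ 1 +ᵍ x) *ᵍ rootCurvature
    (ιᵍ σ) x *ᵍ (conj (x +ᵍ -ᵍ ιᵍ σ) *ᵍ conj (x +ᵍ -ᵍ ιᵍ σ))

-- With r = −σ, p = (Im x)² and t = 1 − r, the real part is a polynomial in Re x with
-- nonnegative coefficients.
rotatedRootCurvature-nonNeg : ∀ {x σ} → 0ℚ ≤ re x → -1ℚ ≤ σ → σ ≤ 0ℚ →
    0ℚ ≤ re (rotatedRootCurvature x σ)
rotatedRootCurvature-nonNeg {a , b} {σ} 0≤a -1≤σ σ≤0 = subst (0ℚ ≤_) (sym expand)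
  ((0≤1 ⊞ r₀) ⊠
    -- Only the coefficient of degree zero in `a` hides a square, that of `p - r`; the others are
    -- sums of products of `p`, `r`, `t` and positive integers.
    ( p₀ ⊠ (t₀ ⊠ square-nonNeg (p - r) ⊞ r₀ ⊠ r₀ ⊠ (0≤1 ⊞ r₀) ⊠ (p₀ ⊞ 0≤1))
    ⊞ 0≤a ⊠ (r₀ ⊠ r₀ ⊠ r₀ ⊞ p₀ ⊠ r₀ ⊠ (0≤1 ⊞ r₀ ⊞ 0≤ 4 ⊠ r₀ ⊠ r₀) ⊞ p₀ ⊠ p₀ ⊠
        (0≤1 ⊞ 0≤ 2 ⊠ r₀ ⊠ t₀))
    ⊞ 0≤a ⊠ 0≤a ⊠ (0≤ 2 ⊠ r₀ ⊠ r₀ ⊠ (0≤1 ⊞ r₀) ⊞ p₀ ⊠ (0≤ 2 ⊠ r₀ ⊞ 0≤ 4 ⊠ r₀ ⊠ r₀) ⊞ 0≤ 3 ⊠ p₀ ⊠ p₀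
        ⊠ t₀)
    ⊞ 0≤a ⊠ 0≤a ⊠ 0≤a ⊠ (r₀ ⊠ (0≤1 ⊞ 0≤ 5 ⊠ r₀) ⊞ p₀ ⊠ (0≤ 2 ⊞ 0≤ 4 ⊠ r₀ ⊠ t₀))
    ⊞ 0≤a ⊠ 0≤a ⊠ 0≤a ⊠ 0≤a ⊠ (0≤ 4 ⊠ r₀ ⊞ r₀ ⊠ r₀ ⊠ t₀ ⊞ 0≤ 3 ⊠ p₀ ⊠ t₀)
    ⊞ 0≤a ⊠ 0≤a ⊠ 0≤a ⊠ 0≤a ⊠ 0≤a ⊠ (0≤1 ⊞ 0≤ 2 ⊠ r₀ ⊠ t₀)
    ⊞ 0≤a ⊠ 0≤a ⊠ 0≤a ⊠ 0≤a ⊠ 0≤a ⊠ 0≤a ⊠ t₀))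
  where
  r = - σ
  p = b * b
  t = 1ℚ - r
  0≤ : ∀ n → 0ℚ ≤ # n
  0≤ n = nonNegative⁻¹ (# n) {{normalize-nonNeg n 1}}
  0≤1 : 0ℚ ≤ 1ℚ
  0≤1 = 0≤ 1
  r₀ : 0ℚ ≤ r
  r₀ = neg-antimono-≤ σ≤0
  p₀ : 0ℚ ≤ p
  p₀ = square-nonNeg b
  t₀ : 0ℚ ≤ t
  t₀ = difference-≤ (neg-antimono-≤ -1≤σ)
  expand : re (rotatedRootCurvature (a , b) σ) ≡
    (1ℚ + r) *
      ( p * (t * ((p - r) * (p - r)) + r * r * (1ℚ + r) * (p + 1ℚ))
      + a * (r * r * r + p * r * (1ℚ + r + # 4 * r * r) + p * p * (1ℚ + # 2 * r * t))
      + a * a * (# 2 * r * r * (1ℚ + r) + p * (# 2 * r + # 4 * r * r) + # 3 * p * p * t)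
      + a * a * a * (r * (1ℚ + # 5 * r) + p * (# 2 + # 4 * r * t))
      + a * a * a * a * (# 4 * r + r * r * t + # 3 * p * t)
      + a * a * a * a * a * (1ℚ + # 2 * r * t)
      + a * a * a * a * a * a * t)
  expand = solve 3 (λ a b s →
    let x = a , b
        s′ = s , :# 0
        1′ = :# 1 , :# 0
        q = (1′ +ᵉ -ᵉ s′) *ᵉ ((((1′ +ᵉ s′) *ᵉ (x *ᵉ x)) +ᵉ -ᵉ (s′ *ᵉ x)) +ᵉ -ᵉ s′)
        w = conjᵉ (x +ᵉ -ᵉ s′)
        r = :- s
        p = b :* b
        t = :# 1 :- r
    in proj₁ (((x *ᵉ conjᵉ (1′ +ᵉ x)) *ᵉ q) *ᵉ (w *ᵉ w)) :=
    (:# 1 :+ r) :*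
      ( p :* (t :* ((p :- r) :* (p :- r)) :+ r :* r :* (:# 1 :+ r) :* (p :+ :# 1))
      :+ a :* (r :* r :* r :+ p :* r :* (:# 1 :+ r :+ :# 4 :* r :* r) :+ p :* p :*
          (:# 1 :+ :# 2 :* r :* t))
      :+ a :* a :* (:# 2 :* r :* r :* (:# 1 :+ r) :+ p :* (:# 2 :* r :+ :# 4 :* r :* r) :+ :# 3 :* p
          :* p :* t)
      :+ a :* a :* a :* (r :* (:# 1 :+ :# 5 :* r) :+ p :* (:# 2 :+ :# 4 :* r :* t))
      :+ a :* a :* a :* a :* (:# 4 :* r :+ r :* r :* t :+ :# 3 :* p :* t)
      :+ a :* a :* a :* a :* a :* (:# 1 :+ :# 2 :* r :* t)
      :+ a :* a :* a :* a :* a :* a :* t)) refl a b σ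

open Curvature ℚ[i] using (evenTuránAt; oddTuránAt; evenTurán-split; oddTurán-split)
open EvaluationAt.ℚ⇒ ℚ[i]
module Real = EvaluationAt.ℚ⇒ ℚ-algebra

open RingIdentities ℚ[i]

re-scale² : ∀ z y → re (z *ᵍ conj z *ᵍ (z *ᵍ conj z) *ᵍ y) ≡ normSq z * normSq z * re y
re-scale² z y = begin
  re (z *ᵍ conj z *ᵍ (z *ᵍ conj z) *ᵍ y)          ≡⟨ cong (λ u → re (u *ᵍ u *ᵍ y)) (*-conj z) ⟩
  re (ιᵍ (normSq z) *ᵍ ιᵍ (normSq z) *ᵍ y)
      ≡⟨ cong (λ u → re (u *ᵍ y)) (𝔾.ι-* (normSq z) (normSq z)) ⟨
  re (ιᵍ (normSq z * normSq z) *ᵍ y)               ≡⟨ re-scale (normSq z * normSq z) y ⟩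
  normSq z * normSq z * re y                       ∎
  where open ≡-Reasoning

-- x · conj (1 + x) rotates every summand of the curvature into the right half-plane.
rotatedCurvature : ℚ → List ℚ → ℚi → ℚi
rotatedCurvature c σs x = let f̄ = conj (⟦ split c σs ⟧ x) in
  x *ᵍ conj (#ᵍ 1 +ᵍ x) *ᵍ splitCurvature c σs x *ᵍ (f̄ *ᵍ f̄)

-- Induction on the zeros: by `combine`, a new zero multiplies the previous value by |w|⁴ and adds
-- |f|⁴ times its own rotated summand. A constant has curvature zero.
rotatedCurvature-nonNeg : ∀ {c lo x} σs → 0ℚ ≤ re x → -1ℚ ≤ lo → Between lo σs 0ℚ →
    0ℚ ≤ re (rotatedCurvature c σs x)
rotatedCurvature-nonNeg {c} {x = x} [] _ _ _ = ≤-reflexive (sym (begin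
  re (y *ᵍ splitCurvature c [] x *ᵍ (f̄ *ᵍ f̄))
    ≡⟨ cong (λ u → re (y *ᵍ u *ᵍ (f̄ *ᵍ f̄))) (vanishing x (ιᵍ c)) ⟩
  re (y *ᵍ #ᵍ 0 *ᵍ (f̄ *ᵍ f̄))
    ≡⟨ cong re (𝔾.solve 2 (λ y f → y 𝔾.:* 𝔾.:# 0 𝔾.:* (f 𝔾.:* f) 𝔾.:= 𝔾.:# 0) refl y f̄) ⟩
  0ℚ ∎))
  where
  open ≡-Reasoning
  f̄ = conj (⟦ c ∷ [] ⟧ x)
  y = x *ᵍ conj (#ᵍ 1 +ᵍ x)
  vanishing : ∀ x c → Curvature.curvature ℚ[i] (#ᵍ 0) x (c +ᵍ x *ᵍ #ᵍ 0) (#ᵍ 0) (#ᵍ 0) ≡ #ᵍ 0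
  vanishing = 𝔾.solve 2 (λ x c →
    let 0′ = 𝔾.:# 0 ; 1′ = 𝔾.:# 1 ; f = c 𝔾.:+ x 𝔾.:* 0′
    in 0′ 𝔾.:* (1′ 𝔾.:+ x 𝔾.:+ 𝔾.:- (x 𝔾.:* x)) 𝔾.:* (f 𝔾.:* f)
       𝔾.:+ (1′ 𝔾.:+ 𝔾.:- x) 𝔾.:* (1′ 𝔾.:+ 𝔾.:- (𝔾.:# 2 𝔾.:* (x 𝔾.:* x))) 𝔾.:* (f 𝔾.:* 0′)
       𝔾.:+ 𝔾.:- (x 𝔾.:* ((1′ 𝔾.:+ 𝔾.:- x) 𝔾.:* (1′ 𝔾.:+ 𝔾.:- x)) 𝔾.:* (1′ 𝔾.:+ x) 𝔾.:*
           (0′ 𝔾.:* 0′ 𝔾.:+ 𝔾.:- (f 𝔾.:* 0′)))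
       𝔾.:= 0′) refl
rotatedCurvature-nonNeg {c} {lo} {x} (σ ∷ σs) 0≤a -1≤lo (lo<σ , between) =
    subst (0ℚ ≤_) (sym expand)
  (+-nonNeg
    (*-nonNeg (square-nonNeg (normSq w)) (rotatedCurvature-nonNeg {c} σs 0≤a -1≤σ between))
    (*-nonNeg (square-nonNeg (normSq f))
      (rotatedRootCurvature-nonNeg {x} 0≤a -1≤σ (<⇒≤ (Between⇒< σs between)))))
  where
  open ≡-Reasoning
  -1≤σ = ≤-trans -1≤lo (<⇒≤ lo<σ)
  y = x *ᵍ conj (#ᵍ 1 +ᵍ x)
  w = x +ᵍ -ᵍ ιᵍ σ
  f = ⟦ split c σs ⟧ x
  z = splitCurvature c σs x
  q = rootCurvature (ιᵍ σ) x
  expand : re (rotatedCurvature c (σ ∷ σs) x) ≡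
    normSq w * normSq w * re (rotatedCurvature c σs x) + normSq f * normSq f
        * re (rotatedRootCurvature x σ)
  expand = begin
    re (rotatedCurvature c (σ ∷ σs) x)
      ≡⟨ cong₂ (λ u v → re (y *ᵍ u *ᵍ (v *ᵍ v))) (splitCurvature-∷ c σ σs x)
           (trans (cong conj (LinearFactors.⟦⟧-split-∷ ℚ[i] c σ σs x)) (conj-* w f)) ⟩
    re (y *ᵍ (w *ᵍ w *ᵍ z +ᵍ q *ᵍ (f *ᵍ f)) *ᵍ ((conj w *ᵍ conj f) *ᵍ (conj w *ᵍ conj f)))
      ≡⟨ cong re (combine y z q w (conj w) f (conj f)) ⟩
    re (w *ᵍ conj w *ᵍ (w *ᵍ conj w) *ᵍ rotatedCurvature c σs x)
        + re (f *ᵍ conj f *ᵍ (f *ᵍ conj f) *ᵍ rotatedRootCurvature x σ)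
      ≡⟨ cong₂ _+_ (re-scale² w (rotatedCurvature c σs x))
        (re-scale² f (rotatedRootCurvature x σ)) ⟩
    normSq w * normSq w * re (rotatedCurvature c σs x) + normSq f * normSq f
        * re (rotatedRootCurvature x σ) ∎

-- Lower bounds for split polynomials

normSq-bound : ∀ {c} y v f → 0ℚ ≤ c → 0ℚ < normSq f → c * (normSq f * normSq f)
    ≤ re (y *ᵍ v *ᵍ (conj f *ᵍ conj f)) →
  c * c * (normSq f * normSq f) ≤ normSq y * normSq v
-- A real part is at most the modulus. After squaring, the modulus contributes the norms of `y` and
-- `v` times N², and the common factor N² cancels.
normSq-bound {c} y v f 0≤c 0<N cN²≤re = *-cancel-≤ (square-pos 0<N) (begin
  N * N * (c * c * (N * N))
      ≡⟨ solve 2 (λ c n → n :* n :* (c :* c :* (n :* n)) := c :* (n :* n) :* (c :* (n :* n)))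
        refl c N ⟩
  c * (N * N) * (c * (N * N))     ≤⟨ *-mono-≤ (≤-trans 0≤cN² cN²≤re) 0≤cN² cN²≤re cN²≤re ⟩
  re z * re z                     ≤⟨ re²≤normSq z ⟩
  normSq z
      ≡⟨ trans (normSq-* (y *ᵍ v) (conj f *ᵍ conj f)) (cong₂ _*_ (normSq-* y v)
                                       (trans (normSq-* (conj f) (conj f))
                                         (cong₂ _*_ (normSq-conj f) (normSq-conj f)))) ⟩
  normSq y * normSq v * (N * N)   ≡⟨ *-comm (normSq y * normSq v) (N * N) ⟩
  N * N * (normSq y * normSq v)   ∎)
  where
  open ≤-Reasoning
  N = normSq f
  z = y *ᵍ v *ᵍ (conj f *ᵍ conj f)
  0≤cN² = *-nonNeg 0≤c (square-nonNeg N)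

1≤normSq-1+ : ∀ x → 0ℚ ≤ re x → 1ℚ ≤ normSq (#ᵍ 1 +ᵍ x)
1≤normSq-1+ (a , b) 0≤a = ≤-by (# 2 * a + (a * a + b * b))
  (solve 2 (λ a b → (:# 1 :+ a) :* (:# 1 :+ a) :+ (:# 0 :+ b) :* (:# 0 :+ b) :- :# 1
    := :# 2 :* a :+ (a :* a :+ b :* b)) refl a b)
  (+-nonNeg (*-nonNeg (nonNegative⁻¹ (# 2)) 0≤a) (normSq-nonNeg (a , b)))

-- All zeros are negative, so no point with nonnegative real part is closer to any of them than 0
-- is.
split-normSq : ∀ {c lo x} σs → 0ℚ ≤ re x → Between lo σs 0ℚ →
  Real.⟦ split c σs ⟧ 0ℚ * Real.⟦ split c σs ⟧ 0ℚ ≤ normSq (⟦ split c σs ⟧ x)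
split-normSq {c} {x = a , b} [] _ _ = ≤-reflexive (solve 3 (λ c a b →
  (c :+ :# 0 :* :# 0) :* (c :+ :# 0 :* :# 0) :=
  (c :+ (a :* :# 0 :+ :- (b :* :# 0))) :* (c :+ (a :* :# 0 :+ :- (b :* :# 0)))
  :+ (:# 0 :+ (a :* :# 0 :+ b :* :# 0)) :* (:# 0 :+ (a :* :# 0 :+ b :* :# 0))) refl c a b)
split-normSq {c} {x = x@(a , b)} (σ ∷ σs) 0≤a (_ , between) = begin
  Real.⟦ split c (σ ∷ σs) ⟧ 0ℚ * Real.⟦ split c (σ ∷ σs) ⟧ 0ℚ
    ≡⟨ cong (λ u → u * u) (LinearFactors.⟦⟧-split-∷ ℚ-algebra c σ σs 0ℚ) ⟩
  (0ℚ - σ) * g * ((0ℚ - σ) * g)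
    ≡⟨ solve 2 (λ s g → (:# 0 :- s) :* g :* ((:# 0 :- s) :* g) := s :* s :* (g :* g)) refl σ g ⟩
  σ * σ * (g * g)
    ≤⟨ *-mono-≤ (normSq-nonNeg w) (square-nonNeg g) σ²≤normSq
      (split-normSq {x = x} σs 0≤a between) ⟩
  normSq w * normSq (⟦ split c σs ⟧ x)
    ≡⟨ normSq-* w (⟦ split c σs ⟧ x) ⟨
  normSq (w *ᵍ ⟦ split c σs ⟧ x)
    ≡⟨ cong normSq (LinearFactors.⟦⟧-split-∷ ℚ[i] c σ σs x) ⟨
  normSq (⟦ split c (σ ∷ σs) ⟧ x) ∎
  where
  open ≤-Reasoning
  g = Real.⟦ split c σs ⟧ 0ℚ
  w = x +ᵍ -ᵍ ιᵍ σ
  0≤-σ = neg-antimono-≤ (<⇒≤ (Between⇒< σs between))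
  σ²≤normSq : σ * σ ≤ normSq w
  σ²≤normSq = ≤-by (a * (a + # 2 * - σ) + b * b)
    (solve 3 (λ a b s → (a :- s) :* (a :- s) :+ (b :- :# 0) :* (b :- :# 0) :- s :* s
      := a :* (a :+ :# 2 :* :- s) :+ b :* b) refl a b σ)
    (+-nonNeg (*-nonNeg 0≤a (+-nonNeg 0≤a (*-nonNeg (nonNegative⁻¹ (# 2)) 0≤-σ))) (square-nonNeg b))

module _ {c : ℚ} (σs : List ℚ) {x : ℚi} (0<a : 0ℚ < re x) (between : Between -1ℚ σs 0ℚ) where
  private
    a = re x
    f = ⟦ split c σs ⟧ x
    N = normSq f
    X = #ᵍ 1 +ᵍ x
    y = x *ᵍ conj X
    z = splitCurvature c σs x
    0≤a = <⇒≤ 0<a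
    -- The real part of `y`, that is, of x times the conjugate of 1 + x.
    s = a + normSq x
    s-nonNeg : 0ℚ ≤ s
    s-nonNeg = +-nonNeg 0≤a (normSq-nonNeg x)
    a≤s : a ≤ s
    a≤s = ≤-by (normSq x) (solve 2 (λ a n → a :+ n :- a := n) refl a (normSq x)) (normSq-nonNeg x)
    rotated = rotatedCurvature-nonNeg {c} {x = x} σs 0≤a ≤-refl between

    re-y : re y ≡ s
    re-y = solve 2 (λ a b → a :* (:# 1 :+ a) :+ :- (b :* :- (:# 0 :+ b)) := a :+ (a :* a :+ b :* b))
        refl (re x) (im x)

    R = normSq x

    conclude : ∀ {M T v} → normSq T ≡ # 4 * R * normSq v → 0ℚ ≤ M → s * s * (N * N)
        ≤ M * R * normSq v →
      # 4 * (a * a * (N * N)) ≤ M * normSq T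
    conclude {M} {T} {v} T≡ 0≤M bound = begin
      # 4 * (a * a * (N * N))   ≤⟨ *-monoˡ-≤ (nonNegative⁻¹ (# 4))
          (*-monoʳ-≤ (square-nonNeg N) (*-mono-≤ s-nonNeg 0≤a a≤s a≤s)) ⟩
      # 4 * (s * s * (N * N))   ≤⟨ *-monoˡ-≤ (nonNegative⁻¹ (# 4)) bound ⟩
      # 4 * (M * R * normSq v)
          ≡⟨ solve 3 (λ m r v → :# 4 :* (m :* r :* v) := m :* (:# 4 :* r :* v))
            refl M R (normSq v) ⟩
      M * (# 4 * R * normSq v)  ≡⟨ cong (M *_) T≡ ⟨
      M * normSq T              ∎
      where open ≤-Reasoning

    normSq--2 : ∀ v → normSq (-ᵍ #ᵍ 2 *ᵍ x *ᵍ v) ≡ # 4 * R * normSq v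
    normSq--2 v = trans (normSq-* (-ᵍ #ᵍ 2 *ᵍ x) v) (cong (_* normSq v) (normSq-* (-ᵍ #ᵍ 2) x))

  -- The Turán value is -2 x v. Multiplied by y and the square of the conjugate of f, the factor v
  -- becomes |f|⁴ y plus twice the rotated curvature, and the real part of this sum is at least s
  -- N².
  evenTurán-bound : 0ℚ < N → # 4 * (a * a * (N * N))
      ≤ normSq X * normSq (evenTuránAt (split c σs) x)
  evenTurán-bound 0<N = conclude {normSq X} {evenTuránAt (split c σs) x} {v}
    (trans (cong normSq (evenTurán-split c σs x)) (normSq--2 v)) (normSq-nonNeg X)
    (≤-trans (normSq-bound y v f s-nonNeg 0<N lower) (≤-reflexive (begin
      normSq y * normSq v
          ≡⟨ cong (_* normSq v) (trans (normSq-* x (conj X)) (cong (R *_) (normSq-conj X))) ⟩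
      R * normSq X * normSq v            ≡⟨ cong (_* normSq v) (*-comm R (normSq X)) ⟩
      normSq X * R * normSq v            ∎)))
    where
    open ≡-Reasoning
    v = f *ᵍ f +ᵍ #ᵍ 2 *ᵍ z
    value : re (y *ᵍ v *ᵍ (conj f *ᵍ conj f)) ≡ N * N * s + # 2 * re (rotatedCurvature c σs x)
    value = begin
      re (y *ᵍ v *ᵍ (conj f *ᵍ conj f))
        ≡⟨ cong re (combine-even y z f (conj f)) ⟩
      re (f *ᵍ conj f *ᵍ (f *ᵍ conj f) *ᵍ y) + re (#ᵍ 2 *ᵍ rotatedCurvature c σs x)
        ≡⟨ cong₂ _+_ (trans (re-scale² f y) (cong (N * N *_) re-y))
          (re-scale (# 2) (rotatedCurvature c σs x)) ⟩
      N * N * s + # 2 * re (rotatedCurvature c σs x) ∎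
    lower : s * (N * N) ≤ re (y *ᵍ v *ᵍ (conj f *ᵍ conj f))
    lower = ≤-by (# 2 * re (rotatedCurvature c σs x))
      (trans (cong (_- s * (N * N)) value)
        (solve 3 (λ n s r → n :* n :* s :+ :# 2 :* r :- s :* (n :* n) := :# 2 :* r)
        refl N s (re (rotatedCurvature c σs x))))
      (*-nonNeg (nonNegative⁻¹ (# 2)) rotated)

  -- The curvature now carries a factor 1 + x, which a second conjugate of 1 + x turns into |1 +
  -- x|². The same factor meets the summand 2 f² that comes from 3 + x = (1 + x) + 2; there x times
  -- the squared conjugate has real part Re x + 2 |x|² + |x|² Re x, which is nonnegative.
  oddTurán-bound : 0ℚ < N → # 4 * (a * a * (N * N)) ≤ normSq X * normSq (oddTuránAt (split c σs) x)
  oddTurán-bound 0<N = conclude {normSq X} {oddTuránAt (split c σs) x} {v}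
    (trans (cong normSq (oddTurán-split c σs x)) (normSq--2 v)) (normSq-nonNeg X) bound
    where
    v = (#ᵍ 3 +ᵍ x) *ᵍ (f *ᵍ f) +ᵍ #ᵍ 2 *ᵍ X *ᵍ z
    y′ = y *ᵍ conj X
    M = normSq X
    0<M : 0ℚ < M
    0<M = <-≤-trans 0<1 (1≤normSq-1+ x 0≤a)
    3+x : #ᵍ 3 +ᵍ x ≡ X +ᵍ #ᵍ 2
    3+x = 𝔾.solve 1 (λ x → 𝔾.:# 3 𝔾.:+ x 𝔾.:= 𝔾.:# 1 𝔾.:+ x 𝔾.:+ 𝔾.:# 2) refl x
    re-y′ : re y′ ≡ a + # 2 * R + R * a
    re-y′ = solve 2 (λ a b →
      proj₁ (((a , b) *ᵉ conjᵉ ((:# 1 , :# 0) +ᵉ (a , b))) *ᵉ conjᵉ ((:# 1 , :# 0) +ᵉ (a , b)))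
      := a :+ :# 2 :* (a :* a :+ b :* b) :+ (a :* a :+ b :* b) :* a) refl (re x) (im x)
    e = # 2 * (N * N * (a + # 2 * R + R * a)) + M * (# 2 * re (rotatedCurvature c σs x))
    value : re (y′ *ᵍ v *ᵍ (conj f *ᵍ conj f)) ≡ M * s * (N * N) + e
    value = begin
      re (y′ *ᵍ v *ᵍ (conj f *ᵍ conj f))
        ≡⟨ cong (λ u → re (y′ *ᵍ (u *ᵍ (f *ᵍ f) +ᵍ #ᵍ 2 *ᵍ X *ᵍ z) *ᵍ (conj f *ᵍ conj f))) 3+x ⟩
      re (y′ *ᵍ ((X +ᵍ #ᵍ 2) *ᵍ (f *ᵍ f) +ᵍ #ᵍ 2 *ᵍ X *ᵍ z) *ᵍ (conj f *ᵍ conj f))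
        ≡⟨ cong re (combine-odd x X (conj X) z f (conj f)) ⟩
      re (f *ᵍ conj f *ᵍ (f *ᵍ conj f) *ᵍ (X *ᵍ conj X *ᵍ y +ᵍ #ᵍ 2 *ᵍ y′))
          + re (X *ᵍ conj X *ᵍ (#ᵍ 2 *ᵍ rotatedCurvature c σs x))
        ≡⟨ cong₂ _+_
             (trans (re-scale² f (X *ᵍ conj X *ᵍ y +ᵍ #ᵍ 2 *ᵍ y′)) (cong (N * N *_) (cong₂ _+_
               (trans (cong (λ u → re (u *ᵍ y)) (*-conj X))
                 (trans (re-scale M y) (cong (M *_) re-y)))
               (trans (re-scale (# 2) y′) (cong (# 2 *_) re-y′)))))
             (trans (cong (λ u → re (u *ᵍ (#ᵍ 2 *ᵍ rotatedCurvature c σs x))) (*-conj X))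
               (trans (re-scale M (#ᵍ 2 *ᵍ rotatedCurvature c σs x))
                 (cong (M *_) (re-scale (# 2) (rotatedCurvature c σs x))))) ⟩
      N * N * (M * s + # 2 * (a + # 2 * R + R * a)) + M * (# 2 * re (rotatedCurvature c σs x))
        ≡⟨ solve 5 (λ n m s t r → n :* n :* (m :* s :+ :# 2 :* t) :+ m :* (:# 2 :* r)
             := m :* s :* (n :* n) :+ (:# 2 :* (n :* n :* t) :+ m :* (:# 2 :* r)))
             refl N M s (a + # 2 * R + R * a) (re (rotatedCurvature c σs x)) ⟩
      M * s * (N * N) + e ∎
      where open ≡-Reasoning
    lower : M * s * (N * N) ≤ re (y′ *ᵍ v *ᵍ (conj f *ᵍ conj f))
    lower = ≤-by e (trans (cong (_- M * s * (N * N)) value) (solve 2 (λ u e → u :+ e :- u := e)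
        refl (M * s * (N * N)) e))
      (+-nonNeg (*-nonNeg (nonNegative⁻¹ (# 2)) (*-nonNeg (square-nonNeg N)
          (+-nonNeg (+-nonNeg 0≤a (*-nonNeg (nonNegative⁻¹ (# 2)) (normSq-nonNeg x)))
            (*-nonNeg (normSq-nonNeg x) 0≤a))))
        (*-nonNeg (<⇒≤ 0<M) (*-nonNeg (nonNegative⁻¹ (# 2)) rotated)))
    open ≤-Reasoning
    unscaled : s * s * (N * N) ≤ R * normSq v
    unscaled = *-cancel-≤ (square-pos 0<M) (begin
      M * M * (s * s * (N * N))
          ≡⟨ solve 3 (λ m s n → m :* m :* (s :* s :* (n :* n)) := m :* s :* (m :* s) :* (n :* n))
            refl M s N ⟩
      M * s * (M * s) * (N * N)
          ≤⟨ normSq-bound y′ v f (*-nonNeg (<⇒≤ 0<M) s-nonNeg) 0<N lower ⟩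
      normSq y′ * normSq v                ≡⟨ cong (_* normSq v) (trans (normSq-* y (conj X))
                                               (cong₂ _*_ (trans (normSq-* x (conj X))
                                                 (cong (R *_) (normSq-conj X))) (normSq-conj X))) ⟩
      R * M * M * normSq v
          ≡⟨ solve 3 (λ r m v → r :* m :* m :* v := m :* m :* (r :* v)) refl R M (normSq v) ⟩
      M * M * (R * normSq v)              ∎)
    bound : s * s * (N * N) ≤ M * R * normSq v
    bound = begin
      s * s * (N * N)         ≤⟨ unscaled ⟩
      R * normSq v            ≡⟨ *-identityˡ (R * normSq v) ⟨
      -- Weakened by the factor M ≥ 1, so that both parities end in the same inequality.
      1ℚ * (R * normSq v)
          ≤⟨ *-monoʳ-≤ (*-nonNeg (normSq-nonNeg x) (normSq-nonNeg v)) (1≤normSq-1+ x 0≤a) ⟩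
      M * (R * normSq v)      ≡⟨ *-assoc M R (normSq v) ⟨
      M * R * normSq v        ∎

-- Passage to the limit

0≤2 : 0ℚ ≤ # 2
0≤2 = nonNegative⁻¹ (# 2)

-- The substitute for the triangle inequality when only squared norms are available; the defect is
-- |z - w|².
normSq-+ : ∀ z w → normSq (z +ᵍ w) ≤ # 2 * normSq z + # 2 * normSq w
normSq-+ (a , b) (c , d) = ≤-by ((a - c) * (a - c) + (b - d) * (b - d))
  (solve 4 (λ a b c d → :# 2 :* (a :* a :+ b :* b) :+ :# 2 :* (c :* c :+ d :* d)
    :- ((a :+ c) :* (a :+ c) :+ (b :+ d) :* (b :+ d))
    := (a :- c) :* (a :- c) :+ (b :- d) :* (b :- d)) refl a b c d)
  (normSq-nonNeg (a - c , b - d))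

normSq-neg : ∀ z → normSq (-ᵍ z) ≡ normSq z
normSq-neg (a , b) = solve 2 (λ a b → :- a :* :- a :+ :- b :* :- b := a :* a :+ b :* b) refl a b

normSq-ι : ∀ q → normSq (ιᵍ q) ≡ q * q
normSq-ι q = solve 1 (λ q → q :* q :+ :# 0 :* :# 0 := q :* q) refl q

distSq : ℚi → ℚi → ℚ
distSq z w = normSq (z +ᵍ -ᵍ w)

normSq-near : ∀ z w → normSq w ≤ # 2 * normSq z + # 2 * distSq z w
normSq-near z w = subst (λ u → normSq u ≤ # 2 * normSq z + # 2 * distSq z w)
  (subtract-difference z w)
  (subst (λ u → normSq (z +ᵍ -ᵍ (z +ᵍ -ᵍ w)) ≤ # 2 * normSq z + # 2 * u) (normSq-neg (z +ᵍ -ᵍ w))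
    (normSq-+ z (-ᵍ (z +ᵍ -ᵍ w))))

smallMultiple : ∀ {K ε} → 0ℚ ≤ K → 0ℚ < ε → ∃ λ θ → 0ℚ < θ × K * θ ≤ ε
smallMultiple {K} {ε} 0≤K 0<ε =
  let r , 0<r , eq = reciprocal (+-mono-≤-< 0≤K 0<1)
  in r * ε , *-pos 0<r 0<ε , ≤-by (r * ε)
       (trans (cong (_- K * (r * ε)) (sym (trans (cong (_* ε) eq) (*-identityˡ ε))))
         (solve 3 (λ c r e → (c :+ :# 1) :* r :* e :- c :* (r :* e) := r :* e) refl K r ε))
       (<⇒≤ (*-pos 0<r 0<ε))

-- The minimum of 1 and ε replaces a square root, which may be irrational.
smallSquare : ∀ {ε} → 0ℚ < ε → ∃ λ δ → 0ℚ < δ × δ * δ ≤ ε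
smallSquare {ε} 0<ε = 1ℚ ⊓ ε , 0<δ ,
  ≤-trans (*-mono-≤ {1ℚ ⊓ ε} {1ℚ} {1ℚ ⊓ ε} {ε} (<⇒≤ 0<1) (<⇒≤ 0<δ) (p⊓q≤p 1ℚ ε) (p⊓q≤q 1ℚ ε))
      (≤-reflexive (*-identityˡ ε))
  where
  0<δ : 0ℚ < 1ℚ ⊓ ε
  0<δ = ⊓-pos 0<1 0<ε

square-≤ : ∀ {d δ} → ∣ d ∣ ≤ δ → d * d ≤ δ * δ
square-≤ {d} d≤δ = ≤-trans (≤∣∣ (d * d)) (∣∣-*-≤ {d} {d} d≤δ d≤δ)

⟦⟧-normSq-bounded : ∀ {B} → 0ℚ ≤ B → ∀ p → ∃ λ M →
    0ℚ ≤ M × (∀ x → normSq x ≤ B → normSq (⟦ p ⟧ x) ≤ M)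
⟦⟧-normSq-bounded 0≤B [] = 0ℚ , ≤-refl , λ _ _ → ≤-refl
⟦⟧-normSq-bounded {B} 0≤B (a ∷ p) =
  let M , 0≤M , bound = ⟦⟧-normSq-bounded 0≤B p
  in # 2 * (a * a) + # 2 * (B * M) , +-nonNeg (*-nonNeg 0≤2 (square-nonNeg a))
      (*-nonNeg 0≤2 (*-nonNeg 0≤B 0≤M)) , λ x x≤B →
     ≤-trans (normSq-+ (ιᵍ a) (x *ᵍ ⟦ p ⟧ x))
       (+-mono-≤ (≤-reflexive (cong (# 2 *_) (normSq-ι a)))
         (*-monoˡ-≤ 0≤2 (≤-trans (≤-reflexive (normSq-* x (⟦ p ⟧ x)))
           (*-mono-≤ 0≤B (normSq-nonNeg (⟦ p ⟧ x)) x≤B (bound x x≤B)))))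

⟦⟧-continuous : ∀ {B} → 0ℚ ≤ B → ∀ p {ε} → 0ℚ < ε →
  ∃ λ δ → 0ℚ < δ × (∀ q x → normSq x ≤ B → Close δ p q → distSq (⟦ p ⟧ x) (⟦ q ⟧ x) ≤ ε)
⟦⟧-continuous 0≤B [] 0<ε = 1ℚ , 0<1 , λ { [] x x≤B [] → <⇒≤ 0<ε }
⟦⟧-continuous {B} 0≤B (a ∷ p) {ε} 0<ε =
  let θ , 0<θ , 2Bθ≤ = smallMultiple (*-nonNeg 0≤2 0≤B) (half-pos 0<ε)
      δ₁ , 0<δ₁ , close = ⟦⟧-continuous 0≤B p 0<θ
      τ , 0<τ , 2τ≤ = smallMultiple 0≤2 (half-pos 0<ε)
      δ₂ , 0<δ₂ , δ₂²≤τ = smallSquare 0<τ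
  in δ₁ ⊓ δ₂ , ⊓-pos 0<δ₁ 0<δ₂ , λ { (b ∷ q) x x≤B (a~b ∷ p~q) → begin
    normSq (ιᵍ a +ᵍ x *ᵍ ⟦ p ⟧ x +ᵍ -ᵍ (ιᵍ b +ᵍ x *ᵍ ⟦ q ⟧ x))
      ≡⟨ cong normSq (difference-∷ (ιᵍ a) (ιᵍ b) x (⟦ p ⟧ x) (⟦ q ⟧ x)) ⟩
    normSq (ιᵍ (a - b) +ᵍ x *ᵍ (⟦ p ⟧ x +ᵍ -ᵍ ⟦ q ⟧ x))
      ≤⟨ normSq-+ (ιᵍ (a - b)) (x *ᵍ (⟦ p ⟧ x +ᵍ -ᵍ ⟦ q ⟧ x)) ⟩
    # 2 * normSq (ιᵍ (a - b)) + # 2 * normSq (x *ᵍ (⟦ p ⟧ x +ᵍ -ᵍ ⟦ q ⟧ x))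
      ≡⟨ cong₂ (λ u v → # 2 * u + # 2 * v) (normSq-ι (a - b)) (normSq-* x (⟦ p ⟧ x +ᵍ -ᵍ ⟦ q ⟧ x)) ⟩
    # 2 * ((a - b) * (a - b)) + # 2 * (normSq x * distSq (⟦ p ⟧ x) (⟦ q ⟧ x))
      ≤⟨ +-mono-≤
           (*-monoˡ-≤ 0≤2 (≤-trans (square-≤ {a - b} (<⇒≤ (<-≤-trans a~b (p⊓q≤q δ₁ δ₂)))) δ₂²≤τ))
           (*-monoˡ-≤ 0≤2 (*-mono-≤ 0≤B (normSq-nonNeg (⟦ p ⟧ x +ᵍ -ᵍ ⟦ q ⟧ x)) x≤B
             (close q x x≤B (Close-mono (p⊓q≤p δ₁ δ₂) p~q)))) ⟩
    # 2 * τ + # 2 * (B * θ)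
      ≤⟨ +-mono-≤ 2τ≤ (≤-trans (≤-reflexive (sym (*-assoc (# 2) B θ))) 2Bθ≤) ⟩
    ½ * ε + ½ * ε
      ≡⟨ half+half ε ⟩
    ε ∎ }
  where open ≤-Reasoning

distSq-* : ∀ {M ε} z w z′ w′ → 0ℚ ≤ M → 0ℚ ≤ ε → ε ≤ 1ℚ → normSq z ≤ M → normSq w ≤ M → distSq z z′
    ≤ ε → distSq w w′ ≤ ε →
  distSq (z *ᵍ w) (z′ *ᵍ w′) ≤ (# 6 * M + # 4) * ε
distSq-* {M} {ε} z w z′ w′ 0≤M 0≤ε ε≤1 z≤M w≤M z~z′ w~w′ = begin
  distSq (z *ᵍ w) (z′ *ᵍ w′)
    ≡⟨ cong normSq (difference-* z w z′ w′) ⟩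
  normSq (z *ᵍ (w +ᵍ -ᵍ w′) +ᵍ w′ *ᵍ (z +ᵍ -ᵍ z′))
    ≤⟨ normSq-+ (z *ᵍ (w +ᵍ -ᵍ w′)) (w′ *ᵍ (z +ᵍ -ᵍ z′)) ⟩
  # 2 * normSq (z *ᵍ (w +ᵍ -ᵍ w′)) + # 2 * normSq (w′ *ᵍ (z +ᵍ -ᵍ z′))
    ≡⟨ cong₂ (λ u v → # 2 * u + # 2 * v) (normSq-* z (w +ᵍ -ᵍ w′)) (normSq-* w′ (z +ᵍ -ᵍ z′)) ⟩
  # 2 * (normSq z * distSq w w′) + # 2 * (normSq w′ * distSq z z′)
    ≤⟨ +-mono-≤
         (*-monoˡ-≤ 0≤2 (*-mono-≤ 0≤M (normSq-nonNeg (w +ᵍ -ᵍ w′)) z≤M w~w′))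
         (*-monoˡ-≤ 0≤2 (*-mono-≤ (+-nonNeg (*-nonNeg 0≤2 0≤M) 0≤2) (normSq-nonNeg (z +ᵍ -ᵍ z′)) w′≤
           z~z′)) ⟩
  # 2 * (M * ε) + # 2 * ((# 2 * M + # 2) * ε)
    ≡⟨ solve 2 (λ m e → :# 2 :* (m :* e) :+ :# 2 :* ((:# 2 :* m :+ :# 2) :* e)
         := (:# 6 :* m :+ :# 4) :* e) refl M ε ⟩
  (# 6 * M + # 4) * ε ∎
  where
  open ≤-Reasoning
  -- This is where ε ≤ 1 enters. The constant 6 M + 4 is 2 M from the first summand plus 2 (2 M + 2)
  -- from the second.
  w′≤ : normSq w′ ≤ # 2 * M + # 2
  w′≤ = ≤-trans (normSq-near w w′) (+-mono-≤ (*-monoˡ-≤ 0≤2 w≤M)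
      (≤-trans (*-monoˡ-≤ 0≤2 (≤-trans w~w′ ε≤1)) (≤-reflexive (*-identityʳ (# 2)))))

distSq-turánForm : ∀ {Q D} α β f g h f′ g′ h′ → 0ℚ ≤ Q → normSq α ≤ Q → normSq β ≤ Q →
  distSq (g *ᵍ g) (g′ *ᵍ g′) ≤ D → distSq (f *ᵍ h) (f′ *ᵍ h′) ≤ D →
  distSq (turánForm α β f g h) (turánForm α β f′ g′ h′) ≤ # 4 * Q * D
distSq-turánForm {Q} {D} α β f g h f′ g′ h′ 0≤Q α≤Q β≤Q gg~ fh~ = begin
  distSq (turánForm α β f g h) (turánForm α β f′ g′ h′)
    ≡⟨ cong normSq (difference-turánForm α β f g h f′ g′ h′) ⟩
  normSq (α *ᵍ d₁ +ᵍ -ᵍ (β *ᵍ d₂))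
    ≤⟨ normSq-+ (α *ᵍ d₁) (-ᵍ (β *ᵍ d₂)) ⟩
  # 2 * normSq (α *ᵍ d₁) + # 2 * normSq (-ᵍ (β *ᵍ d₂))
    ≡⟨ cong₂ (λ u v → # 2 * u + # 2 * v) (normSq-* α d₁)
      (trans (normSq-neg (β *ᵍ d₂)) (normSq-* β d₂)) ⟩
  # 2 * (normSq α * normSq d₁) + # 2 * (normSq β * normSq d₂)
    ≤⟨ +-mono-≤ (*-monoˡ-≤ 0≤2 (*-mono-≤ 0≤Q (normSq-nonNeg d₁) α≤Q gg~))
      (*-monoˡ-≤ 0≤2 (*-mono-≤ 0≤Q (normSq-nonNeg d₂) β≤Q fh~)) ⟩
  # 2 * (Q * D) + # 2 * (Q * D)
    ≡⟨ solve 2 (λ q d → :# 2 :* (q :* d) :+ :# 2 :* (q :* d) := :# 4 :* q :* d) refl Q D ⟩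
  # 4 * Q * D ∎
  where
  open ≤-Reasoning
  d₁ = g *ᵍ g +ᵍ -ᵍ (g′ *ᵍ g′)
  d₂ = f *ᵍ h +ᵍ -ᵍ (f′ *ᵍ h′)

-- Transfer of the lower bound to limits

Close-at-0 : ∀ {δ} p q → 0ℚ < δ → Close δ p q → ∣ Real.⟦ p ⟧ 0ℚ - Real.⟦ q ⟧ 0ℚ ∣ < δ
Close-at-0 []      []      0<δ []         = 0<δ
Close-at-0 (a ∷ p) (b ∷ q) 0<δ (a~b ∷ _) = subst (λ u → ∣ u ∣ < _)
  (solve 4 (λ a b u v → a :- b := a :+ :# 0 :* u :- (b :+ :# 0 :* v))
    refl a b (Real.⟦ p ⟧ 0ℚ) (Real.⟦ q ⟧ 0ℚ)) a~b

¼ : ℚ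
¼ = ½ * ½

0<¼ : 0ℚ < ¼
0<¼ = half-pos 0<½

-- One split polynomial q must serve all three approximations: the bounds for split polynomials
-- concern the triple q, G q, H q with G and H applied to that same q.
simultaneous-approximation : ∀ {p} (G H : Poly → Poly) →
  ContinuousAt G p → ContinuousAt H p → LimitOfSplits p → Real.⟦ p ⟧ 0ℚ ≡ 1ℚ →
  ∀ {B Δ} → 0ℚ ≤ B → 0ℚ < Δ → ∃ λ c → ∃ λ σs → let q = split c σs in
    Between -1ℚ σs 0ℚ × ½ < Real.⟦ q ⟧ 0ℚ ×
    (∀ x → normSq x ≤ B → distSq (⟦ p ⟧ x) (⟦ q ⟧ x) ≤ Δ × distSq (⟦ G p ⟧ x) (⟦ G q ⟧ x)
      ≤ Δ × distSq (⟦ H p ⟧ x) (⟦ H q ⟧ x) ≤ Δ)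
simultaneous-approximation {p} G H contG contH limit p0≡1 {B} {Δ} 0≤B 0<Δ
  with ⟦⟧-continuous 0≤B p 0<Δ | ⟦⟧-continuous 0≤B (G p) 0<Δ | ⟦⟧-continuous 0≤B (H p) 0<Δ
... | δf , 0<δf , closef | δg′ , 0<δg′ , closeg | δh′ , 0<δh′ , closeh
  with contG 0<δg′ | contH 0<δh′
... | δg , 0<δg , closeG | δh , 0<δh , closeH
  -- The cap ½ on the tolerance keeps the value at 0, which is 1 for p, above ½ for the approximant.
  with limit ((δf ⊓ ½) ⊓ (δg ⊓ δh)) (⊓-pos (⊓-pos 0<δf 0<½) (⊓-pos 0<δg 0<δh))
... | c , σs , _ , between , close =
  c , σs , between ,
  <-by (½ - (1ℚ - Real.⟦ q ⟧ 0ℚ)) (solve 2 (λ h v → v :- h := h :- (h :+ h :- v))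
      refl ½ (Real.⟦ q ⟧ 0ℚ))
    (difference (≤-<-trans (≤∣∣ (1ℚ - Real.⟦ q ⟧ 0ℚ))
      (<-≤-trans (subst (λ u → ∣ u - Real.⟦ q ⟧ 0ℚ ∣ < (δf ⊓ ½) ⊓ (δg ⊓ δh)) p0≡1
        (Close-at-0 p q (⊓-pos (⊓-pos 0<δf 0<½) (⊓-pos 0<δg 0<δh)) close))
        (≤-trans (p⊓q≤p (δf ⊓ ½) (δg ⊓ δh)) (p⊓q≤q δf ½))))) ,
  λ x x≤B →
    closef q x x≤B (Close-mono (≤-trans (p⊓q≤p (δf ⊓ ½) (δg ⊓ δh)) (p⊓q≤p δf ½)) close) ,
    closeg (G q) x x≤B (closeG q (Close-mono (≤-trans (p⊓q≤q (δf ⊓ ½) (δg ⊓ δh)) (p⊓q≤p δg δh))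
        close)) ,
    closeh (H q) x x≤B (closeH q (Close-mono (≤-trans (p⊓q≤q (δf ⊓ ½) (δg ⊓ δh)) (p⊓q≤q δg δh))
        close))
  where q = split c σs

perturbed-bound : ∀ {κ K Q M Δ} α β f g h f′ g′ h′ → 0ℚ < Q → 0ℚ ≤ M → 0ℚ < Δ → Δ ≤ 1ℚ →
  normSq α ≤ Q → normSq β ≤ Q → K ≤ Q → normSq f ≤ M → normSq g ≤ M → normSq h ≤ M →
  distSq f f′ ≤ Δ × distSq g g′ ≤ Δ × distSq h h′ ≤ Δ →
  κ ≤ K * normSq (turánForm α β f′ g′ h′) →
  κ ≤ # 2 * Q * normSq (turánForm α β f g h) + # 2 * Q * (# 4 * Q * (# 6 * M + # 4)) * Δ
perturbed-bound {κ} {K} {Q} {M} {Δ} α β f g h f′ g′ h′ 0<Q 0≤M 0<Δ Δ≤1 α≤Q β≤Q K≤Q f≤M g≤M h≤M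
    (f~ , g~ , h~) κ≤ = begin
  κ
    ≤⟨ κ≤ ⟩
  K * normSq T′
    ≤⟨ *-mono-≤ (<⇒≤ 0<Q) (normSq-nonNeg T′) K≤Q
      (≤-trans (normSq-near T T′) (+-monoʳ-≤ (# 2 * normSq T) (*-monoˡ-≤ 0≤2 T~T′))) ⟩
  Q * (# 2 * normSq T + # 2 * (# 4 * Q * ((# 6 * M + # 4) * Δ)))
    ≡⟨ solve 4 (λ q t m d → let D = (:# 6 :* m :+ :# 4) in
         q :* (:# 2 :* t :+ :# 2 :* (:# 4 :* q :* (D :* d)))
         := :# 2 :* q :* t :+ :# 2 :* q :* (:# 4 :* q :* D) :* d) refl Q (normSq T) M Δ ⟩
  # 2 * Q * normSq T + # 2 * Q * (# 4 * Q * (# 6 * M + # 4)) * Δ ∎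
  where
  open ≤-Reasoning
  T  = turánForm α β f g h
  T′ = turánForm α β f′ g′ h′
  T~T′ : distSq T T′ ≤ # 4 * Q * ((# 6 * M + # 4) * Δ)
  T~T′ = distSq-turánForm α β f g h f′ g′ h′ (<⇒≤ 0<Q) α≤Q β≤Q
    (distSq-* g g g′ g′ 0≤M (<⇒≤ 0<Δ) Δ≤1 g≤M g≤M g~ g~)
      (distSq-* f h f′ h′ 0≤M (<⇒≤ 0<Δ) Δ≤1 f≤M h≤M f~ h~)

common-bound : ∀ {B} → 0ℚ ≤ B → ∀ p q r → ∃ λ M → 0ℚ ≤ M × (∀ x → normSq x ≤ B →
  normSq (⟦ p ⟧ x) ≤ M × normSq (⟦ q ⟧ x) ≤ M × normSq (⟦ r ⟧ x) ≤ M)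
common-bound 0≤B p q r
  with ⟦⟧-normSq-bounded 0≤B p | ⟦⟧-normSq-bounded 0≤B q | ⟦⟧-normSq-bounded 0≤B r
... | K , 0≤K , p≤ | L , 0≤L , q≤ | M , 0≤M , r≤ =
  K + L + M , +-nonNeg (+-nonNeg 0≤K 0≤L) 0≤M , λ x x≤B →
    ≤-trans (p≤ x x≤B) (≤-by (L + M) (solve 3 (λ f g h → f :+ g :+ h :- f := g :+ h) refl K L M)
        (+-nonNeg 0≤L 0≤M)) ,
    ≤-trans (q≤ x x≤B) (≤-by (K + M) (solve 3 (λ f g h → f :+ g :+ h :- g := f :+ h) refl K L M)
        (+-nonNeg 0≤K 0≤M)) ,
    ≤-trans (r≤ x x≤B) (≤-by (K + L) (solve 3 (λ f g h → f :+ g :+ h :- h := f :+ g) refl K L M)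
        (+-nonNeg 0≤K 0≤L))

absorb-half : ∀ {κ t c r} → 0ℚ < r → c * r ≡ 1ℚ → κ ≤ c * t + ½ * κ → r * (½ * κ) ≤ t
absorb-half {κ} {t} {c} {r} 0<r cr≡1 κ≤ = begin
  r * (½ * κ)    ≤⟨ *-monoˡ-≤ (<⇒≤ 0<r) (≤-by (c * t + ½ * κ - κ) halve (difference-≤ κ≤)) ⟩
  r * (c * t)    ≡⟨ solve 3 (λ r c t → r :* (c :* t) := c :* r :* t) refl r c t ⟩
  c * r * t      ≡⟨ trans (cong (_* t) cr≡1) (*-identityˡ t) ⟩
  t              ∎
  where
  open ≤-Reasoning
  halve : c * t - ½ * κ ≡ c * t + ½ * κ - κ
  halve = trans (solve 2 (λ t h → t :- h := t :+ h :- (h :+ h)) refl (c * t) (½ * κ))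
      (cong (λ u → c * t + ½ * κ - u) (half+half κ))

nearby-bound : ∀ {ε Q K M Δ} α β (f g h f′ g′ h′ : ℚi) {a N r κ} → 0ℚ < r → # 2 * Q * r ≡ 1ℚ →
  κ ≡ # 4 * (ε * ε * (¼ * ¼)) → 0ℚ < ε → ε ≤ a → ¼ ≤ N → 0ℚ < Q → 0ℚ ≤ M → 0ℚ < Δ → Δ ≤ 1ℚ →
  # 2 * Q * (# 4 * Q * (# 6 * M + # 4)) * Δ ≤ ½ * κ →
  normSq α ≤ Q × normSq β ≤ Q × K ≤ Q → normSq f ≤ M × normSq g ≤ M × normSq h ≤ M →
  distSq f f′ ≤ Δ × distSq g g′ ≤ Δ × distSq h h′ ≤ Δ →
  # 4 * (a * a * (N * N)) ≤ K * normSq (turánForm α β f′ g′ h′) →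
  r * (½ * κ) ≤ normSq (turánForm α β f g h)
nearby-bound {ε} {Q} α β f g h f′ g′ h′ {a} {N} 0<r 2Qr≡1 refl 0<ε ε≤a ¼≤N 0<Q 0≤M 0<Δ Δ≤1 CΔ≤
    (α≤Q , β≤Q , K≤Q) (f≤M , g≤M , h≤M) near bound =
  absorb-half {c = # 2 * Q} 0<r 2Qr≡1 (≤-trans
    (perturbed-bound α β f g h f′ g′ h′ 0<Q 0≤M 0<Δ Δ≤1 α≤Q β≤Q K≤Q f≤M g≤M h≤M near (≤-trans
      (*-monoˡ-≤ (nonNegative⁻¹ (# 4)) (*-mono-≤ (square-nonNeg a) (square-nonNeg ¼)
        (*-mono-≤ (≤-trans (<⇒≤ 0<ε) ε≤a) (<⇒≤ 0<ε) ε≤a ε≤a)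
        (*-mono-≤ (≤-trans (<⇒≤ 0<¼) ¼≤N) (<⇒≤ 0<¼) ¼≤N ¼≤N)))
      bound))
    (+-monoʳ-≤ (# 2 * Q * normSq (turánForm α β f g h)) CΔ≤))

-- The bound `κ` for split polynomials does not depend on the approximant, and the approximation
-- error is uniform for |x|² ≤ B. An approximant whose error uses up at most half of `κ` leaves the
-- other half for the limit.
turánForm-lower-bound : ∀ {p} (G H : Poly → Poly) (α β : ℚi → ℚi) →
  ContinuousAt G p → ContinuousAt H p → LimitOfSplits p → Real.⟦ p ⟧ 0ℚ ≡ 1ℚ →
  ∀ {ε B Q} → 0ℚ < ε → 0ℚ ≤ B → 0ℚ < Q →
  (∀ {x} → normSq x ≤ B → normSq (α x) ≤ Q × normSq (β x) ≤ Q × normSq (#ᵍ 1 +ᵍ x) ≤ Q) →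
  (∀ {c} σs {x} → 0ℚ < re x → Between -1ℚ σs 0ℚ → let q = split c σs ; N = normSq (⟦ q ⟧ x) in 0ℚ
    < N →
    # 4 * (re x * re x * (N * N))
        ≤ normSq (#ᵍ 1 +ᵍ x) * normSq (turánForm (α x) (β x) (⟦ q ⟧ x) (⟦ G q ⟧ x) (⟦ H q ⟧ x))) →
  ∃ λ η → 0ℚ < η × (∀ x → ε ≤ re x → normSq x ≤ B →
    η ≤ normSq (turánForm (α x) (β x) (⟦ p ⟧ x) (⟦ G p ⟧ x) (⟦ H p ⟧ x)))
turánForm-lower-bound {p} G H α β contG contH limit p0≡1 {ε} {B} {Q} 0<ε 0≤B 0<Q αβ≤Q split-bound =
  let M , 0≤M , fgh≤M = common-bound 0≤B p (G p) (H p)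
      0≤C = *-nonNeg (*-nonNeg 0≤2 (<⇒≤ 0<Q)) (*-nonNeg (*-nonNeg (nonNegative⁻¹ (# 4)) (<⇒≤ 0<Q))
          (+-nonNeg (*-nonNeg (nonNegative⁻¹ (# 6)) 0≤M) (nonNegative⁻¹ (# 4))))
      θ , 0<θ , Cθ≤ = smallMultiple 0≤C (half-pos 0<κ)
      c , σs , between , ½<q0 , near = simultaneous-approximation G H contG contH limit p0≡1 0≤B
          (⊓-pos 0<1 0<θ)
      r , 0<r , 2Qr≡1 = reciprocal (*-pos (positive⁻¹ (# 2)) 0<Q)
  in r * (½ * κ) , *-pos 0<r (half-pos 0<κ) , conclusion M 0≤M fgh≤M (1ℚ ⊓ θ) (⊓-pos 0<1 0<θ)
      (p⊓q≤p 1ℚ θ)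
       (≤-trans (*-monoˡ-≤ 0≤C (p⊓q≤q 1ℚ θ)) Cθ≤) c σs between ½<q0 near r 0<r 2Qr≡1
  where
  -- The least value of 4 (Re x)² N² on the region: Re x ≥ ε, and N ≥ ¼ since a split polynomial
  -- above ½ at 0 has squared norm at least ¼ there.
  κ = # 4 * (ε * ε * (¼ * ¼))
  0<κ : 0ℚ < κ
  0<κ = *-pos (positive⁻¹ (# 4)) (*-pos (square-pos 0<ε) (square-pos 0<¼))
  conclusion : ∀ M → 0ℚ ≤ M →
    (∀ x → normSq x ≤ B → normSq (⟦ p ⟧ x) ≤ M × normSq (⟦ G p ⟧ x) ≤ M × normSq (⟦ H p ⟧ x) ≤ M) →
    ∀ Δ → 0ℚ < Δ → Δ ≤ 1ℚ → # 2 * Q * (# 4 * Q * (# 6 * M + # 4)) * Δ ≤ ½ * κ →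
    ∀ c σs → Between -1ℚ σs 0ℚ → let q = split c σs in ½ < Real.⟦ q ⟧ 0ℚ →
    (∀ x → normSq x ≤ B → distSq (⟦ p ⟧ x) (⟦ q ⟧ x) ≤ Δ × distSq (⟦ G p ⟧ x) (⟦ G q ⟧ x)
      ≤ Δ × distSq (⟦ H p ⟧ x) (⟦ H q ⟧ x) ≤ Δ) →
    ∀ r → 0ℚ < r → # 2 * Q * r ≡ 1ℚ →
    ∀ x → ε ≤ re x → normSq x ≤ B → r * (½ * κ)
        ≤ normSq (turánForm (α x) (β x) (⟦ p ⟧ x) (⟦ G p ⟧ x) (⟦ H p ⟧ x))
  conclusion M 0≤M fgh≤M Δ 0<Δ Δ≤1 CΔ≤ c σs between ½<q0 near r 0<r 2Qr≡1 x ε≤a x≤B =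
    nearby-bound {ε} {Q} {normSq (#ᵍ 1 +ᵍ x)} {M} {Δ} (α x) (β x) (⟦ p ⟧ x) (⟦ G p ⟧ x) (⟦ H p ⟧ x)
        (⟦ q ⟧ x) (⟦ G q ⟧ x) (⟦ H q ⟧ x)
      {re x} {normSq (⟦ q ⟧ x)} {r} {κ} 0<r 2Qr≡1 refl 0<ε ε≤a ¼≤N 0<Q 0≤M 0<Δ Δ≤1 CΔ≤
          (αβ≤Q {x} x≤B) (fgh≤M x x≤B) (near x x≤B)
      (split-bound {c} σs {x} (<-≤-trans 0<ε ε≤a) between (<-≤-trans 0<¼ ¼≤N))
    where
    q = split c σs
    ¼≤N : ¼ ≤ normSq (⟦ q ⟧ x)
    ¼≤N = ≤-trans (*-mono-≤ (<⇒≤ (<-trans 0<½ ½<q0)) (<⇒≤ 0<½) (<⇒≤ ½<q0) (<⇒≤ ½<q0))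
      (split-normSq {c} {x = x} σs (≤-trans (<⇒≤ 0<ε) ε≤a) between)

-- Lower bounds for the Turán polynomials

open Powers ℚ[i]
open TuránFactorisation ℚ[i]
module Gaussian = EvaluationAt.ℤ⇒ ℚ[i]

oddStep-at-0 : ∀ p → Real.⟦ oddStep p ⟧ 0ℚ ≡ Real.⟦ p ⟧ 0ℚ
oddStep-at-0 p = trans (Steps.⟦⟧-oddStep ℚ-algebra p 0ℚ)
  (solve 3 (λ f n f₁ → f :+ :# 2 :* :# 0 :* (n :* f :+ (:# 1 :- :# 0) :* f₁) := f) refl
    (Real.⟦ p ⟧ 0ℚ) (# (degree p)) (Real.⟦ ℚ[x].derivative p ⟧ 0ℚ))

evenStep-at-0 : ∀ p → Real.⟦ evenStep p ⟧ 0ℚ ≡ Real.⟦ p ⟧ 0ℚ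
evenStep-at-0 p = trans (Steps.⟦⟧-evenStep ℚ-algebra p 0ℚ)
  (solve 3 (λ f n f₁ → (:# 1 :+ :# 3 :* :# 0) :* f
    :+ :# 2 :* :# 0 :* (:# 1 :+ :# 0) :* (n :* f :+ (:# 1 :- :# 0) :* f₁) := f) refl
    (Real.⟦ p ⟧ 0ℚ) (# (degree p)) (Real.⟦ ℚ[x].derivative p ⟧ 0ℚ))

oddReduced-at-0 : ∀ k → Real.⟦ oddReduced k ⟧ 0ℚ ≡ 1ℚ
evenReduced-at-0 : ∀ k → Real.⟦ evenReduced k ⟧ 0ℚ ≡ 1ℚ
oddReduced-at-0 zero    = refl
oddReduced-at-0 (suc k) = trans (oddStep-at-0 (evenReduced k)) (evenReduced-at-0 k)
evenReduced-at-0 k      = trans (evenStep-at-0 (oddReduced k)) (oddReduced-at-0 k)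

normSq-1+-bounded : ∀ {B x} → normSq x ≤ B → normSq (#ᵍ 1 +ᵍ x) ≤ # 2 + # 2 * B
normSq-1+-bounded {B} {x} x≤B = ≤-trans (normSq-+ (#ᵍ 1) x) (+-monoʳ-≤ (# 2) (*-monoˡ-≤ 0≤2 x≤B))

1≤normSq-^ : ∀ {x} k → 0ℚ ≤ re x → 1ℚ ≤ normSq ((#ᵍ 1 +ᵍ x) ^ k)
1≤normSq-^ zero 0≤a = ≤-refl
1≤normSq-^ {x} (suc k) 0≤a = subst (1ℚ ≤_) (sym (normSq-* (#ᵍ 1 +ᵍ x) ((#ᵍ 1 +ᵍ x) ^ k)))
  (*-mono-≤ {1ℚ} {normSq (#ᵍ 1 +ᵍ x)} {1ℚ} (normSq-nonNeg (#ᵍ 1 +ᵍ x)) (<⇒≤ 0<1) (1≤normSq-1+ x 0≤a)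
    (1≤normSq-^ {x} k 0≤a))

module _ {ε B : ℚ} (0<ε : 0ℚ < ε) (0≤B : 0ℚ ≤ B) where
  private
    -- A common bound for both coefficients 1 and 1 + x in squared norm, since |1 + x|² ≤ 2 + 2
    -- |x|².
    Q = # 2 + # 2 * B
    1≤Q : 1ℚ ≤ Q
    1≤Q = ≤-by (1ℚ + # 2 * B) (solve 1 (λ b → :# 2 :+ :# 2 :* b :- :# 1 := :# 1 :+ :# 2 :* b)
        refl B)
      (+-nonNeg (<⇒≤ 0<1) (*-nonNeg 0≤2 0≤B))
    0<Q : 0ℚ < Q
    0<Q = <-≤-trans 0<1 1≤Q

  BoundedBelow : (ℚi → ℚi) → Set
  BoundedBelow f = ∃ λ η → 0ℚ < η × (∀ x → ε ≤ re x → normSq x ≤ B → η ≤ normSq (f x))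

  evenTurán-boundedBelow : ∀ k → BoundedBelow (evenTuránAt (evenReduced k))
  evenTurán-boundedBelow k = turánForm-lower-bound oddStep (λ p → evenStep (oddStep p))
      (λ x → #ᵍ 1 +ᵍ x) (λ _ → #ᵍ 1)
    (oddStep-continuous p) (∘-continuous {evenStep} {oddStep} (oddStep-continuous p)
      (evenStep-continuous (oddStep p)))
    (evenReduced-limit k) (evenReduced-at-0 k) 0<ε 0≤B 0<Q
    (λ {x} x≤B → normSq-1+-bounded {x = x} x≤B , 1≤Q , normSq-1+-bounded {x = x} x≤B)
    (λ {c} σs {x} 0<a between → evenTurán-bound {c} σs {x} 0<a between)
    where p = evenReduced k

  oddTurán-boundedBelow : ∀ k → BoundedBelow (oddTuránAt (oddReduced k))
  oddTurán-boundedBelow k = turánForm-lower-bound evenStep (λ p → oddStep (evenStep p)) (λ _ → #ᵍ 1)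
      (λ x → #ᵍ 1 +ᵍ x)
    (evenStep-continuous p) (∘-continuous {oddStep} {evenStep} (evenStep-continuous p)
      (oddStep-continuous (evenStep p)))
    (oddReduced-limit k) (oddReduced-at-0 k) 0<ε 0≤B 0<Q
    (λ {x} x≤B → 1≤Q , normSq-1+-bounded {x = x} x≤B , normSq-1+-bounded {x = x} x≤B)
    (λ {c} σs {x} 0<a between → oddTurán-bound {c} σs {x} 0<a between)
    where p = oddReduced k

  ε²≤normSq : ∀ x k → ε ≤ re x → ε * ε ≤ normSq (x *ᵍ (#ᵍ 1 +ᵍ x) ^ k)
  ε²≤normSq x k ε≤a = begin
    ε * ε
        ≤⟨ *-mono-≤ (≤-trans (<⇒≤ 0<ε) ε≤a) (<⇒≤ 0<ε) ε≤a ε≤a ⟩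
    re x * re x                                  ≤⟨ re²≤normSq x ⟩
    normSq x                                     ≡⟨ *-identityʳ (normSq x) ⟨
    normSq x * 1ℚ
        ≤⟨ *-monoˡ-≤ (normSq-nonNeg x) (1≤normSq-^ {x} k (≤-trans (<⇒≤ 0<ε) ε≤a)) ⟩
    normSq x * normSq ((#ᵍ 1 +ᵍ x) ^ k)          ≡⟨ normSq-* x ((#ᵍ 1 +ᵍ x) ^ k) ⟨
    normSq (x *ᵍ (#ᵍ 1 +ᵍ x) ^ k)                ∎
    where open ≤-Reasoning

  scaled-boundedBelow : ∀ {f g} k → BoundedBelow g →
    (∀ x → let P = x *ᵍ (#ᵍ 1 +ᵍ x) ^ k in f x ≡ P *ᵍ P *ᵍ g x) → BoundedBelow f
  scaled-boundedBelow {f} {g} k (η , 0<η , bound) f≡ =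
      ε * ε * (ε * ε) * η , *-pos (square-pos (square-pos 0<ε)) 0<η , λ x ε≤a x≤B →
    let P = x *ᵍ (#ᵍ 1 +ᵍ x) ^ k
        P≥ = ε²≤normSq x k ε≤a
    in subst (ε * ε * (ε * ε) * η ≤_)
         (sym (trans (cong normSq (f≡ x))
           (trans (normSq-* (P *ᵍ P) (g x)) (cong (_* normSq (g x)) (normSq-* P P)))))
         (*-mono-≤ (square-nonNeg (normSq P)) (<⇒≤ 0<η)
           (*-mono-≤ (normSq-nonNeg P) (square-nonNeg ε) P≥ P≥) (bound x ε≤a x≤B))

  1+-boundedBelow : ∀ {g} → BoundedBelow g → BoundedBelow (λ x → (#ᵍ 1 +ᵍ x) *ᵍ g x)
  1+-boundedBelow {g} (η , 0<η , bound) = η , 0<η , λ x ε≤a x≤B →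
    subst₂ _≤_ (*-identityˡ η) (sym (normSq-* (#ᵍ 1 +ᵍ x) (g x)))
      (*-mono-≤ {1ℚ} (normSq-nonNeg (#ᵍ 1 +ᵍ x)) (<⇒≤ 0<η) (1≤normSq-1+ x (≤-trans (<⇒≤ 0<ε) ε≤a))
        (bound x ε≤a x≤B))

  parity : ∀ m → (∃ λ k → m ≡ double k) ⊎ (∃ λ k → m ≡ suc (double k))
  parity zero = inj₁ (0 , refl)
  parity (suc m) with parity m
  ... | inj₁ (k , refl) = inj₂ (k , refl)
  ... | inj₂ (k , refl) = inj₁ (suc k , refl)

  turán-boundedBelow : ∀ m → BoundedBelow Gaussian.⟦ turán (suc m) ⟧
  turán-boundedBelow m with parity m
  ... | inj₁ (k , refl) = scaled-boundedBelow k (oddTurán-boundedBelow k) (turán-odd k)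
  ... | inj₂ (k , refl) = scaled-boundedBelow k (1+-boundedBelow (evenTurán-boundedBelow k))
      (turán-even k)

-- From Gaussian rationals to complex numbers

eval-seq : ∀ p z i → let v = ℂ[x].eval (ℤ[x]⇒ℂ[x] p) z in
  (seq (Re v) i , seq (Im v) i) ≡ Gaussian.⟦ p ⟧ (seq (Re z) i , seq (Im z) i)
eval-seq []      z i = refl
-- Real arithmetic is termwise, so one Horner step over ℂ, read at index i, computes to the Horner
-- step over the Gaussian rationals.
eval-seq (a ∷ p) z i = cong (λ v → (a ℚ./ 1 , 0ℚ) +ᵍ (seq (Re z) i , seq (Im z) i) *ᵍ v)
    (eval-seq p z i)

square-bounded : ∀ x → ∃ λ B → 0ℚ ≤ B × ∃ λ N → ∀ {n} → N ℕ.≤ n → seq x n * seq x n ≤ B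
square-bounded x with cauchy x 1ℚ 0<1
... | N , close = b * b , square-nonNeg b , N , λ {n} N≤n → square-≤ {seq x n} (begin
    ∣ seq x n ∣                                  ≡⟨ cong ∣_∣ (solve 2 (λ u v → u := v :+ (u :- v))
        refl (seq x n) (seq x N)) ⟩
    ∣ seq x N + (seq x n - seq x N) ∣            ≤⟨ ∣p+q∣≤∣p∣+∣q∣ (seq x N) (seq x n - seq x N) ⟩
    ∣ seq x N ∣ + ∣ seq x n - seq x N ∣          ≤⟨ +-monoʳ-≤ ∣ seq x N ∣ (<⇒≤
        (close N≤n ℕₚ.≤-refl)) ⟩
    ∣ seq x N ∣ + 1ℚ                             ∎)
  where
  open ≤-Reasoning
  b = ∣ seq x N ∣ + 1ℚ

-- From some index on, the terms of z stay in one region Re x ≥ ε, |x|² ≤ B. There the squared norms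
-- of the values stay above a fixed η, so the values cannot tend to zero.
turán-nonzero : ∀ m z → 0ᵣ <ᵣ Re z →
    ¬ (RawRing._≈_ ℂ-rawRing (ℂ[x].eval (ℤ[x]⇒ℂ[x] (turán (suc m))) z) (RawRing.0# ℂ-rawRing))
turán-nonzero m z (ε , 0<ε , N₁ , ε<) (re≈0 , im≈0) =
  let B₁ , 0≤B₁ , N₂ , re≤ = square-bounded (Re z)
      B₂ , 0≤B₂ , N₃ , im≤ = square-bounded (Im z)
      η , 0<η , bound = turán-boundedBelow 0<ε (+-nonNeg 0≤B₁ 0≤B₂) m
      -- The squares of the real and the imaginary part will be at most τ each, hence at most half
      -- of η together.
      τ , 0<τ , 2τ≤ = smallMultiple 0≤2 (half-pos 0<η)
      δ , 0<δ , δ²≤τ = smallSquare 0<τ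
      N₄ , re< = re≈0 δ 0<δ
      N₅ , im< = im≈0 δ 0<δ
      -- A single index beyond all five thresholds suffices; their sum serves as an upper bound.
      i = N₁ ℕ.+ (N₂ ℕ.+ (N₃ ℕ.+ (N₄ ℕ.+ N₅)))
  in contradict η 0<η bound τ 2τ≤ δ δ²≤τ i
       (subst (_< seq (Re z) i) (+-identityˡ ε) (ε< (ℕₚ.m≤m+n N₁ _)))
       (re≤ (ℕₚ.≤-trans (ℕₚ.m≤m+n N₂ _) (ℕₚ.m≤n+m _ N₁)))
       (im≤ (ℕₚ.≤-trans (ℕₚ.m≤m+n N₃ _) (ℕₚ.≤-trans (ℕₚ.m≤n+m _ N₂) (ℕₚ.m≤n+m _ N₁))))
       (re< (ℕₚ.≤-trans (ℕₚ.m≤m+n N₄ N₅)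
         (ℕₚ.≤-trans (ℕₚ.m≤n+m _ N₃) (ℕₚ.≤-trans (ℕₚ.m≤n+m _ N₂) (ℕₚ.m≤n+m _ N₁)))))
       (im< (ℕₚ.≤-trans (ℕₚ.m≤n+m N₅ N₄)
         (ℕₚ.≤-trans (ℕₚ.m≤n+m _ N₃) (ℕₚ.≤-trans (ℕₚ.m≤n+m _ N₂) (ℕₚ.m≤n+m _ N₁)))))
  where
  open ≤-Reasoning
  v = ℂ[x].eval (ℤ[x]⇒ℂ[x] (turán (suc m))) z
  contradict : ∀ {B₁ B₂} η → 0ℚ < η →
      (∀ x → ε ≤ re x → normSq x ≤ B₁ + B₂ → η ≤ normSq (Gaussian.⟦ turán (suc m) ⟧ x)) →
    ∀ τ → # 2 * τ ≤ ½ * η → ∀ δ → δ * δ ≤ τ → ∀ i → ε < seq (Re z) i →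
    seq (Re z) i * seq (Re z) i ≤ B₁ → seq (Im z) i * seq (Im z) i ≤ B₂ →
    ∣ seq (Re v) i - 0ℚ ∣ < δ → ¬ (∣ seq (Im v) i - 0ℚ ∣ < δ)
  contradict η 0<η bound τ 2τ≤ δ δ²≤τ i ε<a re≤ im≤ re<δ im<δ = <-irrefl refl (begin-strict
    η
        ≤⟨ bound (seq (Re z) i , seq (Im z) i) (<⇒≤ ε<a) (+-mono-≤ re≤ im≤) ⟩
    normSq (Gaussian.⟦ turán (suc m) ⟧ (seq (Re z) i , seq (Im z) i))
        ≡⟨ cong normSq (eval-seq (turán (suc m)) z i) ⟨
    seq (Re v) i * seq (Re v) i + seq (Im v) i * seq (Im v) i
        ≤⟨ +-mono-≤ (≤-trans (small (seq (Re v) i) re<δ) δ²≤τ)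
          (≤-trans (small (seq (Im v) i) im<δ) δ²≤τ) ⟩
    τ + τ
        ≡⟨ solve 1 (λ t → t :+ t := :# 2 :* t) refl τ ⟩
    # 2 * τ                                                    ≤⟨ 2τ≤ ⟩
    ½ * η
        <⟨ <-by (½ * η) (trans (cong (_- ½ * η) (sym (half+half η)))
          (solve 1 (λ h → h :+ h :- h := h) refl (½ * η))) (half-pos 0<η) ⟩
    η                                                          ∎)
    where
    small : ∀ u → ∣ u - 0ℚ ∣ < δ → u * u ≤ δ * δ
    small u u<δ = square-≤ {u} (≤-trans (≤-reflexive (cong ∣_∣ (sym (+-identityʳ u)))) (<⇒≤ u<δ))

proposition3p10 : (n : ℕ) → .{{_ : NonZero n}} → HurwitzStable (ℤ[x]⇒ℂ[x] (turán n))
proposition3p10 (suc m) = inj₂ (turán-nonzero m)
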